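{- (a) For Pythagorean $\mathbb F$ it holds that $\mathrm{sat}_{\mathrm L(\mathbb F^*)}\in\mathrm{BP}(\mathcal{NP}_{\mathrm{Re}\,\mathbb F})$. In particular, $\mathrm{sat}_{\mathrm L(\mathbb R^*)},\ \mathrm{sat}_{\mathrm L(\mathbb C^*)}\in\mathrm{BP}(\mathcal{NP}_{\mathbb R})$. (b) An ortholattice term is weakly (resp. strongly) satisfiable either in both or in none of $\mathrm L(\mathbb F^*)$ and $\mathrm L((\mathrm{Re}\,\mathbb F)^*)$; i.e. $\mathrm{SAT}_{\mathrm L(\mathbb F^*)}=\mathrm{SAT}_{\mathrm L((\mathrm{Re}\,\mathbb F)^*)}$ and $\mathrm{sat}_{\mathrm L(\mathbb F^*)}=\mathrm{sat}_{\mathrm L((\mathrm{Re}\,\mathbb F)^*)}$.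
   Context: $\mathbb F$ is a $*$-subfield of $\mathbb C$, i.e. a subfield closed under complex conjugation; it is assumed that $\mathbb F\subseteq\mathbb R$ or $\mathbb F=\mathbb F'+i\mathbb F'$ with $\mathbb F'=\mathbb F\cap\mathbb R$. $\mathrm{Re}\,\mathbb F=\{x:x,y\in\mathbb R,\ x+iy\in\mathbb F\}$. $\mathbb F$ is Pythagorean if in $\mathbb F\cap\mathbb R$ every sum of squares is a square. $\mathrm L(\mathbb F^d)$ is the ortholattice of linear subspaces of $\mathbb F^d$ under $\cap$, $+$, $^\perp$ (with respect to $\sum_i\overline{x_i}y_i$), $\{\vec0\}$ (as $0$), $\mathbb F^d$ (as $1$). An ortholattice term is built from variables with $\wedge,\vee,\neg,0,1$. It is strongly (weakly) satisfiable in an ortholattice $L$ if $t_L(\bar a)=1$ (resp. $\ne0$) for some assignment $\bar a$ in $L$; it is strongly (weakly) satisfiable in $\mathrm L(\mathbb F^*)$ if it is so in $\mathrm L(\mathbb F^d)$ for some $d\in\mathbb N=\{1,2,\ldots\}$. $\mathrm{SAT}_{\mathrm L(\mathbb F^*)}$ and $\mathrm{sat}_{\mathrm L(\mathbb F^*)}\subseteq\{0,1\}^*$ are the sets of binary encodings of terms strongly, resp. weakly, satisfiable in $\mathrm L(\mathbb F^*)$. A Blum-Shub-Smale (BSS) machine over a commutative ring $R$ stores, operates on ($+,-,\times$, and $\div$ over a field) and compares ($=$, and also $<$ in the ordered case) elements of $R$ at unit cost, with input in $R^*=\bigcup_nR^n$ and finitely many constants from $R$. $\mathcal{NP}_R$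 is the class of sets decidable by nondeterministic polynomial-time BSS machines over $R$ (guessing elements of $R$), and $\mathrm{BP}(\mathcal{NP}_R)=\{\mathcal L\cap\{0,1\}^*:\mathcal L\in\mathcal{NP}_R\}$. -}

module Defs where

open import Level using (0ℓ; _⊔_) renaming (suc to lsuc)
open import Algebra.Bundles using (CommutativeRing; AbelianGroup)
open import Algebra.Core using (Op₁; Op₂)
open import Algebra.Definitions using (Invertible)
import Algebra.Construct.DirectProduct as DirectProduct
import Algebra.Properties.CommutativeMonoid.Sum as CommutativeMonoidSum
import Algebra.Properties.Ring as RingProperties
import Algebra.Properties.Semiring.Sum as SemiringSum
import Algebra.Solver.Ring.NaturalCoefficients.Default as SemiringSolver
open import Data.Bool.Base using (Bool; true; false; if_then_else_)
open import Data.List.Base as List using (List; []; _∷_; _++_; length; drop; head)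
open import Data.Maybe.Base using (Maybe; just; nothing; fromMaybe)
open import Data.Nat.Base as ℕ using (ℕ; zero; suc)
import Data.Nat.Properties as ℕ
open import Data.Nat.Binary.Base as ℕᵇ using (ℕᵇ; 2[1+_]; 1+[2_])
open import Data.Product.Base using (Σ; ∃; ∃₂; _×_; _,_; proj₁; proj₂)
open import Data.Sum.Base using (_⊎_)
open import Data.Vec.Functional as Vector using (Vector; zipWith; replicate)
import Data.Vec.Functional.Relation.Binary.Equality.Setoid as VectorEquality
open import Function.Base using (_∘_; _on_)
open import Function.Bundles using (_⇔_)
open import Relation.Binary.Core using (Rel)
open import Relation.Binary.Definitions using (_Respects_)
import Relation.Binary.Construct.On as On
import Relation.Binary.Reasoning.Setoid as SetoidReasoning
open import Relation.Binary.PropositionalEquality.Core using (_≡_)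
open import Relation.Binary.Structures using (IsStrictTotalOrder)
open import Relation.Nullary.Decidable.Core using (does; yes; no)
open import Relation.Nullary.Negation.Core using (¬_)
open import Relation.Unary using (Pred; _∈_; _⊆_; _≐_; U)

record OrderedField : Set₁ where
  infix 4 _<_

  field
    commutativeRing : CommutativeRing 0ℓ 0ℓ

  open CommutativeRing commutativeRing public

  field
    _<_                : Rel Carrier 0ℓ
    isStrictTotalOrder : IsStrictTotalOrder _≈_ _<_
    0<1                : 0# < 1#
    +-monoʳ-<          : ∀ x {y z} → y < z → (x + y) < (x + z)
    *-positive         : ∀ {x y} → 0# < x → 0# < y → 0# < (x * y)
    invertible         : ∀ {x} → x ≉ 0# → Invertible _≈_ 1# _*_ x

  open IsStrictTotalOrder isStrictTotalOrder public
    using (_≟_; _<?_)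

  divide : ∀ (x : Carrier) {y} → y ≉ 0# → Carrier
  divide x y≉0 = x * proj₁ (invertible y≉0)

-- ℝ is given axiomatically, as a Dedekind-complete ordered field; such a
-- field is unique up to isomorphism.
record RealNumbers : Set₁ where
  field
    orderedField : OrderedField

  open OrderedField orderedField public

  UpperBound : Pred Carrier 0ℓ → Pred Carrier 0ℓ
  UpperBound P b = ∀ {x} → x ∈ P → ¬ (b < x)

  field
    supremum : (P : Pred Carrier 0ℓ) → ∃ P → ∃ (UpperBound P) →
               ∃ λ s → s ∈ UpperBound P × (∀ {b} → b ∈ UpperBound P → ¬ (b < s))

module _ (R : CommutativeRing 0ℓ 0ℓ) where

  open CommutativeRing R

  record IsSubfield (P : Pred Carrier 0ℓ) : Set where
    field
      resp      : P Respects _≈_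
      0∈        : 0# ∈ P
      1∈        : 1# ∈ P
      +-closed  : ∀ {x y} → x ∈ P → y ∈ P → (x + y) ∈ P
      *-closed  : ∀ {x y} → x ∈ P → y ∈ P → (x * y) ∈ P
      -‿closed  : ∀ {x} → x ∈ P → (- x) ∈ P
      ⁻¹-closed : ∀ {x y} → x ∈ P → (x * y) ≈ 1# → y ∈ P

  subring : ∀ {P} → IsSubfield P → CommutativeRing 0ℓ 0ℓ
  subring {P} isSubfield = record
    { Carrier = Σ Carrier P
    ; _≈_ = _≈_ on proj₁
    ; _+_ = λ (x , p) (y , q) → (x + y) , +-closed p q
    ; _*_ = λ (x , p) (y , q) → (x * y) , *-closed p q
    ; -_  = λ (x , p) → (- x) , -‿closed p
    ; 0#  = 0# , 0∈
    ; 1#  = 1# , 1∈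
    ; isCommutativeRing = record
      { isRing = record
        { +-isAbelianGroup = record
          { isGroup = record
            { isMonoid = record
              { isSemigroup = record
                { isMagma = record
                  { isEquivalence = On.isEquivalence proj₁ isEquivalence
                  ; ∙-cong = +-cong
                  }
                ; assoc = λ (x , _) (y , _) (z , _) → +-assoc x y z
                }
              ; identity = (λ (x , _) → +-identityˡ x) , (λ (x , _) → +-identityʳ x)
              }
            ; inverse = (λ (x , _) → -‿inverseˡ x) , (λ (x , _) → -‿inverseʳ x)
            ; ⁻¹-cong = -‿cong
            }
          ; comm = λ (x , _) (y , _) → +-comm x y
          }
        ; *-cong = *-cong
        ; *-assoc = λ (x , _) (y , _) (z , _) → *-assoc x y z
        ; *-identity = (λ (x , _) → *-identityˡ x) , (λ (x , _) → *-identityʳ x)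
        ; distrib = (λ (x , _) (y , _) (z , _) → distribˡ x y z)
                  , (λ (x , _) (y , _) (z , _) → distribʳ x y z)
        }
      ; *-comm = λ (x , _) (y , _) → *-comm x y
      }
    }
    where open IsSubfield isSubfield

suborderedField : (K : OrderedField) → ∀ {P} →
                  IsSubfield (OrderedField.commutativeRing K) P → OrderedField
suborderedField K isSubfield = record
  { commutativeRing    = subring commutativeRing isSubfield
  ; _<_                = _<_ on proj₁
  ; isStrictTotalOrder = On.isStrictTotalOrder proj₁ isStrictTotalOrder
  ; 0<1                = 0<1
  ; +-monoʳ-<          = λ (x , _) → +-monoʳ-< x
  ; *-positive         = *-positive
  ; invertible         = λ {(x , p)} x≉0 →
      let (y , yx≈1 , xy≈1) = invertible x≉0
      in (y , ⁻¹-closed p xy≈1) , yx≈1 , xy≈1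
  }
  where
  open OrderedField K
  open IsSubfield isSubfield

record RawOrtholattice c ℓ : Set (lsuc (c ⊔ ℓ)) where
  infix  8 ~_
  infixr 7 _∧_
  infixr 6 _∨_
  infix  4 _≈_
  field
    Carrier : Set c
    _≈_     : Rel Carrier ℓ
    _∧_     : Op₂ Carrier
    _∨_     : Op₂ Carrier
    ~_      : Op₁ Carrier
    0#      : Carrier
    1#      : Carrier

data Term : Set where
  var           : ℕ → Term
  bottom top    : Term
  not           : Term → Term
  _and_ _or_    : Term → Term → Term

module _ {c ℓ} (L : RawOrtholattice c ℓ) where

  open RawOrtholattice L

  ⟦_⟧ : Term → (ℕ → Carrier) → Carrier
  ⟦ var n   ⟧ a = a n
  ⟦ bottom  ⟧ a = 0#
  ⟦ top     ⟧ a = 1#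
  ⟦ not t   ⟧ a = ~ ⟦ t ⟧ a
  ⟦ s and t ⟧ a = ⟦ s ⟧ a ∧ ⟦ t ⟧ a
  ⟦ s or t  ⟧ a = ⟦ s ⟧ a ∨ ⟦ t ⟧ a

  StronglySatisfiable : Pred Term (c ⊔ ℓ)
  StronglySatisfiable t = ∃ λ a → ⟦ t ⟧ a ≈ 1#

  WeaklySatisfiable : Pred Term (c ⊔ ℓ)
  WeaklySatisfiable t = ∃ λ a → ¬ (⟦ t ⟧ a ≈ 0#)

-- Binary encoding: terms in prefix notation, each symbol being a codeword of
-- a prefix-free code.  A variable is followed by the digits of its index in
-- bijective base 2, each digit announced by true, the end marked by false.

encodeIndex : ℕᵇ → List Bool
encodeIndex ℕᵇ.zero  = false ∷ []
encodeIndex 2[1+ n ] = true ∷ false ∷ encodeIndex n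
encodeIndex 1+[2 n ] = true ∷ true  ∷ encodeIndex n

encode : Term → List Bool
encode (var n)   = false ∷ false ∷ encodeIndex (ℕᵇ.fromℕ n)
encode (not t)   = false ∷ true ∷ encode t
encode (s and t) = true ∷ false ∷ encode s ++ encode t
encode (s or t)  = true ∷ true ∷ false ∷ encode s ++ encode t
encode bottom    = true ∷ true ∷ true ∷ false ∷ []
encode top       = true ∷ true ∷ true ∷ true ∷ []

Encodings : ∀ {ℓ} → Pred Term ℓ → Pred (List Bool) ℓ
Encodings P w = ∃ λ t → w ≡ encode t × t ∈ P

module _ (𝔽 : CommutativeRing 0ℓ 0ℓ)
         (conj : Op₁ (CommutativeRing.Carrier 𝔽))
         (d : ℕ) where

  open CommutativeRing 𝔽
  open VectorEquality setoid
  open CommutativeMonoidSum +-commutativeMonoid using (sum; sum-cong-≋; ∑-distrib-+)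
  open SemiringSum semiring using (*-distribˡ-sum)
  open SetoidReasoning setoid
  open SemiringSolver commutativeSemiring using (solve; _:=_; _:+_; _:*_)

  V : Set
  V = Vector Carrier d

  infixl 6 _+ᵥ_
  infixr 7 _*ᵥ_

  0ᵥ : V
  0ᵥ = replicate d 0#

  _+ᵥ_ : Op₂ V
  _+ᵥ_ = zipWith _+_

  _*ᵥ_ : Carrier → Op₁ V
  c *ᵥ x = Vector.map (c *_) x

  ⟨_,_⟩ : V → V → Carrier
  ⟨ x , y ⟩ = sum (zipWith _*_ (conj ∘ x) y)

  record Subspace : Set₁ where
    field
      member   : Pred V 0ℓ
      resp     : member Respects _≋_
      0∈       : 0ᵥ ∈ member
      +-closed : ∀ {x y} → x ∈ member → y ∈ member → (x +ᵥ y) ∈ member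
      *-closed : ∀ c {x} → x ∈ member → (c *ᵥ x) ∈ member

  open Subspace

  zeroSubspace : Subspace
  zeroSubspace = record
    { member   = _≋ 0ᵥ
    ; resp     = λ x≋y x≋0 i → trans (sym (x≋y i)) (x≋0 i)
    ; 0∈       = λ _ → refl
    ; +-closed = λ x≋0 y≋0 i → trans (+-cong (x≋0 i) (y≋0 i)) (+-identityˡ 0#)
    ; *-closed = λ c x≋0 i → trans (*-congˡ (x≋0 i)) (zeroʳ c)
    }

  -- The closure conditions, being ⊤-valued, are found by η.
  wholeSpace : Subspace
  wholeSpace = record { member = U }

  _∩ₛ_ : Op₂ Subspace
  A ∩ₛ B = record
    { member   = λ x → x ∈ member A × x ∈ member B
    ; resp     = λ x≋y (p , q) → resp A x≋y p , resp B x≋y q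
    ; 0∈       = 0∈ A , 0∈ B
    ; +-closed = λ (p , q) (p′ , q′) → +-closed A p p′ , +-closed B q q′
    ; *-closed = λ c (p , q) → *-closed A c p , *-closed B c q
    }

  _+ₛ_ : Op₂ Subspace
  A +ₛ B = record
    { member   = λ z → ∃₂ λ x y → x ∈ member A × y ∈ member B × z ≋ (x +ᵥ y)
    ; resp     = λ z≋w (x , y , p , q , e) →
        x , y , p , q , λ i → trans (sym (z≋w i)) (e i)
    ; 0∈       = 0ᵥ , 0ᵥ , 0∈ A , 0∈ B , λ _ → sym (+-identityˡ 0#)
    ; +-closed = λ (x , y , p , q , e) (x′ , y′ , p′ , q′ , e′) →
        (x +ᵥ x′) , (y +ᵥ y′) , +-closed A p p′ , +-closed B q q′ ,
        λ i → trans (+-cong (e i) (e′ i))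
                    (solve 4 (λ a b c d → (a :+ b) :+ (c :+ d) := (a :+ c) :+ (b :+ d))
                             refl (x i) (y i) (x′ i) (y′ i))
    ; *-closed = λ c (x , y , p , q , e) →
        (c *ᵥ x) , (c *ᵥ y) , *-closed A c p , *-closed B c q ,
        λ i → trans (*-congˡ (e i)) (distribˡ c (x i) (y i))
    }

  _⊥ₛ : Op₁ Subspace
  A ⊥ₛ = record
    { member   = λ y → ∀ {x} → x ∈ member A → ⟨ x , y ⟩ ≈ 0#
    ; resp     = λ {y} {y′} y≋y′ p {x} q →
        trans (sum-cong-≋ (λ i → *-congˡ (sym (y≋y′ i)))) (p q)
    ; 0∈       = λ {x} _ → begin
        ⟨ x , 0ᵥ ⟩                  ≈⟨ sum-cong-≋ (λ i → *-comm (conj (x i)) 0#) ⟩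
        sum (λ i → 0# * conj (x i)) ≈⟨ *-distribˡ-sum 0# (conj ∘ x) ⟨
        0# * sum (conj ∘ x)         ≈⟨ zeroˡ _ ⟩
        0#                          ∎
    ; +-closed = λ {y} {z} p q {x} r → begin
        ⟨ x , y +ᵥ z ⟩        ≈⟨ sum-cong-≋ (λ i → distribˡ (conj (x i)) (y i) (z i)) ⟩
        sum (λ i → conj (x i) * y i + conj (x i) * z i)
                              ≈⟨ ∑-distrib-+ (λ i → conj (x i) * y i) (λ i → conj (x i) * z i) ⟩
        ⟨ x , y ⟩ + ⟨ x , z ⟩ ≈⟨ +-cong (p r) (q r) ⟩
        0# + 0#               ≈⟨ +-identityˡ 0# ⟩
        0#                    ∎
    ; *-closed = λ c {y} p {x} r → begin
        ⟨ x , c *ᵥ y ⟩  ≈⟨ sum-cong-≋ (λ i →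
                              solve 3 (λ a b e → a :* (b :* e) := b :* (a :* e))
                                      refl (conj (x i)) c (y i)) ⟩
        sum (λ i → c * (conj (x i) * y i))
                        ≈⟨ *-distribˡ-sum c (λ i → conj (x i) * y i) ⟨
        c * ⟨ x , y ⟩   ≈⟨ *-congˡ (p r) ⟩
        c * 0#          ≈⟨ zeroʳ c ⟩
        0#              ∎
    }

  subspaceOrtholattice : RawOrtholattice (lsuc 0ℓ) 0ℓ
  subspaceOrtholattice = record
    { Carrier = Subspace
    ; _≈_     = λ A B → member A ≐ member B
    ; _∧_     = _∩ₛ_
    ; _∨_     = _+ₛ_
    ; ~_      = _⊥ₛ
    ; 0#      = zeroSubspace
    ; 1#      = wholeSpace
    }

module BSS (K : OrderedField) where

  open OrderedField K

  -- A machine has K-valued registers on which it computes, a K-valued memory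
  -- (initially holding the input), and ℕ-valued index registers serving to
  -- address the memory.  In the instructions, r s t name registers, i j name
  -- index registers and l is a line of the program.  Index registers only
  -- allow copying, reset, increment and comparison, so that within T steps
  -- they cannot exceed the input length by more than T.
  data Instruction : Set where
    constant                    : (r : ℕ) (c : Carrier) → Instruction
    add subtract multiply ratio : (r s t : ℕ) → Instruction
    guess                       : (r : ℕ) → Instruction
    load store                  : (r i : ℕ) → Instruction
    reset increment             : (i : ℕ) → Instruction
    copyIndex                   : (i j : ℕ) → Instruction
    jump≈ jump<                 : (r s l : ℕ) → Instruction
    jumpIndex≡                  : (i j l : ℕ) → Instruction
    accept reject               : Instruction

  Program : Set
  Program = List Instruction

  record State : Set where
    constructor state
    field
      line     : ℕ
      register : ℕ → Carrier
      memory   : ℕ → Carrier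
      index    : ℕ → ℕ

  data Configuration : Set where
    running : State → Configuration
    halted  : (accepting : Bool) → Configuration

  nth : ∀ {A : Set} → List A → ℕ → Maybe A
  nth xs n = head (drop n xs)

  infixl 9 _[_≔_]

  _[_≔_] : ∀ {A : Set} → (ℕ → A) → ℕ → A → (ℕ → A)
  (f [ n ≔ x ]) m = if does (m ℕ.≟ n) then x else f m

  -- The first argument is the element of K obtained if the instruction is
  -- a guess.
  execute : Carrier → Instruction → State → Configuration
  execute g (constant r c)     (state p x m ι) = running (state (suc p) (x [ r ≔ c ]) m ι)
  execute g (add r s t)        (state p x m ι) = running (state (suc p) (x [ r ≔ x s + x t ]) m ι)
  execute g (subtract r s t)   (state p x m ι) = running (state (suc p) (x [ r ≔ x s - x t ]) m ι)
  execute g (multiply r s t)   (state p x m ι) = running (state (suc p) (x [ r ≔ x s * x t ]) m ι)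
  execute g (ratio r s t)      (state p x m ι) with x t ≟ 0#
  ... | yes _   = halted false
  ... | no  t≉0 = running (state (suc p) (x [ r ≔ divide (x s) t≉0 ]) m ι)
  execute g (guess r)          (state p x m ι) = running (state (suc p) (x [ r ≔ g ]) m ι)
  execute g (load r i)         (state p x m ι) = running (state (suc p) (x [ r ≔ m (ι i) ]) m ι)
  execute g (store r i)        (state p x m ι) = running (state (suc p) x (m [ ι i ≔ x r ]) ι)
  execute g (reset i)          (state p x m ι) = running (state (suc p) x m (ι [ i ≔ 0 ]))
  execute g (increment i)      (state p x m ι) = running (state (suc p) x m (ι [ i ≔ suc (ι i) ]))
  execute g (copyIndex i j)    (state p x m ι) = running (state (suc p) x m (ι [ i ≔ ι j ]))
  execute g (jump≈ r s l)      (state p x m ι) =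
    running (state (if does (x r ≟ x s) then l else suc p) x m ι)
  execute g (jump< r s l)      (state p x m ι) =
    running (state (if does (x r <? x s) then l else suc p) x m ι)
  execute g (jumpIndex≡ i j l) (state p x m ι) =
    running (state (if does (ι i ℕ.≟ ι j) then l else suc p) x m ι)
  execute g accept             _               = halted true
  execute g reject             _               = halted false

  step : Program → Carrier → Configuration → Configuration
  step M g (halted b)  = halted b
  step M g (running s) with nth M (State.line s)
  ... | just I  = execute g I s
  ... | nothing = halted false

  -- γ n is what a guess made in step n yields.
  run : Program → (γ : ℕ → Carrier) → (steps : ℕ) → Configuration → Configuration
  run M γ zero    c = c
  run M γ (suc n) c = run M (γ ∘ suc) n (step M (γ 0) c)

  -- Index register 0 initially holds the input length.
  initial : List Carrier → Configuration
  initial x = running (state 0 (λ _ → 0#)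
                             (λ n → fromMaybe 0# (nth x n))
                             ((λ _ → 0) [ 0 ≔ length x ]))

  Accepts : Program → Pred (List Carrier) 0ℓ
  Accepts M x = ∃₂ λ γ n → run M γ n (initial x) ≡ halted true

  PolynomialTime : Pred Program 0ℓ
  PolynomialTime M = ∃₂ λ c k → ∀ x γ →
    ∃ λ b → run M γ (c ℕ.* suc (length x) ℕ.^ k) (initial x) ≡ halted b

  NP : Pred (Pred (List Carrier) 0ℓ) 0ℓ
  NP 𝓛 = ∃ λ M → M ∈ PolynomialTime × 𝓛 ≐ Accepts M

  bit : Bool → Carrier
  bit b = if b then 1# else 0#

  BP : ∀ {ℓ} → Pred (Pred (List Carrier) 0ℓ) 0ℓ → Pred (Pred (List Bool) ℓ) (lsuc 0ℓ ⊔ ℓ)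
  BP 𝒞 S = ∃ λ 𝓛 → 𝓛 ∈ 𝒞 × S ≐ (𝓛 ∘ List.map bit)

module Complex (ℝ : RealNumbers) where

  open RealNumbers ℝ
  open RingProperties ring
    using (-1*x≈-x; -‿distribʳ-*; -0#≈0#)
  open SemiringSolver commutativeSemiring
    using (solve; _:=_; _:+_; _:*_; con)
  open CommutativeMonoidSum +-commutativeMonoid using (sum)

  private
    additive : AbelianGroup 0ℓ 0ℓ
    additive = DirectProduct.abelianGroup +-abelianGroup +-abelianGroup

    -- The solver is for semirings, so x - y is turned into x + n * y with n a variable.
    minus : ∀ x y → x - y ≈ x + (- 1#) * y
    minus x y = +-congˡ (sym (-1*x≈-x y))

  infixl 7 _*ℂ_

  -- (a , b) stands for a + ib.
  _*ℂ_ : Op₂ (Carrier × Carrier)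
  (a , b) *ℂ (c , d) = (a * c - b * d) , (a * d + b * c)

  private
    *ℂ-assoc : ∀ x y z → AbelianGroup._≈_ additive ((x *ℂ y) *ℂ z) (x *ℂ (y *ℂ z))
    *ℂ-assoc (a , b) (c , d) (e , f) =
      trans (trans (minus _ _) (+-congʳ (*-congʳ (minus _ _))))
        (trans (solve 7 (λ n a b c d e f →
            (a :* c :+ n :* (b :* d)) :* e :+ n :* ((a :* d :+ b :* c) :* f)
            := a :* (c :* e :+ n :* (d :* f)) :+ n :* (b :* (c :* f :+ d :* e)))
            refl (- 1#) a b c d e f)
          (sym (trans (minus _ _) (+-congʳ (*-congˡ (minus _ _)))))) ,
      trans (+-congʳ (*-congʳ (minus _ _)))
        (trans (solve 7 (λ n a b c d e f →
            (a :* c :+ n :* (b :* d)) :* f :+ (a :* d :+ b :* c) :* e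
            := a :* (c :* f :+ d :* e) :+ b :* (c :* e :+ n :* (d :* f)))
            refl (- 1#) a b c d e f)
          (sym (+-congˡ (*-congˡ (minus _ _)))))

    *ℂ-comm : ∀ x y → AbelianGroup._≈_ additive (x *ℂ y) (y *ℂ x)
    *ℂ-comm (a , b) (c , d) =
      +-cong (*-comm a c) (-‿cong (*-comm b d)) ,
      solve 4 (λ a b c d → a :* d :+ b :* c := c :* b :+ d :* a) refl a b c d

    *ℂ-identityˡ : ∀ x → AbelianGroup._≈_ additive ((1# , 0#) *ℂ x) x
    *ℂ-identityˡ (a , b) =
      trans (minus _ _)
        (solve 3 (λ n a b → con 1 :* a :+ n :* (con 0 :* b) := a) refl (- 1#) a b) ,
      solve 2 (λ a b → con 1 :* b :+ con 0 :* a := b) refl a b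

    *ℂ-distribˡ : ∀ x y z → AbelianGroup._≈_ additive
                    (x *ℂ AbelianGroup._∙_ additive y z)
                    (AbelianGroup._∙_ additive (x *ℂ y) (x *ℂ z))
    *ℂ-distribˡ (a , b) (c , d) (e , f) =
      trans (minus _ _)
        (trans (solve 7 (λ n a b c d e f →
            a :* (c :+ e) :+ n :* (b :* (d :+ f))
            := (a :* c :+ n :* (b :* d)) :+ (a :* e :+ n :* (b :* f)))
            refl (- 1#) a b c d e f)
          (sym (+-cong (minus _ _) (minus _ _)))) ,
      solve 6 (λ a b c d e f →
        a :* (d :+ f) :+ b :* (c :+ e) := (a :* d :+ b :* c) :+ (a :* f :+ b :* e))
        refl a b c d e f

    module Additive = AbelianGroup additive

  ℂ : CommutativeRing 0ℓ 0ℓ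
  ℂ = record
    { Carrier = Carrier × Carrier
    ; _≈_ = Additive._≈_
    ; _+_ = Additive._∙_
    ; _*_ = _*ℂ_
    ; -_  = Additive._⁻¹
    ; 0#  = Additive.ε
    ; 1#  = 1# , 0#
    ; isCommutativeRing = record
      { isRing = record
        { +-isAbelianGroup = Additive.isAbelianGroup
        ; *-cong = λ (p , q) (r , s) →
            +-cong (*-cong p r) (-‿cong (*-cong q s)) , +-cong (*-cong p s) (*-cong q r)
        ; *-assoc = *ℂ-assoc
        ; *-identity = *ℂ-identityˡ ,
            λ x → Additive.trans (*ℂ-comm x (1# , 0#)) (*ℂ-identityˡ x)
        ; distrib = *ℂ-distribˡ ,
            λ x y z → Additive.trans (*ℂ-comm (y Additive.∙ z) x)
              (Additive.trans (*ℂ-distribˡ x y z)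
                (Additive.∙-cong (*ℂ-comm x y) (*ℂ-comm x z)))
        }
      ; *-comm = *ℂ-comm
      }
    }

  conjugate : Op₁ (Carrier × Carrier)
  conjugate (a , b) = a , (- b)

  record StarSubfield : Set₁ where
    field
      member      : Pred (Carrier × Carrier) 0ℓ
      isSubfield  : IsSubfield ℂ member
      conj-closed : ∀ {z} → z ∈ member → conjugate z ∈ member

    open IsSubfield isSubfield public

    field𝔽 : CommutativeRing 0ℓ 0ℓ
    field𝔽 = subring ℂ isSubfield

    conj : Op₁ (CommutativeRing.Carrier field𝔽)
    conj (z , p) = conjugate z , conj-closed p

    𝔽∩ℝ : Pred Carrier 0ℓ
    𝔽∩ℝ x = (x , 0#) ∈ member

    Re : Pred Carrier 0ℓ
    Re x = ∃ λ y → (x , y) ∈ member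

    -- 𝔽 ⊆ ℝ, or 𝔽 = 𝔽′ + i𝔽′ with 𝔽′ = 𝔽 ∩ ℝ
    StandingAssumption : Set
    StandingAssumption =
      (∀ {x y} → (x , y) ∈ member → y ≈ 0#) ⊎
      (∀ {x y} → (x , y) ∈ member ⇔ (x ∈ 𝔽∩ℝ × y ∈ 𝔽∩ℝ))

    Pythagorean : Set
    Pythagorean = ∀ n (x : Vector Carrier n) → (∀ i → x i ∈ 𝔽∩ℝ) →
                  ∃ λ y → y ∈ 𝔽∩ℝ × sum (λ i → x i * x i) ≈ y * y

    private
      half : ∃ λ h → (1# + 1#) * h ≈ 1#
      half = let (h , _ , e) = invertible 2≉0 in h , e
        where
        0<2 : 0# < 1# + 1#
        0<2 = IsStrictTotalOrder.trans isStrictTotalOrder 0<1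
                (IsStrictTotalOrder.<-respˡ-≈ isStrictTotalOrder (+-identityʳ 1#)
                  (+-monoʳ-< 1# 0<1))
        2≉0 : 1# + 1# ≉ 0#
        2≉0 e = IsStrictTotalOrder.irrefl isStrictTotalOrder (sym e) 0<2

      -- x = ((x + iy) + conj (x + iy)) / 2
      Re⊆𝔽∩ℝ : Re ⊆ 𝔽∩ℝ
      Re⊆𝔽∩ℝ {x} (y , p) =
        let (h , 2h≈1) = half
            h∈ : (h , 0#) ∈ member
            h∈ = ⁻¹-closed (+-closed 1∈ 1∈)
                   ( trans (minus _ _) (trans (solve 3 (λ n t h →
                       t :* h :+ n :* ((con 0 :+ con 0) :* con 0) := t :* h)
                       refl (- 1#) (1# + 1#) h) 2h≈1)
                   , solve 2 (λ t h → t :* con 0 :+ (con 0 :+ con 0) :* h := con 0)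
                       refl (1# + 1#) h )
            2x∈ : (x + x , 0#) ∈ member
            2x∈ = resp (refl , -‿inverseʳ y) (+-closed p (conj-closed p))
        in resp ( trans (minus _ _) (trans (solve 3 (λ n x h →
                    (x :+ x) :* h :+ n :* (con 0 :* con 0) := x :* ((con 1 :+ con 1) :* h))
                    refl (- 1#) x h) (trans (*-congˡ 2h≈1) (*-identityʳ x)))
                , solve 2 (λ t h → t :* con 0 :+ con 0 :* h := con 0) refl (x + x) h )
                (*-closed 2x∈ h∈)

      real*real : ∀ x y → AbelianGroup._≈_ additive
                    ((x , 0#) *ℂ (y , 0#)) (x * y , 0#)
      real*real x y =
        trans (minus _ _)
          (solve 3 (λ n x y → x :* y :+ n :* (con 0 :* con 0) := x :* y) refl (- 1#) x y) ,
        solve 2 (λ x y → x :* con 0 :+ con 0 :* y := con 0) refl x y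

    Re-isSubfield : IsSubfield commutativeRing Re
    Re-isSubfield = record
      { resp      = λ x≈y (z , p) → z , resp (x≈y , refl) p
      ; 0∈        = 0# , 0∈
      ; 1∈        = 0# , 1∈
      ; +-closed  = λ (u , p) (v , q) → (u + v) , +-closed p q
      ; *-closed  = λ p q → 0# , resp (real*real _ _) (*-closed (Re⊆𝔽∩ℝ p) (Re⊆𝔽∩ℝ q))
      ; -‿closed  = λ (u , p) → (- u) , -‿closed p
      ; ⁻¹-closed = λ p xy≈1 → 0# , ⁻¹-closed (Re⊆𝔽∩ℝ p)
          (trans (proj₁ (real*real _ _)) xy≈1 , proj₂ (real*real _ _))
      }

    ReField : OrderedField
    ReField = suborderedField orderedField Re-isSubfield

  open StarSubfield

  realSubfield : ∀ {P} → IsSubfield commutativeRing P → StarSubfield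
  realSubfield {P} P-isSubfield = record
    { member      = λ (a , b) → a ∈ P × b ≈ 0#
    ; isSubfield  = record
      { resp      = λ (e , f) (p , q) → P.resp e p , trans (sym f) q
      ; 0∈        = P.0∈ , refl
      ; 1∈        = P.1∈ , refl
      ; +-closed  = λ (p , q) (p′ , q′) →
          P.+-closed p p′ , trans (+-cong q q′) (+-identityˡ 0#)
      ; *-closed  = λ (p , q) (p′ , q′) →
          P.resp (sym (real-part q)) (P.*-closed p p′) ,
          trans (+-cong (trans (*-congˡ q′) (zeroʳ _)) (trans (*-congʳ q) (zeroˡ _)))
                (+-identityˡ 0#)
      ; -‿closed  = λ (p , q) → P.-‿closed p , trans (-‿cong q) -0#≈0#
      ; ⁻¹-closed = λ (p , q) (e , f) →
          let ac≈1 = trans (sym (real-part q)) e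
              ad≈0 = trans (sym (trans (+-congˡ (trans (*-congʳ q) (zeroˡ _)))
                                       (+-identityʳ _))) f
          in P.⁻¹-closed p ac≈1 ,
             trans (sym (*-identityˡ _)) (trans (*-congʳ (sym ac≈1))
               (trans (solve 3 (λ a c d → (a :* c) :* d := c :* (a :* d)) refl _ _ _)
                 (trans (*-congˡ ad≈0) (zeroʳ _))))
      }
    ; conj-closed = λ (p , q) → p , trans (-‿cong q) -0#≈0#
    }
    where
    module P = IsSubfield P-isSubfield
    real-part : ∀ {a b c d} → b ≈ 0# → a * c - b * d ≈ a * c
    real-part q = trans (+-congˡ (trans (-‿cong (trans (*-congʳ q) (zeroˡ _))) -0#≈0#))
                        (+-identityʳ _)

  ReSubfield : StarSubfield → StarSubfield
  ReSubfield 𝔽 = realSubfield (Re-isSubfield 𝔽)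

  ℝ-subfield : StarSubfield
  ℝ-subfield = realSubfield {P = U} record {}

  ℂ-subfield : StarSubfield
  ℂ-subfield = record { member = U ; isSubfield = record {} }

  L : StarSubfield → ℕ → RawOrtholattice (lsuc 0ℓ) 0ℓ
  L 𝔽 d = subspaceOrtholattice (field𝔽 𝔽) (conj 𝔽) d

  StronglySatisfiable* WeaklySatisfiable* : StarSubfield → Pred Term (lsuc 0ℓ)
  StronglySatisfiable* 𝔽 t = ∃ λ d → ℕ.NonZero d × StronglySatisfiable (L 𝔽 d) t
  WeaklySatisfiable*   𝔽 t = ∃ λ d → ℕ.NonZero d × WeaklySatisfiable   (L 𝔽 d) t

  SAT sat : StarSubfield → Pred (List Bool) (lsuc 0ℓ)
  SAT 𝔽 = Encodings (StronglySatisfiable* 𝔽)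
  sat 𝔽 = Encodings (WeaklySatisfiable*   𝔽)

{-# OPTIONS --safe #-}
module Submission where

-- (b) A subspace of 𝔽^d with 𝔽 = 𝔽′ + i𝔽′ is a subspace of 𝔽′^2d, and B ↦ B + iB embeds the
-- subspaces of 𝔽′^d into those of 𝔽^d; both maps preserve the operations of the ortholattice.
--
-- (a) By (b) only a real field K matters. Membership of a vector v in the value of a term unfolds into
-- finitely many vectors, each required to lie in (the value of) a variable or in its orthocomplement: for
-- s ∨ t and ¬ (s ∧ t) one guesses a decomposition v = x + y. Conversely, vectors such that those attached
-- to i and to ¬ i are mutually orthogonal come from the assignment of i to the orthocomplement of the
-- latter. If K is Pythagorean, Gram–Schmidt turns the n guessed vectors into vectors in K^n. So
-- the machine guesses an n × n matrix, one row for each coordinate and one column for each position in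
-- the word of length n; for each coordinate, it parses the word while distributing the coordinate of v to
-- the leaves, and at last checks the orthogonality of leaves with opposite literals.

open import Defs
open import Axiom.ExcludedMiddle using (ExcludedMiddle)
open import Data.Product.Base using (_×_)
open import Function.Bundles using (_⇔_)
open import Relation.Unary using (_≐_)
open import Level as Level using (0ℓ)
open import Algebra.Bundles using (CommutativeRing)
open import Algebra.Core using (Op₁)
open import Data.Nat.Base using (ℕ; NonZero)
open import Data.Product.Base using (∃; _,_)
open import Data.Sum.Base using (_⊎_)
open import Function.Base using (id)

-- The dimension d of a satisfying assignment has no bound given in advance, and a subspace is not
-- finite data. Retaining only the vectors met while one nonzero vector of the term's value is
-- unfolded removes both obstacles: there is at most one per position of the word, so an isometric
-- copy of their span has as many coordinates as the word has bits. Normalisation is the only place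
-- for square roots; the way back from vectors to an assignment works over every ordered field.
--
-- How the word is parsed does not depend on the coordinate; only the tests at constants do, which
-- is why coordinates can be treated in separate passes. Literals are compared by arithmetic: an
-- occurrence of variable i is named 1 + i with the sign of its literal, and in an ordered field two
-- names cancel exactly if the literals are opposite.
--
-- Soundness of the machine concerns all guesses, completeness one sequence of guesses, and the
-- running time all of them again. A single calculus of weakest preconditions, with a parameter that
-- restricts the guesses, serves all three.

-- Ring identities with integer coefficients

module IntegerRingSolver (R : CommutativeRing 0ℓ 0ℓ) where

  open import Algebra.Bundles using (RawRing)
  open import Algebra.Solver.Ring.AlmostCommutativeRing
    using (AlmostCommutativeRing; fromCommutativeRing; _-Raw-AlmostCommutative⟶_)
  import Algebra.Properties.Ring as RingProperties
  import Algebra.Properties.Semiring.Mult.TCOptimised as Mult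
  import Algebra.Solver.Ring as RingSolver
  open import Data.Integer.Base as ℤ using (ℤ; +_; -[1+_]; +[1+_]; _⊖_)
  import Data.Integer.Properties as ℤ
  open import Data.Maybe.Base using (Maybe; just; nothing)
  open import Data.Nat.Base as ℕ using (ℕ; zero; suc)
  import Data.Nat.Properties as ℕ
  open import Relation.Binary.PropositionalEquality as ≡ using (_≡_; cong)
  open import Relation.Nullary.Decidable.Core using (yes; no)

  open CommutativeRing R
  open RingProperties ring
  open Mult semiring using (1+×; ×-homo-+; ×1-homo-*) renaming (_×_ to _·_)
  open import Relation.Binary.Reasoning.Setoid setoid

  private
    -- With this variant of the multiple, `1 · 1#` reduces to `1#`, so `con (+ 1)` in solver
    -- equations means `1#` itself and `1-homo` is `refl`.
    fromℤ : ℤ → Carrier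
    fromℤ (+ n)    = n · 1#
    fromℤ -[1+ n ] = - (suc n · 1#)

    neg-homo : ∀ i → fromℤ (ℤ.- i) ≈ - fromℤ i
    neg-homo (+ zero)  = sym -0#≈0#
    neg-homo (+ suc n) = refl
    neg-homo -[1+ n ]  = sym (-‿involutive _)

    ⊖-homo : ∀ m n → fromℤ (m ⊖ n) ≈ m · 1# - n · 1#
    ⊖-homo m zero = begin
      fromℤ (m ⊖ 0)    ≡⟨ cong fromℤ (ℤ.⊖-≥ {m} {0} ℕ.z≤n) ⟩
      m · 1#           ≈⟨ +-identityʳ _ ⟨
      m · 1# + 0#      ≈⟨ +-congˡ -0#≈0# ⟨
      m · 1# - 0#      ∎
    ⊖-homo zero    (suc n) = sym (+-identityˡ _)
    ⊖-homo (suc m) (suc n) = begin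
      fromℤ (suc m ⊖ suc n)                  ≡⟨ cong fromℤ (ℤ.[1+m]⊖[1+n]≡m⊖n m n) ⟩
      fromℤ (m ⊖ n)                          ≈⟨ ⊖-homo m n ⟩
      m · 1# - n · 1#                        ≈⟨ +-identityˡ _ ⟨
      0# + (m · 1# - n · 1#)                 ≈⟨ +-congʳ (-‿inverseʳ 1#) ⟨
      (1# - 1#) + (m · 1# - n · 1#)          ≈⟨ +-assoc _ _ _ ⟩
      1# + (- 1# + (m · 1# - n · 1#))        ≈⟨ +-congˡ (+-assoc _ _ _) ⟨
      1# + ((- 1# + m · 1#) - n · 1#)        ≈⟨ +-congˡ (+-congʳ (+-comm _ _)) ⟩
      1# + ((m · 1# - 1#) - n · 1#)          ≈⟨ +-congˡ (+-assoc _ _ _) ⟩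
      1# + (m · 1# + (- 1# - n · 1#))        ≈⟨ +-assoc _ _ _ ⟨
      (1# + m · 1#) + (- 1# - n · 1#)        ≈⟨ +-congˡ (-‿+-comm 1# _) ⟩
      (1# + m · 1#) - (1# + n · 1#)          ≈⟨ +-cong (1+× m 1#) (-‿cong (1+× n 1#)) ⟨
      suc m · 1# - suc n · 1#                ∎

    +-homo : ∀ i j → fromℤ (i ℤ.+ j) ≈ fromℤ i + fromℤ j
    +-homo (+ m)    (+ n)    = ×-homo-+ 1# m n
    +-homo (+ m)    -[1+ n ] = ⊖-homo m (suc n)
    +-homo -[1+ m ] (+ n)    = trans (⊖-homo n (suc m)) (+-comm _ _)
    +-homo -[1+ m ] -[1+ n ] = begin
      - (suc (suc (m ℕ.+ n)) · 1#)         ≡⟨ cong (λ k → - (k · 1#)) (cong suc (≡.sym (ℕ.+-suc m n))) ⟩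
      - ((suc m ℕ.+ suc n) · 1#)           ≈⟨ -‿cong (×-homo-+ 1# (suc m) (suc n)) ⟩
      - (suc m · 1# + suc n · 1#)          ≈⟨ -‿+-comm _ _ ⟨
      - (suc m · 1#) - suc n · 1#          ∎

    *-homo : ∀ i j → fromℤ (i ℤ.* j) ≈ fromℤ i * fromℤ j
    *-homo (+ m) (+ n) = trans (reflexive (cong fromℤ (≡.sym (ℤ.pos-* m n)))) (×1-homo-* m n)
    *-homo (+ m) -[1+ n ] = begin
      fromℤ (+ m ℤ.* -[1+ n ])            ≡⟨ cong fromℤ (≡.sym (ℤ.neg-distribʳ-* (+ m) (+ suc n))) ⟩
      fromℤ (ℤ.- (+ m ℤ.* + suc n))       ≈⟨ neg-homo (+ m ℤ.* + suc n) ⟩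
      - fromℤ (+ m ℤ.* + suc n)           ≈⟨ -‿cong (*-homo (+ m) (+ suc n)) ⟩
      - (m · 1# * (suc n · 1#))           ≈⟨ -‿distribʳ-* _ _ ⟩
      m · 1# * - (suc n · 1#)             ∎
    *-homo -[1+ m ] (+ n) = begin
      fromℤ (-[1+ m ] ℤ.* + n)            ≡⟨ cong fromℤ (≡.sym (ℤ.neg-distribˡ-* (+ suc m) (+ n))) ⟩
      fromℤ (ℤ.- (+ suc m ℤ.* + n))       ≈⟨ neg-homo (+ suc m ℤ.* + n) ⟩
      - fromℤ (+ suc m ℤ.* + n)           ≈⟨ -‿cong (*-homo (+ suc m) (+ n)) ⟩
      - (suc m · 1# * (n · 1#))           ≈⟨ -‿distribˡ-* _ _ ⟩
      - (suc m · 1#) * (n · 1#)           ∎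
    *-homo -[1+ m ] -[1+ n ] = begin
      (suc m ℕ.* suc n) · 1#              ≈⟨ ×1-homo-* (suc m) (suc n) ⟩
      suc m · 1# * (suc n · 1#)           ≈⟨ -‿involutive _ ⟨
      - - (suc m · 1# * (suc n · 1#))     ≈⟨ -‿cong (-‿distribˡ-* _ _) ⟩
      - (- (suc m · 1#) * (suc n · 1#))   ≈⟨ -‿distribʳ-* _ _ ⟩
      - (suc m · 1#) * - (suc n · 1#)     ∎

    almost : AlmostCommutativeRing 0ℓ 0ℓ
    almost = fromCommutativeRing R

    morphism : ℤ.+-*-rawRing -Raw-AlmostCommutative⟶ almost
    morphism = record
      { ⟦_⟧ = fromℤ ; +-homo = +-homo ; *-homo = *-homo ; -‿homo = neg-homo
      ; 0-homo = refl ; 1-homo = refl }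

    coefficient≟ : ∀ i j → Maybe (fromℤ i ≈ fromℤ j)
    coefficient≟ i j with i ℤ.≟ j
    ... | yes ≡.refl = just refl
    ... | no _       = nothing

  open RingSolver ℤ.+-*-rawRing almost morphism coefficient≟ public
    using (solve; _:=_; _:+_; _:*_; _:-_; :-_; con)

-- Ordered fields: positivity, sums of squares, characteristic zero

module OrderedFieldProperties (K : OrderedField) where

  open import Algebra.Definitions using (Invertible)
  import Algebra.Properties.CommutativeMonoid.Sum as Sum
  import Algebra.Properties.Semiring.Mult as Mult
  open import Data.Empty using (⊥; ⊥-elim)
  open import Data.Fin.Base using (Fin; zero; suc)
  open import Data.Integer.Base using (+_)
  open import Data.Nat.Base as ℕ using (ℕ; zero; suc)
  import Data.Nat.Properties as ℕ
  open import Data.Product.Base using (_,_; proj₁; proj₂)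
  open import Data.Sum.Base using (_⊎_; inj₁; inj₂)
  open import Data.Vec.Functional using (Vector)
  open import Relation.Binary.Definitions using (tri<; tri≈; tri>)
  open import Relation.Binary.PropositionalEquality as ≡ using (_≡_)
  open import Relation.Binary.Structures using (IsStrictTotalOrder)
  open import Relation.Nullary.Decidable.Core using (yes; no)
  open import Relation.Nullary.Negation.Core using (¬_)

  open OrderedField K hiding (zero)
  open IsStrictTotalOrder isStrictTotalOrder public
    using (compare; irrefl; <-resp-≈; <-respˡ-≈; <-respʳ-≈) renaming (trans to <-trans)
  open Sum +-commutativeMonoid public using (sum; sum-cong-≋; ∑-distrib-+)
  open Mult semiring public using (×-homo-+) renaming (_×_ to _·_)
  open IntegerRingSolver commutativeRing public

  infix 4 _≤_

  -- The negative form is the one used by `UpperBound`, so suprema can be handled without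
  -- conversion.
  _≤_ : Carrier → Carrier → Set
  x ≤ y = ¬ (y < x)

  +-monoˡ-< : ∀ z {x y} → x < y → x + z < y + z
  +-monoˡ-< z x<y = <-respˡ-≈ (+-comm z _) (<-respʳ-≈ (+-comm z _) (+-monoʳ-< z x<y))

  +-mono-< : ∀ {x y u v} → x < y → u < v → x + u < y + v
  +-mono-< x<y u<v = <-trans (+-monoˡ-< _ x<y) (+-monoʳ-< _ u<v)

  x<y⇒0<y-x : ∀ {x y} → x < y → 0# < y - x
  x<y⇒0<y-x {x} {y} x<y = <-respˡ-≈ (-‿inverseʳ x) (+-monoˡ-< (- x) x<y)

  0<y-x⇒x<y : ∀ {x y} → 0# < y - x → x < y
  0<y-x⇒x<y {x} {y} p = <-respˡ-≈ (+-identityˡ x)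
    (<-respʳ-≈ (solve 2 (λ x y → y :- x :+ x := y) refl x y) (+-monoˡ-< x p))

  neg-positive : ∀ {x} → x < 0# → 0# < - x
  neg-positive {x} x<0 = <-respʳ-≈ (+-identityˡ (- x)) (x<y⇒0<y-x x<0)

  0<x+y : ∀ {x y} → 0# < x → 0# < y → 0# < x + y
  0<x+y p q = <-respˡ-≈ (+-identityˡ 0#) (+-mono-< p q)

  0<x⇒x≉0 : ∀ {x} → 0# < x → x ≉ 0#
  0<x⇒x≉0 p e = irrefl (sym e) p

  ≉0⇒0<x² : ∀ {x} → x ≉ 0# → 0# < x * x
  ≉0⇒0<x² {x} x≉0 with compare x 0#
  ... | tri< x<0 _ _ = <-respʳ-≈ (solve 1 (λ x → :- x :* :- x := x :* x) refl x)
                         (*-positive (neg-positive x<0) (neg-positive x<0))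
  ... | tri≈ _ x≈0 _ = ⊥-elim (x≉0 x≈0)
  ... | tri> _ _ 0<x = *-positive 0<x 0<x

  0≤x² : ∀ x → 0# ≤ x * x
  0≤x² x p with x ≟ 0#
  ... | yes x≈0 = irrefl (trans (*-congʳ x≈0) (zeroˡ x)) p
  ... | no x≉0  = irrefl refl (<-trans p (≉0⇒0<x² x≉0))

  <-≤-trans : ∀ {x y z} → x < y → y ≤ z → x < z
  <-≤-trans {x} {y} {z} x<y y≤z with compare y z
  ... | tri< y<z _ _ = <-trans x<y y<z
  ... | tri≈ _ y≈z _ = <-respʳ-≈ y≈z x<y
  ... | tri> _ _ z<y = ⊥-elim (y≤z z<y)

  0<x+y-≤ : ∀ {x y} → 0# < x → 0# ≤ y → 0# < x + y
  0<x+y-≤ {x} {y} p q with compare y 0#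
  ... | tri< y<0 _ _ = ⊥-elim (q y<0)
  ... | tri≈ _ y≈0 _ = <-respʳ-≈ (trans (sym (+-identityʳ x)) (+-congˡ (sym y≈0))) p
  ... | tri> _ _ 0<y = 0<x+y p 0<y

  0≤x+y : ∀ {x y} → 0# ≤ x → 0# ≤ y → 0# ≤ x + y
  0≤x+y {x} {y} p q with compare x 0#
  ... | tri< x<0 _ _ = ⊥-elim (p x<0)
  ... | tri≈ _ x≈0 _ = λ r → q (<-respˡ-≈ (trans (+-congʳ x≈0) (+-identityˡ y)) r)
  ... | tri> _ _ 0<x = λ r → irrefl refl (<-trans r (0<x+y-≤ 0<x q))

  0≤sum² : ∀ {n} (x : Vector Carrier n) → 0# ≤ sum (λ i → x i * x i)
  0≤sum² {zero}  x = irrefl refl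
  0≤sum² {suc n} x = 0≤x+y (0≤x² (x zero)) (0≤sum² (λ i → x (suc i)))

  -- A nonzero first entry would make the whole sum positive. This is the anisotropy of the standard
  -- inner product, on which all of the linear algebra rests.
  sum²≈0 : ∀ {n} (x : Vector Carrier n) → sum (λ i → x i * x i) ≈ 0# → ∀ i → x i ≈ 0#
  sum²≈0 {suc n} x e with x zero ≟ 0#
  ... | no x≉0  = ⊥-elim (irrefl (sym e) (0<x+y-≤ (≉0⇒0<x² x≉0) (0≤sum² (λ i → x (suc i)))))
  ... | yes x≈0 = λ where
    zero    → x≈0
    (suc i) → sum²≈0 (λ i → x (suc i))
      (trans (sym (+-identityˡ _)) (trans (+-congʳ (sym (trans (*-congʳ x≈0) (zeroˡ _)))) e)) i

  inverse : ∀ {x} → x ≉ 0# → Carrier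
  inverse x≉0 = proj₁ (invertible x≉0)

  inverseʳ : ∀ {x} (x≉0 : x ≉ 0#) → x * inverse x≉0 ≈ 1#
  inverseʳ x≉0 = proj₂ (proj₂ (invertible x≉0))

  xy≈0⇒y≈0 : ∀ {x y} → x ≉ 0# → x * y ≈ 0# → y ≈ 0#
  xy≈0⇒y≈0 {x} {y} x≉0 e = trans (sym (*-identityˡ y)) (trans (*-congʳ (sym (inverseʳ x≉0)))
    (trans (solve 3 (λ x y z → x :* z :* y := z :* (x :* y)) refl x y (inverse x≉0)) (trans (*-congˡ e) (zeroʳ _))))

  1≉0 : 1# ≉ 0#
  1≉0 = 0<x⇒x≉0 0<1

  -- Lets the machine keep a sign in a field register and test it by equality with 1.
  -1≉1 : - 1# ≉ 1#
  -1≉1 e = irrefl (trans (sym (-‿inverseˡ 1#)) (+-congʳ e)) (0<x+y 0<1 0<1)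

  0<[1+n]·1 : ∀ n → 0# < suc n · 1#
  0<[1+n]·1 zero    = <-respʳ-≈ (sym (+-identityʳ 1#)) 0<1
  0<[1+n]·1 (suc n) = 0<x+y 0<1 (0<[1+n]·1 n)

  -- Characteristic zero, by which the names of different variables differ.
  ·1-injective : ∀ m n → m · 1# ≈ n · 1# → m ≡ n
  ·1-injective zero    zero    e = ≡.refl
  ·1-injective zero    (suc n) e = ⊥-elim (irrefl e (0<[1+n]·1 n))
  ·1-injective (suc m) zero    e = ⊥-elim (irrefl (sym e) (0<[1+n]·1 m))
  ·1-injective (suc m) (suc n) e = ≡.cong suc (·1-injective m n
    (trans (sym (cancel (m · 1#))) (trans (+-congˡ e) (cancel (n · 1#)))))
    where
    cancel : ∀ x → - 1# + (1# + x) ≈ x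
    cancel x = trans (sym (+-assoc _ _ _)) (trans (+-congʳ (-‿inverseˡ 1#)) (+-identityˡ x))

-- Structured programs: weakest preconditions, compilation, running time

module StructuredPrograms (K : OrderedField) where

  open import Data.Bool.Base using (Bool; true; false; T; if_then_else_) renaming (not to notᵇ)
  open import Data.Bool.ListAction using (any)
  open import Data.Empty using (⊥; ⊥-elim)
  open import Data.List.Base as List using (List; []; _∷_; _++_; length; drop; head)
  open import Data.List.Properties using (length-++)
  open import Data.List.Membership.Propositional using (_∈_)
  open import Data.List.Relation.Unary.Any using (here; there)
  open import Data.Maybe.Base using (Maybe; just; nothing)
  open import Data.Nat.Base as ℕ using (ℕ; zero; suc; _≤_; z≤n; s≤s)
  import Data.Nat.Properties as ℕ
  open import Data.Nat.Solver using (module +-*-Solver)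
  open import Data.Product.Base using (∃; ∃₂; _×_; _,_; proj₁; proj₂)
  open import Data.Sum.Base using (_⊎_; inj₁; inj₂)
  open import Data.Unit.Base using (⊤; tt)
  open import Function.Base using (_∘_)
  open import Relation.Binary.PropositionalEquality
  open import Relation.Nullary.Decidable.Core using (does; yes; no)
  open import Relation.Nullary.Negation.Core using (¬_)

  open OrderedField K using (Carrier; _≈_; _≟_; _<?_)
  open BSS K

  record Store : Set where
    constructor store
    field
      register : ℕ → Carrier
      memory   : ℕ → Carrier
      index    : ℕ → ℕ
  open Store public

  at : ℕ → Store → Configuration
  at l (store x m ι) = running (state l x m ι)

  _∈ᵇ_ : ℕ → List ℕ → Bool
  i ∈ᵇ is = any (λ j → does (j ℕ.≟ i)) is

  -- Index register 0 holds the input length, the bound of every loop.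
  plain : List ℕ → Instruction → Bool
  plain fr (reset i)       = notᵇ (i ∈ᵇ (0 ∷ fr))
  plain fr (increment i)   = notᵇ (i ∈ᵇ (0 ∷ fr))
  plain fr (copyIndex i j) = notᵇ (i ∈ᵇ (0 ∷ fr))
  plain fr (constant _ _)   = true
  plain fr (add _ _ _)      = true
  plain fr (subtract _ _ _) = true
  plain fr (multiply _ _ _) = true
  plain fr (load _ _)       = true
  plain fr (store _ _)      = true
  plain fr _               = false

  effect : Instruction → Store → Store
  effect I s with execute (register s 0) I (state 0 (register s) (memory s) (index s))
  ... | running (state _ x m ι) = store x m ι
  ... | halted _                = s

  infixr 5 _⨾_

  -- Commands whose loop counters are frozen, so that a loop makes exactly as
  -- many rounds as the input has entries.
  data Cmd (fr : List ℕ) : Set where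
    op    : (I : Instruction) {_ : T (plain fr I)} → Cmd fr
    guess : (r : ℕ) → Cmd fr
    skip  : Cmd fr
    _⨾_   : (c d : Cmd fr) → Cmd fr
    if≈   : (r s : ℕ) (c d : Cmd fr) → Cmd fr
    if≡   : (i j : ℕ) (c d : Cmd fr) → Cmd fr
    for   : (i : ℕ) {_ : T (notᵇ (i ∈ᵇ (0 ∷ fr)))} → Cmd (i ∷ fr) → Cmd fr
    halt  : Bool → Cmd fr

  private
    variable
      fr : List ℕ

  setRegister : ℕ → Carrier → Store → Store
  setRegister r c s = record s { register = register s [ r ≔ c ] }

  setIndex : ℕ → ℕ → Store → Store
  setIndex i k s = record s { index = index s [ i ≔ k ] }

  ≡ᵇ-yes : ∀ {m n} → m ≡ n → (m ℕ.≡ᵇ n) ≡ true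
  ≡ᵇ-yes {zero}  refl = refl
  ≡ᵇ-yes {suc m} refl = ≡ᵇ-yes {m} refl

  ≡ᵇ-no : ∀ {m n} → m ≢ n → (m ℕ.≡ᵇ n) ≡ false
  ≡ᵇ-no {zero}  {zero}  ne = ⊥-elim (ne refl)
  ≡ᵇ-no {zero}  {suc n} ne = refl
  ≡ᵇ-no {suc m} {zero}  ne = refl
  ≡ᵇ-no {suc m} {suc n} ne = ≡ᵇ-no (ne ∘ cong suc)

  Frozen : List ℕ → Store → Store → Set
  Frozen fr s s′ = ∀ i → i ∈ (0 ∷ fr) → index s′ i ≡ index s i

  private
    ∈ᵇ-sound : ∀ {i} {is : List ℕ} → i ∈ is → T (i ∈ᵇ is)
    ∈ᵇ-sound {i} (here refl) rewrite ≡ᵇ-yes {i} refl = tt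
    ∈ᵇ-sound {i} (there {x = x} i∈) with x ℕ.≡ᵇ i
    ... | true  = tt
    ... | false = ∈ᵇ-sound i∈

  update-≢ : ∀ {A : Set} (f : ℕ → A) {n m x} → m ≢ n → (f [ n ≔ x ]) m ≡ f m
  update-≢ f m≢n rewrite ≡ᵇ-no m≢n = refl

  update-≡ : ∀ {A : Set} (f : ℕ → A) {n m x} → m ≡ n → (f [ n ≔ x ]) m ≡ x
  update-≡ f m≡n rewrite ≡ᵇ-yes m≡n = refl

  private
    ∈-≢ : ∀ {i j} {is : List ℕ} → T (notᵇ (i ∈ᵇ is)) → j ∈ is → j ≢ i
    ∈-≢ {i} {is = is} t j∈ refl with i ∈ᵇ is | ∈ᵇ-sound j∈
    ... | true | _ = t

  frozen-effect : ∀ I → T (plain fr I) → ∀ s → Frozen fr s (effect I s)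
  frozen-effect (constant r c)    t s _ i∈ = refl
  frozen-effect (add r _ _)       t s _ i∈ = refl
  frozen-effect (subtract r _ _)  t s _ i∈ = refl
  frozen-effect (multiply r _ _)  t s _ i∈ = refl
  frozen-effect (load r i)        t s _ i∈ = refl
  frozen-effect (store r i)       t s _ i∈ = refl
  frozen-effect (reset i)         t s _ i∈ = update-≢ (index s) (∈-≢ t i∈)
  frozen-effect (increment i)     t s _ i∈ = update-≢ (index s) (∈-≢ t i∈)
  frozen-effect (copyIndex i j)   t s _ i∈ = update-≢ (index s) (∈-≢ t i∈)

  -- Weakest preconditions: Ok restricts the guesses, H is what has to hold
  -- if the command halts the machine.
  module WP (Ok : Store → Carrier → Set) (H : Bool → Set) where

    mutual
      wp : Cmd fr → (Store → Set) → Store → Set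
      wp (op I)        Q s = Q (effect I s)
      wp (guess r)     Q s = ∀ g → Ok s g → Q (setRegister r g s)
      wp skip          Q s = Q s
      wp (c ⨾ d)       Q s = wp c (wp d Q) s
      wp (if≈ r t c d) Q s = (register s r ≈ register s t → wp c Q s) ×
                             (¬ register s r ≈ register s t → wp d Q s)
      wp (if≡ i j c d) Q s = (index s i ≡ index s j → wp c Q s) ×
                             (¬ index s i ≡ index s j → wp d Q s)
      wp (for i c)     Q s = rounds i c (index s 0) Q (setIndex i 0 s)
      wp (halt b)      Q s = H b

      rounds : ∀ i → Cmd (i ∷ fr) → ℕ → (Store → Set) → Store → Set
      rounds i c zero    Q s = Q s
      rounds i c (suc k) Q s = wp c (λ s → rounds i c k Q (effect (increment i) s)) s

    mutual
      wp-mono : ∀ (c : Cmd fr) {Q Q′ : Store → Set} → (∀ s → Q s → Q′ s) →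
                ∀ s → wp c Q s → wp c Q′ s
      wp-mono (op I)        f s w = f _ w
      wp-mono (guess r)     f s w = λ g ok → f _ (w g ok)
      wp-mono skip          f s w = f s w
      wp-mono (c ⨾ d)       f s w = wp-mono c (wp-mono d f) s w
      wp-mono (if≈ r t c d) f s (w , w′) = wp-mono c f s ∘ w , wp-mono d f s ∘ w′
      wp-mono (if≡ i j c d) f s (w , w′) = wp-mono c f s ∘ w , wp-mono d f s ∘ w′
      wp-mono (for i c)     f s w = rounds-mono i c (index s 0) f _ w
      wp-mono (halt b)      f s w = w

      rounds-mono : ∀ i (c : Cmd (i ∷ fr)) k {Q Q′ : Store → Set} → (∀ s → Q s → Q′ s) →
                    ∀ s → rounds i c k Q s → rounds i c k Q′ s
      rounds-mono i c zero    f s w = f s w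
      rounds-mono i c (suc k) f s w = wp-mono c (λ s → rounds-mono i c k f _) s w

    mutual
      -- No command can block or diverge. With a trivial `H` this gives termination of every
      -- program, whatever it computes.
      wp-total : (∀ b → H b) → ∀ (c : Cmd fr) {Q : Store → Set} → (∀ s → Q s) → ∀ s → wp c Q s
      wp-total h (op I)        q s = q _
      wp-total h (guess r)     q s = λ _ _ → q _
      wp-total h skip          q s = q s
      wp-total h (c ⨾ d)       q s = wp-total h c (wp-total h d q) s
      wp-total h (if≈ r t c d) q s = (λ _ → wp-total h c q s) , (λ _ → wp-total h d q s)
      wp-total h (if≡ i j c d) q s = (λ _ → wp-total h c q s) , (λ _ → wp-total h d q s)
      wp-total h (for i c)     q s = rounds-total h i c (index s 0) q _
      wp-total h (halt b)      q s = h b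

      rounds-total : (∀ b → H b) → ∀ i (c : Cmd (i ∷ fr)) k {Q : Store → Set} → (∀ s → Q s) →
                     ∀ s → rounds i c k Q s
      rounds-total h i c zero    q s = q s
      rounds-total h i c (suc k) q s = wp-total h c (λ s → rounds-total h i c k q _) s

    mutual
      -- The plain instructions of a body cannot write index register 0 or an enclosing counter, and
      -- an inner loop has a counter of its own. Hence after the body has run, the counter of a loop
      -- still tells the round.
      wp-frame : ∀ (c : Cmd fr) {Q : Store → Set} s → wp c Q s →
                 wp c (λ s′ → Q s′ × Frozen fr s s′) s
      wp-frame (op I {p})    s w = w , frozen-effect I p s
      wp-frame (guess r)     s w = λ g ok → w g ok , λ _ _ → refl
      wp-frame skip          s w = w , λ _ _ → refl
      wp-frame (c ⨾ d)       s w = wp-mono c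
        (λ s′ (w′ , e) → wp-mono d (λ s″ (q , e′) → q , λ _ i∈ → trans (e′ _ i∈) (e _ i∈)) s′ (wp-frame d s′ w′))
        s (wp-frame c s w)
      wp-frame (if≈ r t c d) s (w , w′) = wp-frame c s ∘ w , wp-frame d s ∘ w′
      wp-frame (if≡ i j c d) s (w , w′) = wp-frame c s ∘ w , wp-frame d s ∘ w′
      wp-frame (for i {p} c) s w = rounds-mono i c (index s 0)
        (λ s′ (q , e) → q , λ _ i∈ → trans (e _ i∈) (update-≢ (index s) (∈-≢ p i∈)))
        _ (rounds-frame i p c (index s 0) _ w)
      wp-frame (halt b)      s w = w

      rounds-frame : ∀ i → T (notᵇ (i ∈ᵇ (0 ∷ fr))) → ∀ (c : Cmd (i ∷ fr)) k {Q : Store → Set} s →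
                     rounds i c k Q s → rounds i c k (λ s′ → Q s′ × Frozen fr s s′) s
      rounds-frame i p c zero    s w = w , λ _ _ → refl
      rounds-frame i p c (suc k) s w = wp-mono c
        (λ s′ (w′ , e) → rounds-mono i c k
           (λ s″ (q , e′) → q , λ _ i∈ → trans (e′ _ i∈) (trans (update-≢ (index s′) (∈-≢ p i∈)) (e _ (weaken i∈))))
           _ (rounds-frame i p c k _ w′))
        s (wp-frame c s w)

      private
        weaken : ∀ {i j} → j ∈ (0 ∷ fr) → j ∈ (0 ∷ i ∷ fr)
        weaken (here e)   = here e
        weaken (there j∈) = there (there j∈)

    private
      -- The induction is on the rounds left, while the invariant is indexed by the rounds done;
      -- `m ℕ.+ k ≡ n` links the two.
      rounds-rule : ∀ {n i k} (c : Cmd (i ∷ fr)) {p : T (notᵇ (i ∈ᵇ (0 ∷ fr)))} (Inv : ℕ → Store → Set)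
        {Q : Store → Set} s₀ → index s₀ 0 ≡ n →
        (∀ k s → k ℕ.< n → index s i ≡ k → Frozen fr s₀ s → Inv k s →
           wp c (λ s′ → Inv (suc k) (effect (increment i) s′)) s) →
        (∀ s → Frozen fr s₀ s → Inv n s → Q s) →
        ∀ m → m ℕ.+ k ≡ n → ∀ s → index s i ≡ k → Frozen fr s₀ s → Inv k s → rounds i c m Q s
      rounds-rule c Inv s₀ e₀ step post zero    refl s e fz inv = post s fz inv
      rounds-rule {i = i} {k} c {p} Inv s₀ e₀ step post (suc m) eq s e fz inv = wp-mono c
        (λ s′ (inv′ , fz′) → rounds-rule c {p} Inv s₀ e₀ step post m (trans (ℕ.+-suc m k) eq) _
           (trans (update-≡ (index s′) {n = i} refl) (cong suc (trans (fz′ _ (there (here refl))) e)))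
           (λ _ i∈ → trans (update-≢ (index s′) (∈-≢ p i∈)) (trans (fz′ _ (weaken i∈)) (fz _ i∈)))
           inv′)
        s (wp-frame c s (step k s (subst (suc k ℕ.≤_) eq (s≤s (ℕ.m≤n+m k m))) e fz inv))

    for-rule : ∀ {n i} {p : T (notᵇ (i ∈ᵇ (0 ∷ fr)))} (c : Cmd (i ∷ fr)) (Inv : ℕ → Store → Set)
      {Q : Store → Set} s → index s 0 ≡ n → Inv 0 (setIndex i 0 s) →
      (∀ k s′ → k ℕ.< n → index s′ i ≡ k → Frozen fr s s′ → Inv k s′ →
         wp c (λ s″ → Inv (suc k) (effect (increment i) s″)) s′) →
      (∀ s′ → Frozen fr s s′ → Inv n s′ → Q s′) →
      wp (for i {p} c) Q s
    for-rule {n = n} {i} {p} c Inv s e₀ base step post = rounds-rule c {p} Inv s e₀ step post (index s 0)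
      (trans (ℕ.+-identityʳ _) e₀) _ (update-≡ (index s) {n = i} refl) (λ _ i∈ → update-≢ (index s) (∈-≢ p i∈)) base

  -- In `c ⨾ d` the summands are reversed because positions are built up as
  -- `size d ℕ.+ (size c ℕ.+ o)`.
  size : Cmd fr → ℕ
  size (op I)        = 1
  size (guess r)     = 1
  size skip          = 0
  size (c ⨾ d)       = size d ℕ.+ size c
  size (if≈ r s c d) = size c ℕ.+ (1 ℕ.+ (size d ℕ.+ 1))
  size (if≡ i j c d) = size c ℕ.+ (1 ℕ.+ (size d ℕ.+ 1))
  size (for i c)     = 2 ℕ.+ (size c ℕ.+ 2)
  size (halt b)      = 1

  -- Index register 0 equals itself, so the conditional jump is always taken.
  jump : ℕ → Instruction
  jump l = jumpIndex≡ 0 0 l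

  -- Jump targets are absolute, hence the offset `o`. A failed test falls through to the next line,
  -- so the second branch of a conditional is placed first. A loop tests its counter against the
  -- input length at line `suc o`, to which the body returns.
  code : ℕ → Cmd fr → List Instruction
  code o (op I)        = I ∷ []
  code o (guess r)     = guess r ∷ []
  code o skip          = []
  code o (c ⨾ d)       = code o c ++ code (size c ℕ.+ o) d
  code o (if≈ r s c d) = jump≈ r s (suc (size d ℕ.+ suc o)) ∷ code (suc o) d
    ++ jump (size c ℕ.+ suc (size d ℕ.+ suc o)) ∷ code (suc (size d ℕ.+ suc o)) c
  code o (if≡ i j c d) = jumpIndex≡ i j (suc (size d ℕ.+ suc o)) ∷ code (suc o) d
    ++ jump (size c ℕ.+ suc (size d ℕ.+ suc o)) ∷ code (suc (size d ℕ.+ suc o)) c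
  code o (for i c)     = reset i ∷ jumpIndex≡ i 0 (2 ℕ.+ (size c ℕ.+ (2 ℕ.+ o))) ∷ code (2 ℕ.+ o) c
    ++ increment i ∷ jump (suc o) ∷ []
  code o (halt true)   = accept ∷ []
  code o (halt false)  = reject ∷ []

  length-code : ∀ o (c : Cmd fr) → length (code o c) ≡ size c
  length-code o (op I)        = refl
  length-code o (guess r)     = refl
  length-code o skip          = refl
  length-code o (c ⨾ d)       = trans (length-++ (code o c))
    (trans (cong₂ ℕ._+_ (length-code o c) (length-code _ d)) (ℕ.+-comm (size c) (size d)))
  length-code o (if≈ r s c d) = trans (cong suc (trans (length-++ (code (suc o) d))
    (cong₂ (λ a b → a ℕ.+ suc b) (length-code _ d) (length-code _ c))))
    (let open +-*-Solver in solve 2 (λ c d → con 1 :+ (d :+ (con 1 :+ c)) := c :+ (con 1 :+ (d :+ con 1))) refl (size c) (size d))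
  length-code o (if≡ r s c d) = trans (cong suc (trans (length-++ (code (suc o) d))
    (cong₂ (λ a b → a ℕ.+ suc b) (length-code _ d) (length-code _ c))))
    (let open +-*-Solver in solve 2 (λ c d → con 1 :+ (d :+ (con 1 :+ c)) := c :+ (con 1 :+ (d :+ con 1))) refl (size c) (size d))
  length-code o (for i c)     = cong (2 ℕ.+_) (trans (length-++ (code (2 ℕ.+ o) c)) (cong (ℕ._+ 2) (length-code _ c)))
  length-code o (halt true)   = refl
  length-code o (halt false)  = refl

  Located : Program → ℕ → List Instruction → Set
  Located M o []       = ⊤
  Located M o (I ∷ Is) = nth M o ≡ just I × Located M (suc o) Is

  located-++ : ∀ M o Is {Js} → Located M o (Is ++ Js) → Located M o Is × Located M (length Is ℕ.+ o) Js
  located-++ M o []            l       = tt , l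
  located-++ M o (I ∷ Is) {Js} (e , l) =
    let (l₁ , l₂) = located-++ M (suc o) Is l
    in (e , l₁) , subst (λ k → Located M k Js) (ℕ.+-suc (length Is) o) l₂

  located-self : ∀ M → Located M 0 M
  located-self M = go [] M refl
    where
    nth-++ : ∀ Is {I : Instruction} {Js} → nth (Is ++ I ∷ Js) (length Is) ≡ just I
    nth-++ []       = refl
    nth-++ (_ ∷ Is) = nth-++ Is
    go : ∀ Is Js → Is ++ Js ≡ M → Located M (length Is) Js
    go Is []       e = tt
    go Is (J ∷ Js) e = subst (λ N → nth N (length Is) ≡ just J) e (nth-++ Is) ,
      subst (λ k → Located M k Js) (trans (length-++ Is) (ℕ.+-comm (length Is) 1))
        (go (Is ++ J ∷ []) Js (trans (assoc Is) e))
      where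
      assoc : ∀ Is → (Is ++ J ∷ []) ++ Js ≡ Is ++ J ∷ Js
      assoc []       = refl
      assoc (I ∷ Is) = cong (I ∷_) (assoc Is)

  -- An upper bound. Adding up both branches of a conditional avoids maxima in the polynomial
  -- estimate.
  time : ℕ → Cmd fr → ℕ
  time n (op I)        = 1
  time n (guess r)     = 1
  time n skip          = 0
  time n (c ⨾ d)       = time n c ℕ.+ time n d
  time n (if≈ r s c d) = 1 ℕ.+ (time n c ℕ.+ (time n d ℕ.+ 1))
  time n (if≡ i j c d) = 1 ℕ.+ (time n c ℕ.+ (time n d ℕ.+ 1))
  time n (for i c)     = 2 ℕ.+ n ℕ.* (1 ℕ.+ (time n c ℕ.+ 2))
  time n (halt b)      = 1

  module Execution (Ok : Store → Carrier → Set) (H : Bool → Set) (M : Program) where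

    open WP Ok H

    OkIn : Configuration → Carrier → Set
    OkIn (running (state _ x m ι)) = Ok (store x m ι)
    OkIn (halted _)              _ = ⊤

    -- All admissible runs from c reach P within n steps.
    data Reach : ℕ → Configuration → (Configuration → Set) → Set₁ where
      now   : ∀ {n c P} → P c → Reach n c P
      later : ∀ {n c P} → (∀ g → OkIn c g → Reach n (step M g c) P) → Reach (suc n) c P

    reach-weaken : ∀ {n n′} → n ℕ.≤ n′ → ∀ {c P} → Reach n c P → Reach n′ c P
    reach-weaken le       (now p)   = now p
    reach-weaken (s≤s le) (later f) = later λ g ok → reach-weaken le (f g ok)

    reach-bind : ∀ n n′ {c P Q} → Reach n c P → (∀ c′ → P c′ → Reach n′ c′ Q) → Reach (n ℕ.+ n′) c Q
    reach-bind n       n′ (now p)   f = reach-weaken (ℕ.m≤n+m n′ n) (f _ p)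
    reach-bind (suc n) n′ (later r) f = later λ g ok → reach-bind n n′ (r g ok) f

    Outcome : ℕ → ℕ → (Store → Set) → Configuration → Set
    Outcome l n Q c = (∃ λ s → c ≡ at l s × index s 0 ≡ n × Q s) ⊎ (∃ λ b → c ≡ halted b × H b)

    private
      step-at : ∀ {I l} s g → nth M l ≡ just I →
                step M g (at l s) ≡ execute g I (state l (register s) (memory s) (index s))
      step-at {l = l} s g e with nth M l
      step-at s g refl | just I = refl

      one : ∀ l {I P} s → nth M l ≡ just I →
            (∀ g → Ok s g → P (execute g I (state l (register s) (memory s) (index s)))) → Reach 1 (at l s) P
      one l {P = P} s e f = later λ g ok → now (subst P (sym (step-at s g e)) (f g ok))

      then : ∀ l n {I P} s → nth M l ≡ just I →
             (∀ g → Ok s g → Reach n (execute g I (state l (register s) (memory s) (index s))) P) → Reach (suc n) (at l s) P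
      then l n {P = P} s e f = later λ g ok → subst (λ c → Reach n c P) (sym (step-at s g e)) (f g ok)

      plain-step : ∀ I → T (plain fr I) → ∀ {l} s g →
        execute g I (state l (register s) (memory s) (index s)) ≡ at (suc l) (effect I s)
      plain-step (constant r c)    t s g = refl
      plain-step (add r _ _)       t s g = refl
      plain-step (subtract r _ _)  t s g = refl
      plain-step (multiply r _ _)  t s g = refl
      plain-step (load r i)        t s g = refl
      plain-step (store r i)       t s g = refl
      plain-step (reset i)         t s g = refl
      plain-step (increment i)     t s g = refl
      plain-step (copyIndex i j)   t s g = refl

      take-jump : ∀ {n l l′ Q} s → nth M l ≡ just (jump l′) → index s 0 ≡ n → Q s → Reach 1 (at l s) (Outcome l′ n Q)
      take-jump {l = l} {l′} s e e₀ q = one l s e λ g _ → inj₁ (s , jumps , e₀ , q)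
        where
        jumps : at (if does (index s 0 ℕ.≟ index s 0) then l′ else suc l) s ≡ at l′ s
        jumps rewrite ≡ᵇ-yes {index s 0} refl = refl

      outcome-bind : ∀ {l l′ n} a b {c Q Q′} → Reach a c (Outcome l n Q) →
        (∀ s → index s 0 ≡ n → Q s → Reach b (at l s) (Outcome l′ n Q′)) → Reach (a ℕ.+ b) c (Outcome l′ n Q′)
      outcome-bind {l} {l′} {n} a b {Q′ = Q′} r f = reach-bind a b r λ where
        _ (inj₁ (s , refl , e , q)) → f s e q
        _ (inj₂ h)                  → now (inj₂ h)

    private
      module Branches (c d : Cmd fr) {o}
        (l : Located M (suc o) (code (suc o) d
           ++ jump (size c ℕ.+ suc (size d ℕ.+ suc o)) ∷ code (suc (size d ℕ.+ suc o)) c)) where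

        split = located-++ M (suc o) (code (suc o) d) l
        rest = subst (λ k → Located M (k ℕ.+ suc o) (jump (size c ℕ.+ suc (size d ℕ.+ suc o)) ∷ code (suc (size d ℕ.+ suc o)) c))
                 (length-code (suc o) d) (proj₂ split)
        end = size c ℕ.+ (1 ℕ.+ (size d ℕ.+ 1)) ℕ.+ o
        end-eq : size c ℕ.+ suc (size d ℕ.+ suc o) ≡ end
        end-eq = let open +-*-Solver in
          solve 3 (λ c d o → c :+ (con 1 :+ (d :+ (con 1 :+ o))) := c :+ (con 1 :+ (d :+ con 1)) :+ o) refl (size c) (size d) o

    mutual
      compile-correct : ∀ (c : Cmd fr) {o n Q} s → Located M o (code o c) → index s 0 ≡ n → wp c Q s →
        Reach (time n c) (at o s) (Outcome (size c ℕ.+ o) n Q)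
      compile-correct (op I {p}) {o} s (e , _) e₀ w = one o s e λ g _ →
        inj₁ (effect I s , plain-step I p s g , trans (frozen-effect I p s 0 (here refl)) e₀ , w)
      compile-correct (guess r) {o} s (e , _) e₀ w = one o s e λ g ok →
        inj₁ (setRegister r g s , refl , e₀ , w g ok)
      compile-correct skip s l e₀ w = now (inj₁ (s , refl , e₀ , w))
      compile-correct (c ⨾ d) {o} {n} {Q} s l e₀ w =
        let (l₁ , l₂) = located-++ M o (code o c) l
            l₂′ = subst (λ k → Located M (k ℕ.+ o) (code (size c ℕ.+ o) d)) (length-code o c) l₂
        in outcome-bind (time n c) (time n d) (compile-correct c s l₁ e₀ w) λ s′ e₀′ w′ →
             subst (λ k → Reach (time n d) (at (size c ℕ.+ o) s′) (Outcome k n Q)) (sym (ℕ.+-assoc (size d) (size c) o))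
               (compile-correct d s′ l₂′ e₀′ w′)
      compile-correct (if≈ r t c d) {o} {n} {Q} s (e , l) e₀ (w , w′) =
        then o (time n c ℕ.+ (time n d ℕ.+ 1)) s e branch
        where
        branch : ∀ g → Ok s g →
          Reach (time n c ℕ.+ (time n d ℕ.+ 1)) (at (if does (register s r ≟ register s t) then _ else suc o) s)
            (Outcome (size c ℕ.+ (1 ℕ.+ (size d ℕ.+ 1)) ℕ.+ o) n Q)
        branch g _ with register s r ≟ register s t
        ... | yes y = then-branch c d s l e₀ (w y)
        ... | no  y = else-branch c d s l e₀ (w′ y)
      compile-correct (if≡ i j c d) {o} {n} {Q} s (e , l) e₀ (w , w′) =
        then o (time n c ℕ.+ (time n d ℕ.+ 1)) s e branch
        where
        branch : ∀ g → Ok s g →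
          Reach (time n c ℕ.+ (time n d ℕ.+ 1)) (at (if does (index s i ℕ.≟ index s j) then _ else suc o) s)
            (Outcome (size c ℕ.+ (1 ℕ.+ (size d ℕ.+ 1)) ℕ.+ o) n Q)
        branch g _ with index s i ℕ.≟ index s j
        ... | yes y rewrite ≡ᵇ-yes y = then-branch c d s l e₀ (w y)
        ... | no  y rewrite ≡ᵇ-no y  = else-branch c d s l e₀ (w′ y)
      compile-correct {fr = fr} (for i {p} c) {o} {n} {Q} s (e , l) e₀ w =
        subst (λ k → Reach k (at o s) (Outcome (size (for i {p} c) ℕ.+ o) n Q)) (cong suc (ℕ.+-comm _ 1))
          (then o (n ℕ.* (1 ℕ.+ (time n c ℕ.+ 2)) ℕ.+ 1) s e λ g _ →
            rounds-correct i {p} c n (setIndex i 0 s) l (trans (update-≢ (index s) (∉-0 {i} {fr} p)) e₀)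
              (trans (cong (n ℕ.+_) (update-≡ (index s) {n = i} refl)) (ℕ.+-identityʳ n))
              (subst (λ k → rounds i c k Q (setIndex i 0 s)) e₀ w))
      compile-correct (halt true)  {o} s (e , _) e₀ w = one o s e λ _ _ → inj₂ (true , refl , w)
      compile-correct (halt false) {o} s (e , _) e₀ w = one o s e λ _ _ → inj₂ (false , refl , w)

      private
        ∉-0 : ∀ {i fr} → T (notᵇ (i ∈ᵇ (0 ∷ fr))) → 0 ≢ i
        ∉-0 {zero}  ()
        ∉-0 {suc i} _ ()

      -- The equation `k ℕ.+ index s i ≡ n` ties the rounds left to the test in the compiled loop,
      -- which succeeds exactly if `k` is zero. The final `+ 1` pays for that last test.
      rounds-correct : ∀ {fr} i {p : T (notᵇ (i ∈ᵇ (0 ∷ fr)))} (c : Cmd (i ∷ fr)) {o n Q} k s →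
        Located M (suc o) (jumpIndex≡ i 0 (2 ℕ.+ (size c ℕ.+ (2 ℕ.+ o))) ∷ code (2 ℕ.+ o) c
          ++ increment i ∷ jump (suc o) ∷ []) →
        index s 0 ≡ n → k ℕ.+ index s i ≡ n → rounds i c k Q s →
        Reach (k ℕ.* (1 ℕ.+ (time n c ℕ.+ 2)) ℕ.+ 1) (at (suc o) s) (Outcome (size (for i {p} c) ℕ.+ o) n Q)
      rounds-correct i {p} c {o} {n} {Q} zero s (e , l) e₀ ei w = one (suc o) s e exit
        where
        end : 2 ℕ.+ (size c ℕ.+ (2 ℕ.+ o)) ≡ size (for i {p} c) ℕ.+ o
        end = cong (2 ℕ.+_) (sym (ℕ.+-assoc (size c) 2 o))
        exit : ∀ g → Ok s g → Outcome (size (for i {p} c) ℕ.+ o) n Q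
                 (at (if does (index s i ℕ.≟ index s 0) then (2 ℕ.+ (size c ℕ.+ (2 ℕ.+ o))) else suc (suc o)) s)
        exit g _ rewrite ≡ᵇ-yes (trans ei (sym e₀)) = inj₁ (s , cong (λ l → at l s) end , e₀ , w)
      rounds-correct {fr = fr} i {p} c {o} {n} {Q} (suc k) s (e , l) e₀ ei w =
        subst (λ t → Reach t (at (suc o) s) (Outcome end n Q)) arith (then (suc o) _ s e enter)
        where
        end = size (for i {p} c) ℕ.+ o
        T′ = k ℕ.* (1 ℕ.+ (time n c ℕ.+ 2)) ℕ.+ 1
        arith : suc (time n c ℕ.+ (2 ℕ.+ T′)) ≡ suc k ℕ.* (1 ℕ.+ (time n c ℕ.+ 2)) ℕ.+ 1
        arith = let open +-*-Solver in
          solve 2 (λ t m → con 1 :+ (t :+ (con 2 :+ (m :+ con 1))) := ((con 1 :+ (t :+ con 2)) :+ m) :+ con 1) refl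
            (time n c) (k ℕ.* (1 ℕ.+ (time n c ℕ.+ 2)))
        split = located-++ M (2 ℕ.+ o) (code (2 ℕ.+ o) c) l
        tail = subst (λ k → Located M (k ℕ.+ (2 ℕ.+ o)) (increment i ∷ jump (suc o) ∷ [])) (length-code (2 ℕ.+ o) c) (proj₂ split)
        loop : ∀ s′ → index s′ 0 ≡ n → rounds i c k Q (effect (increment i) s′) × Frozen (i ∷ _) s s′ →
               Reach (2 ℕ.+ T′) (at (size c ℕ.+ (2 ℕ.+ o)) s′) (Outcome end n Q)
        loop s′ e₀′ (w′ , fz) = then (size c ℕ.+ (2 ℕ.+ o)) (suc T′) s′ (proj₁ tail) λ g _ →
          outcome-bind 1 T′ {Q = λ s → s ≡ effect (increment i) s′}
            (take-jump (effect (increment i) s′) (proj₁ (proj₂ tail)) (trans (update-≢ (index s′) (∉-0 {i} {fr} p)) e₀′) refl)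
            λ { _ e₀″ refl → rounds-correct i {p} c k (effect (increment i) s′) (e , l) e₀″
                  (trans (cong (k ℕ.+_) (trans (update-≡ (index s′) {n = i} refl) (cong suc (fz _ (there (here refl))))))
                     (trans (ℕ.+-suc k _) ei)) w′ }
        enter : ∀ g → Ok s g → Reach (time n c ℕ.+ (2 ℕ.+ T′))
                  (at (if does (index s i ℕ.≟ index s 0) then _ else suc (suc o)) s) (Outcome end n Q)
        enter g _ rewrite ≡ᵇ-no (λ y → ℕ.m≢1+n+m (index s i) (trans (trans y e₀) (sym ei))) =
          outcome-bind (time n c) (2 ℕ.+ T′)
                        (compile-correct c s (proj₁ split) e₀ (wp-frame c s w)) loop

      private
        then-branch : ∀ (c d : Cmd fr) {o n Q} s → Located M (suc o) (code (suc o) d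
             ++ jump (size c ℕ.+ suc (size d ℕ.+ suc o)) ∷ code (suc (size d ℕ.+ suc o)) c) → index s 0 ≡ n → wp c Q s →
          Reach (time n c ℕ.+ (time n d ℕ.+ 1)) (at (suc (size d ℕ.+ suc o)) s)
            (Outcome (size c ℕ.+ (1 ℕ.+ (size d ℕ.+ 1)) ℕ.+ o) n Q)
        then-branch c d {o} {n} {Q} s l e₀ w = reach-weaken (ℕ.m≤m+n _ _)
          (subst (λ k → Reach (time n c) (at (suc (size d ℕ.+ suc o)) s) (Outcome k n Q)) end-eq (compile-correct c s (proj₂ rest) e₀ w))
          where open Branches c d l

        else-branch : ∀ (c d : Cmd fr) {o n Q} s → Located M (suc o) (code (suc o) d
             ++ jump (size c ℕ.+ suc (size d ℕ.+ suc o)) ∷ code (suc (size d ℕ.+ suc o)) c) → index s 0 ≡ n → wp d Q s →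
          Reach (time n c ℕ.+ (time n d ℕ.+ 1)) (at (suc o) s)
            (Outcome (size c ℕ.+ (1 ℕ.+ (size d ℕ.+ 1)) ℕ.+ o) n Q)
        else-branch c d {o} {n} {Q} s l e₀ w = reach-weaken (ℕ.m≤n+m _ (time n c))
          (outcome-bind (time n d) 1 (compile-correct d s (proj₁ split) e₀ w) λ s′ e₀′ q →
             subst (λ k → Reach 1 (at (size d ℕ.+ suc o) s′) (Outcome k n Q)) end-eq (take-jump s′ (proj₁ rest) e₀′ q))
          where open Branches c d l

  private
    bound-+ : ∀ {c c′} k k′ n → c ℕ.* suc n ℕ.^ k ℕ.+ c′ ℕ.* suc n ℕ.^ k′ ≤ (c ℕ.+ c′) ℕ.* suc n ℕ.^ (k ℕ.+ k′)
    bound-+ {c} {c′} k k′ n = ℕ.≤-trans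
      (ℕ.+-mono-≤ (ℕ.*-monoʳ-≤ c (ℕ.^-monoʳ-≤ (suc n) (ℕ.m≤m+n k k′)))
                  (ℕ.*-monoʳ-≤ c′ (ℕ.^-monoʳ-≤ (suc n) (ℕ.m≤n+m k′ k))))
      (ℕ.≤-reflexive (sym (ℕ.*-distribʳ-+ (suc n ℕ.^ (k ℕ.+ k′)) c c′)))

    bound-const : ∀ m n → m ≤ m ℕ.* suc n ℕ.^ 0
    bound-const m n = ℕ.≤-reflexive (sym (ℕ.*-identityʳ m))

    Polynomial : (ℕ → ℕ) → Set
    Polynomial f = ∃₂ λ c k → ∀ n → f n ≤ c ℕ.* suc n ℕ.^ k

    poly-const : ∀ m → Polynomial (λ _ → m)
    poly-const m = m , 0 , bound-const m

    poly-+ : ∀ {f g} → Polynomial f → Polynomial g → Polynomial (λ n → f n ℕ.+ g n)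
    poly-+ (c , k , f≤) (c′ , k′ , g≤) = c ℕ.+ c′ , k ℕ.+ k′ , λ n →
      ℕ.≤-trans (ℕ.+-mono-≤ (f≤ n) (g≤ n)) (bound-+ {c} {c′} k k′ n)

    poly-n* : ∀ {f} → Polynomial f → Polynomial (λ n → n ℕ.* f n)
    poly-n* (c , k , f≤) = c , suc k , λ n → ℕ.≤-trans (ℕ.*-mono-≤ (ℕ.n≤1+n n) (f≤ n))
      (ℕ.≤-reflexive (let open +-*-Solver in solve 3 (λ n c m → n :* (c :* m) := c :* (n :* m)) refl (suc n) c (suc n ℕ.^ k)))

    time-polynomial : ∀ (c : Cmd fr) → Polynomial (λ n → time n c)
    time-polynomial (op I)        = poly-const 1
    time-polynomial (guess r)     = poly-const 1
    time-polynomial skip          = poly-const 0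
    time-polynomial (c ⨾ d)       = poly-+ (time-polynomial c) (time-polynomial d)
    time-polynomial (if≈ r s c d) =
      poly-+ (poly-const 1) (poly-+ (time-polynomial c) (poly-+ (time-polynomial d) (poly-const 1)))
    time-polynomial (if≡ i j c d) =
      poly-+ (poly-const 1) (poly-+ (time-polynomial c) (poly-+ (time-polynomial d) (poly-const 1)))
    time-polynomial (for i c)     =
      poly-+ (poly-const 2) (poly-n* (poly-+ (poly-const 1) (poly-+ (time-polynomial c) (poly-const 2))))
    time-polynomial (halt b)      = poly-const 1

  initialStore : List Carrier → Store
  initialStore x with initial x
  ... | running (state _ y m ι) = store y m ι
  ... | halted _                = store (λ n → OrderedField.0# K) (λ n → OrderedField.0# K) (λ n → n)

  -- Running past the last line would reject; normal completion of the command is thus turned into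
  -- acceptance.
  program : Cmd [] → Program
  program c = code 0 (c ⨾ halt true)

  module _ (c : Cmd []) where

    open Execution using (now; later)

    private
      M = program c

      run-halted : ∀ γ n b → run M γ n (halted b) ≡ halted b
      run-halted γ zero    b = refl
      run-halted γ (suc n) b = run-halted (γ ∘ suc) n b

      duration : List Carrier → ℕ
      duration x = time (length x) (c ⨾ halt true)

      Halts : (Bool → Set) → Configuration → Set
      Halts H c = ∃ λ b → c ≡ halted b × H b

      reach-halt : ∀ (Ok : Store → Carrier → Set) (H : Bool → Set) x → WP.wp Ok H c (λ _ → H true) (initialStore x) →
        Execution.Reach Ok H M (duration x) (initial x) (Halts H)
      reach-halt Ok H x w = subst (λ k → Reach k (initial x) (Halts H)) (ℕ.+-identityʳ _)
        (reach-bind (time (length x) (c ⨾ halt true)) 0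
          -- The trailing `halt true` leaves no normal exit, so the postcondition can be chosen
          -- false and only the halting outcome remains.
          (compile-correct (c ⨾ halt true) {Q = λ _ → ⊥} (initialStore x) (located-self M) refl w)
          λ where
            _ (inj₁ (_ , _ , _ , ()))
            _ (inj₂ h) → Execution.now h)
        where open Execution Ok H M hiding (now; later)

      -- With unrestricted guesses the tree `Reach` branches over all field elements, and `γ`
      -- selects one path in it.
      demonic : ∀ {H γ P} n c → Execution.Reach (λ _ _ → ⊤) H M n c P → ∃ λ m → m ≤ n × P (run M γ m c)
      demonic n       c (now p) = 0 , z≤n , p
      demonic {γ = γ} (suc n) (running s) (later f) =
        let (m , m≤n , p) = demonic {γ = γ ∘ suc} n _ (f (γ 0) tt) in suc m , s≤s m≤n , p
      demonic {γ = γ} (suc n) (halted b) (later f) =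
        let (m , m≤n , p) = demonic {γ = γ ∘ suc} n _ (f (γ 0) tt) in suc m , s≤s m≤n , p

      -- Here `γ` is built along the path: in every running state an admissible guess is chosen and
      -- recorded.
      angelic : ∀ {Ok : Store → Carrier → Set} {H P} → (∀ s → ∃ (Ok s)) →
        ∀ n c → Execution.Reach Ok H M n c P → ∃₂ λ γ m → P (run M γ m c)
      angelic ok n c (now p) = (λ _ → OrderedField.0# K) , 0 , p
      angelic ok (suc n) (running (state l x m ι)) (later f) =
        let (g , okg) = ok (store x m ι)
            (γ , k , p) = angelic ok n _ (f g okg)
        in (λ { zero → g ; (suc i) → γ i }) , suc k , p
      angelic ok (suc n) (halted b) (later f) =
        let (γ , k , p) = angelic ok n _ (f (OrderedField.0# K) tt)
        in (λ { zero → OrderedField.0# K ; (suc i) → γ i }) , suc k , p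

      run-beyond : ∀ {γ b} {m n} → m ≤ n → ∀ c → run M γ m c ≡ halted b → run M γ n c ≡ halted b
      run-beyond {γ} {n = n} z≤n _ refl = run-halted γ n _
      run-beyond (s≤s m≤n) c e = run-beyond m≤n _ e

    program-polynomial : PolynomialTime M
    program-polynomial =
      let (a , k , t≤) = time-polynomial (c ⨾ halt true)
      in a , k , λ x γ →
        let open WP (λ _ _ → ⊤) (λ _ → ⊤)
            (m , m≤ , b , e , _) = demonic {γ = γ} {P = Halts (λ _ → ⊤)} (duration x) (initial x) (reach-halt _ (λ _ → ⊤) x (wp-total (λ _ → tt) c (λ _ → tt) (initialStore x)))
        in b , run-beyond (ℕ.≤-trans m≤ (t≤ (length x))) _ e

    -- The precondition holds for every sequence of guesses, in particular for that of the given
    -- accepting run. It makes this run halt with a verdict that yields `P` if it is `true`, and for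
    -- fixed `γ` a run has only one verdict.
    accepts-sound : ∀ {P : Set} x →
      WP.wp (λ _ _ → ⊤) (λ b → b ≡ true → P) c (λ _ → P) (initialStore x) → Accepts M x → P
    accepts-sound {P} x w (γ , n , e) =
      let H = λ b → b ≡ true → P
          (m , _ , b , e′ , h) = demonic {γ = γ} {P = Halts H} (duration x) (initial x)
            (reach-halt (λ _ _ → ⊤) H x (WP.wp-mono _ H c (λ _ p _ → p) _ w))
      in h (agree m b e′)
      where
      agree : ∀ m b → run M γ m (initial x) ≡ halted b → b ≡ true
      agree m b e′ with ℕ.≤-total m n
      ... | inj₁ m≤n with trans (sym (run-beyond m≤n _ e′)) e
      ...   | refl = refl
      agree m b e′ | inj₂ n≤m with trans (sym e′) (run-beyond n≤m _ e)
      ...   | refl = refl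

    accepts-complete : ∀ {Ok : Store → Carrier → Set} x → (∀ s → ∃ (Ok s)) →
      WP.wp Ok (_≡ true) c (λ _ → ⊤) (initialStore x) → Accepts M x
    accepts-complete {Ok} x ok w =
      let (γ , n , _ , e , b) = angelic {H = _≡ true} {P = Halts (_≡ true)} ok (duration x) (initial x) (reach-halt Ok (_≡ true) x (WP.wp-mono _ _ c (λ _ _ → refl) _ w))
      in γ , n , trans e (cong halted b)

-- The automaton that parses a word and splits one coordinate

module Automata (K : OrderedField) where

  open import Data.Bool.Base using (Bool; true; false; if_then_else_) renaming (not to notᵇ)
  open import Data.List.Base using (List; []; _∷_; length)
  open import Data.Maybe.Base using (Maybe; just; nothing; _>>=_)
  open import Data.Nat.Base as ℕ using (ℕ; zero; suc; _≤_; z≤n; s≤s)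
  import Data.Nat.Properties as ℕ
  open import Data.Product.Base using (∃; _×_; _,_)
  open import Relation.Binary.PropositionalEquality using (_≡_; refl)
  open import Relation.Nullary.Decidable.Core using (yes; no)

  open OrderedField K using (Carrier; _+_; _*_; _-_; -_; 0#; 1#; _≟_)

  -- A vector of a sum is split between the operands; a vector of an intersection is handed to both
  -- unchanged.
  left right : Bool → Carrier → Carrier → Carrier
  left  split v g = if split then g else v
  right split v g = if split then v - g else v

  sgn : Bool → Carrier
  sgn σ = if σ then 1# else - 1#

  -- What has been read of the current symbol.
  data Mode : Set where
    start m0 m1 m11 m111 flag digit done : Mode

  modeIndex : Mode → ℕ
  modeIndex start = 0
  modeIndex m0    = 1
  modeIndex m1    = 2
  modeIndex m11   = 3
  modeIndex m111  = 4
  modeIndex flag  = 5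
  modeIndex digit = 6
  modeIndex done  = 7

  -- The current subterm t and the subterms t on the stack come with a sign σ and
  -- one coordinate v of a vector required to lie in t, or in its
  -- orthocomplement if σ is false.
  record Config : Set where
    constructor conf
    field
      mode   : Mode
      sign   : Bool
      value  : Carrier
      power  : Carrier
      name   : Carrier
      stack  : List (Bool × Carrier)
  open Config public

  pop : Config → Config
  pop (conf _ σ v w c [])             = conf done  σ v w c []
  pop (conf _ _ _ w c ((σ , v) ∷ st)) = conf start σ v w c st

  fork : Bool → Carrier → Config → Config
  fork split g (conf _ σ v w c st) = conf start σ (left split v g) w c ((σ , right split v g) ∷ st)

  requireZero : Bool → Config → Maybe Config
  requireZero false a = just (pop a)
  requireZero true  a with value a ≟ 0#
  ... | yes _ = just (pop a)
  ... | no  _ = nothing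

  δ : Bool → Carrier → Config → Maybe Config
  δ false g (conf start σ v w c st) = just (conf m0 σ v w c st)
  δ true  g (conf start σ v w c st) = just (conf m1 σ v w c st)
  -- The name starts at 1 instead of 0, so it ends as one more than the index: it is positive, and
  -- attaching a sign to it loses nothing.
  δ false g (conf m0    σ v w c st) = just (conf flag σ v 1# 1# st)
  δ true  g (conf m0    σ v w c st) = just (conf start (notᵇ σ) v w c st)
  -- The orthocomplement of a meet is the sum of the orthocomplements: a meet splits under the
  -- negative sign, a join under the positive one.
  δ false g (conf m1    σ v w c st) = just (fork (notᵇ σ) g (conf start σ v w c st))
  δ true  g (conf m1    σ v w c st) = just (conf m11 σ v w c st)
  δ false g (conf m11   σ v w c st) = just (fork σ g (conf start σ v w c st))
  δ true  g (conf m11   σ v w c st) = just (conf m111 σ v w c st)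
  δ false g (conf m111  σ v w c st) = requireZero σ (conf start σ v w c st)
  δ true  g (conf m111  σ v w c st) = requireZero (notᵇ σ) (conf start σ v w c st)
  δ false g (conf flag  σ v w c st) = just (pop (conf start σ v w c st))
  δ true  g (conf flag  σ v w c st) = just (conf digit σ v w c st)
  -- In bijective base 2 this bit announces the digit 2 and the next clause the digit 1. The sums
  -- are associated as the machine's additions produce them, because the store is described up to
  -- `≡`.
  δ false g (conf digit σ v w c st) = just (conf flag σ v (w + w) ((c + w) + w) st)
  δ true  g (conf digit σ v w c st) = just (conf flag σ v (w + w) (c + w) st)
  -- Any bit after the end of the term kills the trace, so only exact encodings end in `done`.
  δ b     g (conf done  σ v w c st) = nothing

  -- The value, resp. signed name, of the variable whose symbol is completed by the bit.
  outValue outName : Bool → Config → Carrier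
  outValue false (conf flag σ v w c st) = v + 0#
  outValue _     _                      = 0#
  outName  false (conf flag σ v w c st) = sgn σ * c
  outName  _     _                      = 0#

  module Trace (word : ℕ → Bool) (g : ℕ → Carrier) where

    trace : ℕ → Maybe Config
    -- In mode `start` no guess is consulted, so the slot of position 0 is free to carry the
    -- coordinate of the root vector.
    trace zero    = just (conf start true (g 0) 1# 1# [])
    trace (suc q) = trace q >>= δ (word q) (g q)

    valueAt nameAt : ℕ → Carrier
    valueAt q with trace q
    ... | just a  = outValue (word q) a
    ... | nothing = 0#
    nameAt q with trace q
    ... | just a  = outName (word q) a
    ... | nothing = 0#

    Done : ℕ → Set
    Done q = ∃ λ a → trace q ≡ just a × mode a ≡ done

    trace-step : ∀ {q a} → trace q ≡ just a → trace (suc q) ≡ δ (word q) (g q) a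
    trace-step {q} e rewrite e = refl

    valueAt-≡ : ∀ {q a} → trace q ≡ just a → valueAt q ≡ outValue (word q) a
    valueAt-≡ {q} e with trace q
    valueAt-≡ refl | just a = refl

    nameAt-≡ : ∀ {q a} → trace q ≡ just a → nameAt q ≡ outName (word q) a
    nameAt-≡ {q} e with trace q
    nameAt-≡ refl | just a = refl

    private
      pop-height : ∀ a → length (stack (pop a)) ≤ length (stack a)
      pop-height (conf _ _ _ _ _ [])       = z≤n
      pop-height (conf _ _ _ _ _ (_ ∷ st)) = ℕ.n≤1+n _

      zero-height : ∀ s a {a′} → requireZero s a ≡ just a′ → length (stack a′) ≤ suc (length (stack a))
      zero-height false a refl = ℕ.m≤n⇒m≤1+n (pop-height a)
      zero-height true  a e with value a ≟ 0#
      zero-height true  a refl | yes _ = ℕ.m≤n⇒m≤1+n (pop-height a)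

      δ-height : ∀ b g a {a′} → δ b g a ≡ just a′ → length (stack a′) ≤ suc (length (stack a))
      δ-height false g (conf start σ v w c st) refl = ℕ.n≤1+n _
      δ-height true  g (conf start σ v w c st) refl = ℕ.n≤1+n _
      δ-height false g (conf m0    σ v w c st) refl = ℕ.n≤1+n _
      δ-height true  g (conf m0    σ v w c st) refl = ℕ.n≤1+n _
      δ-height false g (conf m1    σ v w c st) refl = ℕ.≤-refl
      δ-height true  g (conf m1    σ v w c st) refl = ℕ.n≤1+n _
      δ-height false g (conf m11   σ v w c st) refl = ℕ.≤-refl
      δ-height true  g (conf m11   σ v w c st) refl = ℕ.n≤1+n _
      δ-height false g (conf m111  σ v w c st) e    = zero-height σ _ e
      δ-height true  g (conf m111  σ v w c st) e    = zero-height (notᵇ σ) _ e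
      δ-height false g (conf flag  σ v w c st) refl = ℕ.m≤n⇒m≤1+n (pop-height (conf start σ v w c st))
      δ-height true  g (conf flag  σ v w c st) refl = ℕ.n≤1+n _
      δ-height false g (conf digit σ v w c st) refl = ℕ.n≤1+n _
      δ-height true  g (conf digit σ v w c st) refl = ℕ.n≤1+n _
      δ-height true  g (conf done  σ v w c st) ()
      δ-height false g (conf done  σ v w c st) ()

    -- Each bit pushes at most one entry. The bound guarantees that a search through the stack ends
    -- within n rounds, the only loop length available.
    height : ∀ q {a} → trace q ≡ just a → length (stack a) ≤ q
    height zero    refl = z≤n
    height (suc q) e with trace q in eq
    ... | just a  = ℕ.≤-trans (δ-height (word q) (g q) a e) (s≤s (height q eq))
    height (suc q) () | nothing

  -- The new term comes last, as in the machine's accumulator, so that loop invariants about sums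
  -- hold by computation.
  sumTo : ℕ → (ℕ → Carrier) → Carrier
  sumTo zero    f = 0#
  sumTo (suc n) f = sumTo n f + f n

-- The verifying machine and its correctness

module Verifiers (K : OrderedField) where

  open import Data.Bool.Base using (Bool; true; false; if_then_else_) renaming (not to notᵇ)
  open import Data.Empty using (⊥; ⊥-elim)
  open import Data.List.Base using (List; []; _∷_; length; map)
  open import Data.List.Properties using (length-map)
  open import Data.Maybe.Base using (Maybe; just; nothing; fromMaybe)
  open import Data.Nat.Base as ℕ using (ℕ; zero; suc; _≤_; _<_; z≤n; s≤s)
  import Data.Nat.Properties as ℕ
  open import Data.Nat.Solver using (module +-*-Solver)
  open import Data.Product.Base using (∃; _×_; _,_; proj₁; proj₂)
  open import Data.Sum.Base using (_⊎_; inj₁; inj₂)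
  open import Data.Unit.Base using (⊤; tt)
  open import Function.Base using (_∘_)
  open import Function.Bundles using (_⇔_; mk⇔)
  open import Relation.Binary.PropositionalEquality
  open import Relation.Nullary.Decidable.Core using (yes; no)
  open import Relation.Nullary.Negation.Core using (¬_)

  open OrderedField K using (Carrier; _+_; _*_; _-_; -_; 0#; 1#; _≈_; _≉_; _≟_)
  private module K = OrderedField K
  open OrderedFieldProperties K using (1≉0; -1≉1)
  open BSS K
  open StructuredPrograms K
  open Automata K

  -- K-registers: 0 zero, 1 one, 2 value, 3 sign, 4 power, 5 name, 6 bit, 7 guess,
  -- 8 and 9 the output, 10 sum of squares of the root coordinates.
  -- Index registers: 1 coordinate, 2 position, 5 mode, 7 and 8 output pointers,
  -- 9 stack pointer, 13 bottom of the stack, 14 first address of the names.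
  -- Memory: the n input bits, a guessed n × n matrix in which row j is replaced by the
  -- values output in pass j, n names, the stack.

  Step : Set
  Step = Cmd (2 ∷ 1 ∷ [])

  setMode : ℕ → Step
  setMode zero    = op (reset 5)
  setMode (suc k) = setMode k ⨾ op (increment 5)

  -- Index register 10 walks up the stack entry by entry, two cells each; register 12 retains the
  -- entry that ends at the stack pointer 9.
  popLoop : Cmd (3 ∷ 2 ∷ 1 ∷ [])
  popLoop = op (copyIndex 11 10) ⨾ op (increment 11) ⨾ op (increment 11) ⨾
            if≡ 11 9 (op (copyIndex 12 10)) skip ⨾ op (copyIndex 10 11)

  -- There is no decrement, so the new top is searched for from the bottom of the stack.
  popCmd : Step
  popCmd = if≡ 9 13 (setMode 7)
    (op (copyIndex 10 13) ⨾ for 3 popLoop ⨾ op (copyIndex 9 12) ⨾ op (copyIndex 11 9) ⨾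
     op (load 2 9) ⨾ op (increment 11) ⨾ op (load 3 11) ⨾ setMode 0)

  pushSign dup split popIfZero : Step
  pushSign  = op (increment 9) ⨾ op (store 3 9) ⨾ op (increment 9) ⨾ setMode 0
  dup       = op (store 2 9) ⨾ pushSign
  -- The left operand receives the guess, fetched again from its memory cell, which the output has
  -- not yet overwritten; `v - g` goes to the stack.
  split     = op (subtract 11 2 7) ⨾ op (load 2 7) ⨾ op (store 11 9) ⨾ pushSign
  popIfZero = if≈ 2 0 popCmd (halt false)

  cases : List Step
  cases =
      if≈ 6 0 (setMode 1) (setMode 2)
    ∷ if≈ 6 0 (op (constant 4 1#) ⨾ op (constant 5 1#) ⨾ setMode 5)
              (if≈ 3 1 (op (constant 3 (- 1#))) (op (constant 3 1#)) ⨾ setMode 0)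
    ∷ if≈ 6 0 (if≈ 3 1 dup split) (setMode 3)
    ∷ if≈ 6 0 (if≈ 3 1 split dup) (setMode 4)
    ∷ if≈ 6 0 (if≈ 3 1 popIfZero popCmd) (if≈ 3 1 popCmd popIfZero)
    -- Adding the zero in register 0 copies a register; this is the origin of `v + 0#` in
    -- `outValue`.
    ∷ if≈ 6 0 (op (add 8 2 0) ⨾ op (multiply 9 3 5) ⨾ popCmd) (setMode 6)
    ∷ if≈ 6 0 (op (add 5 5 4) ⨾ op (add 5 5 4) ⨾ op (add 4 4 4) ⨾ setMode 5)
              (op (add 5 5 4) ⨾ op (add 4 4 4) ⨾ setMode 5)
    ∷ []

  -- Index registers can only be compared with each other, so register 6 counts through the modes
  -- until it meets the current one. Mode `done` has no case and ends in rejection.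
  switch : List Step → Step
  switch []       = halt false
  switch (c ∷ cs) = if≡ 5 6 c (op (increment 6) ⨾ switch cs)

  bitStep : Step
  bitStep = op (load 6 2) ⨾ op (load 7 7) ⨾ op (constant 8 0#) ⨾ op (constant 9 0#) ⨾
            op (reset 6) ⨾ switch cases ⨾
            -- The value replaces the guess just consumed, so that the guessed matrix gradually
            -- turns into the matrix of outputs.
            op (store 8 7) ⨾ op (store 9 8) ⨾ op (increment 7) ⨾ op (increment 8)

  pass : Cmd (1 ∷ [])
  pass = op (copyIndex 8 14) ⨾ op (copyIndex 9 13) ⨾ op (load 2 7) ⨾ op (multiply 11 2 2) ⨾ op (add 10 10 11) ⨾
         op (constant 3 1#) ⨾ op (constant 4 1#) ⨾ op (constant 5 1#) ⨾ op (reset 5) ⨾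
         for 2 bitStep ⨾
         -- Register 6 is brought to 7, the index of `done`: the word must be exactly one term.
         op (reset 6) ⨾ op (increment 6) ⨾ op (increment 6) ⨾ op (increment 6) ⨾ op (increment 6) ⨾
         op (increment 6) ⨾ op (increment 6) ⨾ op (increment 6) ⨾ if≡ 5 6 skip (halt false)

  checkPair : Cmd (4 ∷ 2 ∷ [])
  checkPair =
    op (copyIndex 19 15) ⨾ op (copyIndex 20 17) ⨾ op (constant 12 0#) ⨾
    -- Registers 19 and 20 run down two columns of the matrix. Addresses can only be incremented, so
    -- the step to the next row is a loop of n increments.
    for 1 (op (load 13 19) ⨾ op (load 14 20) ⨾ op (multiply 13 13 14) ⨾ op (add 12 12 13) ⨾
           for 3 (op (increment 19) ⨾ op (increment 20))) ⨾
    op (load 13 16) ⨾ op (load 14 18) ⨾ op (add 13 13 14) ⨾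
    if≈ 13 0 (if≈ 12 0 skip (halt false)) skip ⨾
    op (increment 17) ⨾ op (increment 18)

  guessMatrix setup checkPairs verifier : Cmd []
  guessMatrix = op (copyIndex 7 0) ⨾ for 1 (for 2 (guess 7 ⨾ op (store 7 7) ⨾ op (increment 7)))
  -- Pointer 7 has come to rest just behind the matrix, where the names begin; the stack starts n
  -- cells further.
  setup = op (copyIndex 14 7) ⨾ op (copyIndex 13 7) ⨾ for 1 (op (increment 13)) ⨾
          op (constant 1 1#) ⨾ op (copyIndex 7 0)
  checkPairs = op (copyIndex 15 0) ⨾ op (copyIndex 16 14) ⨾
    for 2 (op (copyIndex 17 0) ⨾ op (copyIndex 18 14) ⨾ for 4 checkPair ⨾ op (increment 15) ⨾ op (increment 16))
  verifier = guessMatrix ⨾ setup ⨾ for 1 pass ⨾ if≈ 10 0 (halt false) skip ⨾ checkPairs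

  module Correctness (Ok : Store → Carrier → Set) (H : Bool → Set)
    (n : ℕ) (word : ℕ → Bool) (G : ℕ → Carrier) where

    open WP Ok H

    row : ℕ → ℕ → Carrier
    row j q = G (j ℕ.* n ℕ.+ q)

    module Row j = Trace word (row j)

    names base : ℕ
    names = n ℕ.+ n ℕ.* n
    base  = names ℕ.+ n

    squares : ℕ → Carrier
    squares j = sumTo j (λ i → row i 0 * row i 0)

    -- Row `j` is in transition: before position `p` it contains outputs, from `p` on still guesses.
    record MemoryInv (j p : ℕ) (m : ℕ → Carrier) : Set where
      field
        input   : ∀ k → k < n → m k ≡ bit (word k)
        guesses : ∀ a → j ℕ.* n ℕ.+ p ≤ a → a < n ℕ.* n → m (n ℕ.+ a) ≡ G a
        rows    : ∀ i q → i < j → q < n → m (n ℕ.+ (i ℕ.* n ℕ.+ q)) ≡ Row.valueAt i q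
        current : ∀ q → q < p → m (n ℕ.+ (j ℕ.* n ℕ.+ q)) ≡ Row.valueAt j q
        named   : ∀ q → q < p → m (names ℕ.+ q) ≡ Row.nameAt j q

    Stack : (ℕ → Carrier) → List (Bool × Carrier) → ℕ → Set
    Stack m []             sp = sp ≡ base
    Stack m ((σ , v) ∷ st) sp = ∃ λ sp′ → sp ≡ 2 ℕ.+ sp′ × m sp′ ≡ v × m (suc sp′) ≡ sgn σ × Stack m st sp′

    -- The parameters are the contents of single registers and not a store. An instruction that
    -- writes to other registers then leaves the type unchanged by computation, and the same record
    -- can be passed on.
    record Env (j p : ℕ) (x y : Carrier) (r₀ r₁ r₈ r₉ r₁₀ : Carrier) (i₀ i₇ i₈ i₁₃ i₁₄ : ℕ)
               (m : ℕ → Carrier) : Set where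
      constructor env
      field
        r₀≡  : r₀ ≡ 0#
        r₁≡  : r₁ ≡ 1#
        r₈≡  : r₈ ≡ x
        r₉≡  : r₉ ≡ y
        r₁₀≡ : r₁₀ ≡ squares (suc j)
        i₀≡  : i₀ ≡ n
        i₇≡  : i₇ ≡ n ℕ.+ (j ℕ.* n ℕ.+ p)
        i₈≡  : i₈ ≡ names ℕ.+ p
        i₁₃≡ : i₁₃ ≡ base
        i₁₄≡ : i₁₄ ≡ names
        mem  : MemoryInv j p m

    record Holds (a : Config) (r₂ r₃ r₄ r₅ : Carrier) (i₅ i₉ : ℕ) (m : ℕ → Carrier) : Set where
      constructor holds
      field
        r₂≡ : r₂ ≡ value a
        r₃≡ : r₃ ≡ sgn (sign a)
        r₄≡ : r₄ ≡ power a
        r₅≡ : r₅ ≡ name a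
        i₅≡ : i₅ ≡ modeIndex (mode a)
        stk : Stack m (stack a) i₉

    InEnv : (j p : ℕ) (x y : Carrier) → Store → Set
    InEnv j p x y (store r m i) = Env j p x y (r 0) (r 1) (r 8) (r 9) (r 10) (i 0) (i 7) (i 8) (i 13) (i 14) m

    Represents : Config → Store → Set
    Represents a (store r m i) = Holds a (r 2) (r 3) (r 4) (r 5) (i 5) (i 9) m

    stack-height : ∀ {m} st {sp} → Stack m st sp → sp ≡ 2 ℕ.* length st ℕ.+ base
    stack-height []             e = e
    stack-height ((σ , v) ∷ st) (sp′ , refl , _ , _ , s) = trans (cong (2 ℕ.+_) (stack-height st s))
      (solve 2 (λ l b → con 2 :+ (con 2 :* l :+ b) := con 2 :* (con 1 :+ l) :+ b) refl (length st) base)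
      where open +-*-Solver

    stack-resp : ∀ {m m′} st {sp} → (∀ a → base ≤ a → a < sp → m′ a ≡ m a) → Stack m st sp → Stack m′ st sp
    stack-resp []             f e = e
    stack-resp ((σ , v) ∷ st) f (sp′ , refl , e , e′ , s) =
      let b≤ = subst (base ≤_) (sym (stack-height st s)) (ℕ.m≤n+m base (2 ℕ.* length st))
      in sp′ , refl , trans (f sp′ b≤ (ℕ.m≤n⇒m≤1+n ℕ.≤-refl)) e ,
         trans (f (suc sp′) (ℕ.m≤n⇒m≤1+n b≤) ℕ.≤-refl) e′ ,
         stack-resp st (λ a b≤a a< → f a b≤a (ℕ.m≤n⇒m≤1+n (ℕ.m≤n⇒m≤1+n a<))) s

    stack-base : ∀ {m} st {sp} → Stack m st sp → base ≤ sp
    stack-base st s = subst (base ≤_) (sym (stack-height st s)) (ℕ.m≤n+m base (2 ℕ.* length st))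

    matrix-address : ∀ {i q} → i < n → q < n → i ℕ.* n ℕ.+ q < n ℕ.* n
    matrix-address {i} {q} i<n q<n = begin-strict
      i ℕ.* n ℕ.+ q <⟨ ℕ.+-monoʳ-< (i ℕ.* n) q<n ⟩
      i ℕ.* n ℕ.+ n ≡⟨ ℕ.+-comm (i ℕ.* n) n ⟩
      suc i ℕ.* n   ≤⟨ ℕ.*-monoˡ-≤ n i<n ⟩
      n ℕ.* n       ∎
      where open ℕ.≤-Reasoning

    matrix<names : ∀ {a} → a < n ℕ.* n → n ℕ.+ a < names
    matrix<names = ℕ.+-monoʳ-< n

    mem-resp : ∀ {j p m m′} → j < n → p ≤ n → (∀ a → a < base → m′ a ≡ m a) → MemoryInv j p m → MemoryInv j p m′
    mem-resp {j} {p} j<n p≤n f inv = record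
      { input   = λ k k<n → trans (f k (ℕ.<-≤-trans k<n (ℕ.≤-trans (ℕ.m≤m+n n _) (ℕ.m≤m+n names n)))) (input k k<n)
      ; guesses = λ a le a< → trans (f _ (below a<)) (guesses a le a<)
      ; rows    = λ i q i<j q<n → trans (f _ (below (matrix-address (ℕ.<-trans i<j j<n) q<n))) (rows i q i<j q<n)
      ; current = λ q q<p → trans (f _ (below (matrix-address j<n (ℕ.<-≤-trans q<p p≤n)))) (current q q<p)
      ; named   = λ q q<p → trans (f _ (ℕ.+-monoʳ-< names (ℕ.<-≤-trans q<p p≤n))) (named q q<p)
      }
      where
      open MemoryInv inv
      below : ∀ {a} → a < n ℕ.* n → n ℕ.+ a < base
      below a< = ℕ.<-≤-trans (matrix<names a<) (ℕ.m≤m+n names n)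

    module _ (j p : ℕ) (j<n : j < n) (p<n : p < n) where

      After : Carrier → Carrier → Config → Store → Set
      After x y a s = InEnv j p x y s × Represents a s

      -- In round i the walking pointer stands at `2 ℕ.* i ℕ.+ base`, so the entry below the top is
      -- met in round `length st`. That round takes place because the height is at most `p`, hence
      -- below `n`.
      pop-correct : ∀ {Q x y m₀ σ v w c} st s → InEnv j p x y s → register s 2 ≡ v → register s 3 ≡ sgn σ →
        register s 4 ≡ w → register s 5 ≡ c → Stack (memory s) st (index s 9) → length st ≤ p →
        (∀ s′ → After x y (pop (conf m₀ σ v w c st)) s′ → Q s′) → wp popCmd Q s
      pop-correct [] s e r₂ r₃ r₄ r₅ stk h k =
        (λ _ → k _ (e , holds r₂ r₃ r₄ r₅ refl stk)) , λ ne → ⊥-elim (ne (trans stk (sym (Env.i₁₃≡ e))))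
      pop-correct {Q} {x} {y} {m₀} {σ} {v} {w} {c} ((σ′ , v′) ∷ st) s e r₂ r₃ r₄ r₅ stk@(sp′ , e₉ , ev , eσ , stk′) h k =
        (λ eq → ⊥-elim (ℕ.m≢1+n+m base {suc (2 ℕ.* length st)} (trans (sym (Env.i₁₃≡ e)) (trans (sym eq) (trans e₉
                  (cong (2 ℕ.+_) (stack-height st stk′))))))) ,
        λ _ → for-rule popLoop Inv (effect (copyIndex 10 13) s) (Env.i₀≡ e)
          (e , r₄ , r₅ , e₉ , ev , eσ , stk′ , Env.i₁₃≡ e , λ ())
          (λ { i s′ i<n _ _ (e , r₄ , r₅ , e₉ , ev , eσ , stk′ , e₁₀ , e₁₂) →
            let i≡ : 2 ℕ.+ index s′ 10 ≡ index s′ 9 → i ≡ length st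
                i≡ eq = ℕ.*-cancelˡ-≡ i (length st) 2 (ℕ.+-cancelʳ-≡ base _ _
                  (trans (sym e₁₀) (trans (ℕ.suc-injective (ℕ.suc-injective (trans eq e₉))) (stack-height st stk′))))
                next : 2 ℕ.+ index s′ 10 ≡ 2 ℕ.* suc i ℕ.+ base
                next = trans (cong (2 ℕ.+_) e₁₀) (let open +-*-Solver in
                  solve 2 (λ l b → con 2 :+ (con 2 :* l :+ b) := con 2 :* (con 1 :+ l) :+ b) refl i base)
            in (λ eq → e , r₄ , r₅ , e₉ , ev , eσ , stk′ , next , λ _ →
                  trans e₁₀ (trans (cong (λ i → 2 ℕ.* i ℕ.+ base) (i≡ eq)) (sym (stack-height st stk′)))) ,
               (λ ne → e , r₄ , r₅ , e₉ , ev , eσ , stk′ , next , λ lt →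
                  e₁₂ (ℕ.≤∧≢⇒< (ℕ.≤-pred lt) λ { refl → ne (trans (cong (2 ℕ.+_) (trans e₁₀ (sym (stack-height st stk′)))) (sym e₉)) })) })
          λ { s′ _ (e , r₄ , r₅ , e₉ , ev , eσ , stk′ , e₁₀ , e₁₂) →
            let e₁₂′ = e₁₂ (ℕ.≤-trans h (ℕ.<⇒≤ p<n)) in
            k _ (e , holds (trans (cong (memory s′) e₁₂′) ev) (trans (cong (memory s′ ∘ suc) e₁₂′) eσ) r₄ r₅ refl
                           (subst (Stack (memory s′) st) (sym e₁₂′) stk′)) }
        where
        Inv : ℕ → Store → Set
        Inv i (store r m ι) = InEnv j p x y (store r m ι) × r 4 ≡ w × r 5 ≡ c × ι 9 ≡ 2 ℕ.+ sp′ ×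
          m sp′ ≡ v′ × m (suc sp′) ≡ sgn σ′ × Stack m st sp′ × ι 10 ≡ 2 ℕ.* i ℕ.+ base × (length st < i → ι 12 ≡ sp′)

      pushed : ∀ {m σ st sp z z′ y} → MemoryInv j p m → Stack m st sp → z ≡ z′ → y ≡ sgn σ →
        MemoryInv j p (m [ sp ≔ z ] [ suc sp ≔ y ]) ×
        Stack (m [ sp ≔ z ] [ suc sp ≔ y ]) ((σ , z′) ∷ st) (2 ℕ.+ sp)
      pushed {m} {σ} {st} {sp} {z} {_} {y} inv stk ez ey =
        mem-resp j<n (ℕ.<⇒≤ p<n) (λ a a<b → unchanged (ℕ.<-≤-trans a<b (stack-base st stk))) inv ,
        sp , refl , trans (update-≢ (m [ sp ≔ z ]) (ℕ.<⇒≢ ℕ.≤-refl)) (trans (update-≡ m {n = sp} refl) ez) ,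
        trans (update-≡ (m [ sp ≔ z ]) {n = suc sp} refl) ey ,
        stack-resp st (λ a _ a<sp → unchanged a<sp) stk
        where
        unchanged : ∀ {a} → a < sp → (m [ sp ≔ z ] [ suc sp ≔ y ]) a ≡ m a
        unchanged a<sp = trans (update-≢ (m [ sp ≔ z ]) (ℕ.<⇒≢ (ℕ.m<n⇒m<1+n a<sp))) (update-≢ m (ℕ.<⇒≢ a<sp))

      bit-case : ∀ {W W′ : Set} b s → register s 6 ≡ bit b → register s 0 ≡ 0# → (if b then W′ else W) →
        (register s 6 ≈ register s 0 → W) × (¬ register s 6 ≈ register s 0 → W′)
      bit-case false s e e₀ w = (λ _ → w) , λ ne → ⊥-elim (ne (K.reflexive (trans e (sym e₀))))
      bit-case true  s e e₀ w =
        (λ eq → ⊥-elim (1≉0 (K.trans (K.reflexive (sym e)) (K.trans eq (K.reflexive e₀))))) , λ _ → w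

      sign-case : ∀ {W W′ : Set} σ s → register s 3 ≡ sgn σ → register s 1 ≡ 1# → (if σ then W else W′) →
        (register s 3 ≈ register s 1 → W) × (¬ register s 3 ≈ register s 1 → W′)
      sign-case true  s e e₁ w = (λ _ → w) , λ ne → ⊥-elim (ne (K.reflexive (trans e (sym e₁))))
      sign-case false s e e₁ w =
        (λ eq → ⊥-elim (-1≉1 (K.trans (K.reflexive (sym e)) (K.trans eq (K.reflexive e₁))))) , λ _ → w

      Continues : (Store → Set) → Carrier → Carrier → Maybe Config → Set
      Continues Q x y nothing  = H false
      Continues Q x y (just a) = ∀ s → After x y a s → Q s

      case : List Step → ℕ → Step
      case []       k       = halt false
      case (c ∷ cs) zero    = c
      case (c ∷ cs) (suc k) = case cs k

      -- Here `k` counts the cases still to be skipped. Skipping changes only index register 6,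
      -- under which `P` has to be stable.
      switch-rule : ∀ {P Q : Store → Set} {k₀} → (∀ s k → P s → P (setIndex 6 k s)) → (∀ s → P s → index s 5 ≡ k₀) →
        ∀ cs k s → k₀ ≡ k ℕ.+ index s 6 → P s → (∀ s → P s → wp (case cs k) Q s) → wp (switch cs) Q s
      switch-rule st i₅ []       k       s e P f = f s P
      switch-rule st i₅ (c ∷ cs) zero    s e P f =
        (λ _ → f s P) , λ ne → ⊥-elim (ne (trans (i₅ s P) e))
      switch-rule st i₅ (c ∷ cs) (suc k) s e P f =
        (λ eq → ⊥-elim (ℕ.m≢1+n+m (index s 6) (trans (sym eq) (trans (i₅ s P) e)))) ,
        λ _ → switch-rule st i₅ cs k (effect (increment 6) s) (trans e (sym (ℕ.+-suc k _))) (st s _ P) f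

      Ready : Bool → Carrier → Config → Store → Set
      Ready b g a (store r m i) = InEnv j p 0# 0# (store r m i) × Represents a (store r m i) ×
        r 6 ≡ bit b × r 7 ≡ g × m (i 7) ≡ g

      private
        fork-correct : ∀ {Q g m₀ σ v w c st} b bit s → Ready bit g (conf m₀ σ v w c st) s →
          Continues Q 0# 0# (just (fork b g (conf m₀ σ v w c st))) → wp (if b then split else dup) Q s
        fork-correct false _ s (e , h , _) k =
          let (mem′ , stk′) = pushed (Env.mem e) (Holds.stk h) (Holds.r₂≡ h) (Holds.r₃≡ h) in
          k _ (record { Env e ; mem = mem′ } ,
               record { Holds h ; i₅≡ = refl ; stk = stk′ })
        fork-correct true _ s (e , h , _ , e₇ , eg) k =
          let (mem′ , stk′) = pushed (Env.mem e) (Holds.stk h) (cong₂ _-_ (Holds.r₂≡ h) e₇) (Holds.r₃≡ h) in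
          k _ (record { Env e ; mem = mem′ } ,
               record { Holds h ; r₂≡ = eg ; i₅≡ = refl
                      ; stk = stk′ })

        pop-ready : ∀ {Q g m₀ σ v w c st} bit s → length st ≤ p → Ready bit g (conf m₀ σ v w c st) s →
          Continues Q 0# 0# (just (pop (conf start σ v w c st))) → wp popCmd Q s
        pop-ready {σ = σ} {st = st} bit s len (e , h , _) k =
          pop-correct {σ = σ} st s e (Holds.r₂≡ h) (Holds.r₃≡ h) (Holds.r₄≡ h) (Holds.r₅≡ h) (Holds.stk h) len k

        zero-correct : ∀ {Q g m₀ σ v w c st} bit s → length st ≤ p → Ready bit g (conf m₀ σ v w c st) s →
          Continues Q 0# 0# (requireZero true (conf start σ v w c st)) → wp popIfZero Q s
        zero-correct {v = v} bit s len r@(e , h , _) k with v ≟ 0#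
        ... | yes v≈0 = (λ _ → pop-ready bit s len r k) ,
                        λ ne → ⊥-elim (ne (K.trans (K.reflexive (Holds.r₂≡ h)) (K.trans v≈0 (K.reflexive (sym (Env.r₀≡ e))))))
        ... | no  v≉0 = (λ eq → ⊥-elim (v≉0 (K.trans (K.reflexive (sym (Holds.r₂≡ h))) (K.trans eq (K.reflexive (Env.r₀≡ e)))))) ,
                        λ _ → k

      case-correct : ∀ {Q} b g a s → length (stack a) ≤ p → Ready b g a s →
        Continues Q (outValue b a) (outName b a) (δ b g a) → wp (case cases (modeIndex (mode a))) Q s
      case-correct false g (conf start σ v w c st) s len (e , h , e₆ , _) k =
        bit-case false s e₆ (Env.r₀≡ e) (k _ (e , record { Holds h ; i₅≡ = refl }))
      case-correct true g (conf start σ v w c st) s len (e , h , e₆ , _) k =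
        bit-case true s e₆ (Env.r₀≡ e) (k _ (e , record { Holds h ; i₅≡ = refl }))
      case-correct false g (conf m0 σ v w c st) s len (e , h , e₆ , _) k =
        bit-case false s e₆ (Env.r₀≡ e) (k _ (e , record { Holds h ; r₄≡ = refl ; r₅≡ = refl ; i₅≡ = refl }))
      case-correct true g (conf m0 true v w c st) s len (e , h , e₆ , _) k =
        bit-case true s e₆ (Env.r₀≡ e) (sign-case true s (Holds.r₃≡ h) (Env.r₁≡ e)
          (k _ (e , record { Holds h ; r₃≡ = refl ; i₅≡ = refl })))
      case-correct true g (conf m0 false v w c st) s len (e , h , e₆ , _) k =
        bit-case true s e₆ (Env.r₀≡ e) (sign-case false s (Holds.r₃≡ h) (Env.r₁≡ e)
          (k _ (e , record { Holds h ; r₃≡ = refl ; i₅≡ = refl })))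
      case-correct false g (conf m1 true v w c st) s len r@(e , h , e₆ , _) k =
        bit-case false s e₆ (Env.r₀≡ e) (sign-case true s (Holds.r₃≡ h) (Env.r₁≡ e) (fork-correct false false s r k))
      case-correct false g (conf m1 false v w c st) s len r@(e , h , e₆ , _) k =
        bit-case false s e₆ (Env.r₀≡ e) (sign-case false s (Holds.r₃≡ h) (Env.r₁≡ e) (fork-correct true false s r k))
      case-correct true g (conf m1 σ v w c st) s len (e , h , e₆ , _) k =
        bit-case true s e₆ (Env.r₀≡ e) (k _ (e , record { Holds h ; i₅≡ = refl }))
      case-correct false g (conf m11 true v w c st) s len r@(e , h , e₆ , _) k =
        bit-case false s e₆ (Env.r₀≡ e) (sign-case true s (Holds.r₃≡ h) (Env.r₁≡ e) (fork-correct true false s r k))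
      case-correct false g (conf m11 false v w c st) s len r@(e , h , e₆ , _) k =
        bit-case false s e₆ (Env.r₀≡ e) (sign-case false s (Holds.r₃≡ h) (Env.r₁≡ e) (fork-correct false false s r k))
      case-correct true g (conf m11 σ v w c st) s len (e , h , e₆ , _) k =
        bit-case true s e₆ (Env.r₀≡ e) (k _ (e , record { Holds h ; i₅≡ = refl }))
      case-correct false g (conf m111 true v w c st) s len r@(e , h , e₆ , _) k =
        bit-case false s e₆ (Env.r₀≡ e) (sign-case true s (Holds.r₃≡ h) (Env.r₁≡ e) (zero-correct false s len r k))
      case-correct false g (conf m111 false v w c st) s len r@(e , h , e₆ , _) k =
        bit-case false s e₆ (Env.r₀≡ e) (sign-case false s (Holds.r₃≡ h) (Env.r₁≡ e) (pop-ready false s len r k))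
      case-correct true g (conf m111 true v w c st) s len r@(e , h , e₆ , _) k =
        bit-case true s e₆ (Env.r₀≡ e) (sign-case true s (Holds.r₃≡ h) (Env.r₁≡ e) (pop-ready true s len r k))
      case-correct true g (conf m111 false v w c st) s len r@(e , h , e₆ , _) k =
        bit-case true s e₆ (Env.r₀≡ e) (sign-case false s (Holds.r₃≡ h) (Env.r₁≡ e) (zero-correct true s len r k))
      case-correct false g (conf flag σ v w c st) s len (e , h , e₆ , _) k =
        bit-case false s e₆ (Env.r₀≡ e) (pop-correct {m₀ = start} {σ} st (effect (multiply 9 3 5) (effect (add 8 2 0) s))
          (record { Env e ; r₈≡ = cong₂ _+_ (Holds.r₂≡ h) (Env.r₀≡ e) ; r₉≡ = cong₂ _*_ (Holds.r₃≡ h) (Holds.r₅≡ h) })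
          (Holds.r₂≡ h) (Holds.r₃≡ h) (Holds.r₄≡ h) (Holds.r₅≡ h) (Holds.stk h) len k)
      case-correct true g (conf flag σ v w c st) s len (e , h , e₆ , _) k =
        bit-case true s e₆ (Env.r₀≡ e) (k _ (e , record { Holds h ; i₅≡ = refl }))
      case-correct false g (conf digit σ v w c st) s len (e , h , e₆ , _) k =
        bit-case false s e₆ (Env.r₀≡ e) (k _ (e , record
          { Holds h ; r₄≡ = cong₂ _+_ r₄≡ r₄≡ ; r₅≡ = cong₂ _+_ (cong₂ _+_ r₅≡ r₄≡) r₄≡ ; i₅≡ = refl }))
        where open Holds h using (r₄≡; r₅≡)
      case-correct true g (conf digit σ v w c st) s len (e , h , e₆ , _) k =
        bit-case true s e₆ (Env.r₀≡ e) (k _ (e , record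
          { Holds h ; r₄≡ = cong₂ _+_ r₄≡ r₄≡ ; r₅≡ = cong₂ _+_ r₅≡ r₄≡ ; i₅≡ = refl }))
        where open Holds h using (r₄≡; r₅≡)
      case-correct false g (conf done σ v w c st) s len r k = k
      case-correct true  g (conf done σ v w c st) s len r k = k

      written : ∀ {m x y a₇ a₈} → a₇ ≡ n ℕ.+ (j ℕ.* n ℕ.+ p) → a₈ ≡ names ℕ.+ p → MemoryInv j p m →
        x ≡ Row.valueAt j p → y ≡ Row.nameAt j p → MemoryInv j (suc p) (m [ a₇ ≔ x ] [ a₈ ≔ y ])
      written {m} {x} {y} refl refl inv ex ey = record
        { input   = λ k k<n → trans (low (ℕ.<⇒≢ (ℕ.<-≤-trans k<n (ℕ.m≤m+n n _))) (ℕ.<-≤-trans k<n (ℕ.m≤m+n n _))) (input k k<n)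
        ; guesses = λ a le a< → trans
            (low (ℕ.>⇒≢ (ℕ.+-monoʳ-< n (subst (ℕ._≤ a) (ℕ.+-suc (j ℕ.* n) p) le))) (matrix<names a<))
            (guesses a (ℕ.≤-trans (ℕ.+-monoʳ-≤ (j ℕ.* n) (ℕ.n≤1+n p)) le) a<)
        ; rows    = λ i q i<j q<n → trans
            (low (ℕ.<⇒≢ (ℕ.+-monoʳ-< n (earlier-row i<j q<n))) (matrix<names (matrix-address (ℕ.<-trans i<j j<n) q<n)))
            (rows i q i<j q<n)
        ; current = λ q q<1+p → case-≤ q (ℕ.m≤n⇒m<n∨m≡n (ℕ.≤-pred q<1+p))
        ; named   = λ q q<1+p → case-≤′ q (ℕ.m≤n⇒m<n∨m≡n (ℕ.≤-pred q<1+p))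
        }
        where
        open MemoryInv inv
        a₇ = n ℕ.+ (j ℕ.* n ℕ.+ p)
        a₈ = names ℕ.+ p
        m₇ = m [ a₇ ≔ x ]
        low : ∀ {a} → a ≢ a₇ → a < names → (m₇ [ a₈ ≔ y ]) a ≡ m a
        low a≢ a< = trans (update-≢ m₇ (ℕ.<⇒≢ (ℕ.<-≤-trans a< (ℕ.m≤m+n names p)))) (update-≢ m a≢)
        earlier-row : ∀ {i q} → i < j → q < n → i ℕ.* n ℕ.+ q < j ℕ.* n ℕ.+ p
        earlier-row {i} {q} i<j q<n = begin-strict
          i ℕ.* n ℕ.+ q <⟨ ℕ.+-monoʳ-< (i ℕ.* n) q<n ⟩
          i ℕ.* n ℕ.+ n ≡⟨ ℕ.+-comm (i ℕ.* n) n ⟩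
          suc i ℕ.* n   ≤⟨ ℕ.*-monoˡ-≤ n i<j ⟩
          j ℕ.* n       ≤⟨ ℕ.m≤m+n (j ℕ.* n) p ⟩
          j ℕ.* n ℕ.+ p ∎
          where open ℕ.≤-Reasoning
        case-≤ : ∀ q → q < p ⊎ q ≡ p → (m₇ [ a₈ ≔ y ]) (n ℕ.+ (j ℕ.* n ℕ.+ q)) ≡ Row.valueAt j q
        case-≤ q (inj₁ q<p) = trans
          (low (ℕ.<⇒≢ (ℕ.+-monoʳ-< n (ℕ.+-monoʳ-< (j ℕ.* n) q<p))) (matrix<names (matrix-address j<n (ℕ.<-trans q<p p<n))))
          (current q q<p)
        case-≤ q (inj₂ refl) = trans
          (update-≢ m₇ (ℕ.<⇒≢ (ℕ.<-≤-trans (matrix<names (matrix-address j<n p<n)) (ℕ.m≤m+n names p))))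
          (trans (update-≡ m {n = a₇} refl) ex)
        case-≤′ : ∀ q → q < p ⊎ q ≡ p → (m₇ [ a₈ ≔ y ]) (names ℕ.+ q) ≡ Row.nameAt j q
        case-≤′ q (inj₁ q<p) = trans (update-≢ m₇ (ℕ.<⇒≢ (ℕ.+-monoʳ-< names q<p)))
          (trans (update-≢ m (ℕ.>⇒≢ (ℕ.<-≤-trans (matrix<names (matrix-address j<n p<n)) (ℕ.m≤m+n names q)))) (named q q<p))
        case-≤′ q (inj₂ refl) = trans (update-≡ m₇ {n = a₈} refl) ey

      written-stack : ∀ {m x y a₇ a₈ sp} st → a₇ ≡ n ℕ.+ (j ℕ.* n ℕ.+ p) → a₈ ≡ names ℕ.+ p → Stack m st sp →
        Stack (m [ a₇ ≔ x ] [ a₈ ≔ y ]) st sp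
      written-stack {m} {x} st refl refl = stack-resp st λ a b≤a _ → trans
        (update-≢ (m [ _ ≔ x ]) (ℕ.>⇒≢ (ℕ.<-≤-trans (ℕ.+-monoʳ-< names p<n) b≤a)))
        (update-≢ m (ℕ.>⇒≢ (ℕ.<-≤-trans (ℕ.<-≤-trans (matrix<names (matrix-address j<n p<n)) (ℕ.m≤m+n names n)) b≤a)))

    InPass : ℕ → ℕ → Store → Set
    InPass j p s = ∃ λ x → ∃ λ y → ∃ λ a → Row.trace j p ≡ just a × InEnv j p x y s × Represents a s

    -- Every rejection has to be accounted for by a failing condition of the certificate. The
    -- hypothesis converts this failure into `H false`; `reject₂` and `reject₃` do so for the
    -- remaining conditions.
    module _ (reject₁ : ∀ j → j < n → ¬ Row.Done j n → H false) where

      bitStep-correct : ∀ j p s → j < n → p < n → index s 2 ≡ p → InPass j p s →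
        wp bitStep (λ s′ → InPass j (suc p) (effect (increment 2) s′)) s
      bitStep-correct j p s@(store r m ι) j<n p<n e₂ (_ , _ , a , ea , e , h) =
        switch-rule j p j<n p<n {P = Ready j p j<n p<n b g a} {k₀ = modeIndex (mode a)} (λ _ _ P → P)
          (λ _ P → Holds.i₅≡ (proj₁ (proj₂ P))) cases _ s₁ (sym (ℕ.+-identityʳ _)) ready
          (λ s P → case-correct j p j<n p<n b g a s (Row.height j p ea) P (continue (δ b g a) refl))
        where
        b = word p
        g = row j p
        s₁ = effect (reset 6) (effect (constant 9 0#) (effect (constant 8 0#) (effect (load 7 7) (effect (load 6 2) s))))
        open MemoryInv (Env.mem e)
        g≡ : m (ι 7) ≡ g
        g≡ = trans (cong m (Env.i₇≡ e)) (guesses _ ℕ.≤-refl (matrix-address j<n p<n))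
        ready : Ready j p j<n p<n b g a s₁
        ready = record { Env e ; r₈≡ = refl ; r₉≡ = refl } , h , trans (cong m e₂) (input p p<n) , g≡ , g≡
        Q : Store → Set
        Q s = InPass j (suc p) (effect (increment 2) (effect (increment 8) (effect (increment 7)
                (effect (store 9 8) (effect (store 8 7) s)))))
        dead : ∀ k → Row.trace j (suc p) ≡ nothing → Row.trace j (k ℕ.+ suc p) ≡ nothing
        dead zero    e = e
        dead (suc k) e rewrite dead k e = refl
        continue : ∀ x → δ b g a ≡ x → Continues j p j<n p<n Q (outValue b a) (outName b a) x
        -- A dead trace stays dead up to position `n`, which contradicts `Done`.
        continue nothing  eq = reject₁ j j<n λ (_ , e , _) →
          absurd (trans (sym e) (trans (cong (Row.trace j) (sym (ℕ.m∸n+n≡m p<n))) (dead (n ℕ.∸ suc p) (trans (Row.trace-step j {p} ea) eq))))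
          where
          absurd : ∀ {a : Config} → just a ≡ nothing → ⊥
          absurd ()
        continue (just a′) eq s′ (e′ , h′) = _ , _ , a′ , trans (Row.trace-step j {p} ea) eq ,
          record { Env e′
                 ; i₇≡ = trans (cong suc (Env.i₇≡ e′)) (trans (sym (ℕ.+-suc n _)) (cong (n ℕ.+_) (sym (ℕ.+-suc (j ℕ.* n) p))))
                 ; i₈≡ = trans (cong suc (Env.i₈≡ e′)) (sym (ℕ.+-suc names p))
                 ; mem = written j p j<n p<n (Env.i₇≡ e′) (Env.i₈≡ e′) (Env.mem e′)
                           (trans (Env.r₈≡ e′) (sym (Row.valueAt-≡ j {p} ea))) (trans (Env.r₉≡ e′) (sym (Row.nameAt-≡ j {p} ea))) } ,
          record { Holds h′ ; stk = written-stack j p j<n p<n (stack a′) (Env.i₇≡ e′) (Env.i₈≡ e′) (Holds.stk h′) }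

      record Between (j : ℕ) (r₀ r₁ r₁₀ : Carrier) (i₀ i₇ i₁₃ i₁₄ : ℕ) (m : ℕ → Carrier) : Set where
        field
          r₀≡  : r₀ ≡ 0#
          r₁≡  : r₁ ≡ 1#
          r₁₀≡ : r₁₀ ≡ squares j
          i₀≡  : i₀ ≡ n
          i₇≡  : i₇ ≡ n ℕ.+ j ℕ.* n
          i₁₃≡ : i₁₃ ≡ base
          i₁₄≡ : i₁₄ ≡ names
          input   : ∀ k → k < n → m k ≡ bit (word k)
          guesses : ∀ a → j ℕ.* n ≤ a → a < n ℕ.* n → m (n ℕ.+ a) ≡ G a
          rows    : ∀ i q → i < j → q < n → m (n ℕ.+ (i ℕ.* n ℕ.+ q)) ≡ Row.valueAt i q
          named   : ∀ q → 0 < j → q < n → m (names ℕ.+ q) ≡ Row.nameAt (ℕ.pred j) q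
          finish  : ∀ i → i < j → Row.Done i n

      BetweenPasses : ℕ → Store → Set
      BetweenPasses j (store r m i) = Between j (r 0) (r 1) (r 10) (i 0) (i 7) (i 13) (i 14) m

      pass-correct : ∀ j s → j < n → BetweenPasses j s → wp pass (λ s′ → BetweenPasses (suc j) (effect (increment 1) s′)) s
      pass-correct j s@(store r m ι) j<n B =
        for-rule bitStep (λ p s → p ≤ n × InPass j p s) s₁ (Between.i₀≡ B) (z≤n , begun)
          (λ { p s p<n e₂ _ (_ , inp) → wp-mono bitStep {Q = λ s → InPass j (suc p) (effect (increment 2) s)}
                 {Q′ = λ s → suc p ≤ n × InPass j (suc p) (effect (increment 2) s)} (λ _ inp′ → p<n , inp′) s (bitStep-correct j p s j<n p<n e₂ inp) })
          (λ { s _ (_ , _ , _ , a , ea , e , h) →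
               (λ e₅ → record
                  { r₀≡ = Env.r₀≡ e ; r₁≡ = Env.r₁≡ e ; r₁₀≡ = Env.r₁₀≡ e ; i₀≡ = Env.i₀≡ e
                  ; i₇≡ = trans (Env.i₇≡ e) (cong (n ℕ.+_) (ℕ.+-comm (j ℕ.* n) n))
                  ; i₁₃≡ = Env.i₁₃≡ e ; i₁₄≡ = Env.i₁₄≡ e
                  ; input = MemoryInv.input (Env.mem e)
                  ; guesses = λ a le → MemoryInv.guesses (Env.mem e) a (subst (ℕ._≤ a) (ℕ.+-comm n (j ℕ.* n)) le)
                  ; rows = λ i q i≤j q<n → last-row (Env.mem e) i q (ℕ.m≤n⇒m<n∨m≡n (ℕ.≤-pred i≤j)) q<n
                  ; named = λ q _ q<n → MemoryInv.named (Env.mem e) q q<n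
                  ; finish = λ i i≤j → finished i (ℕ.m≤n⇒m<n∨m≡n (ℕ.≤-pred i≤j)) (a , ea , mode-done (mode a) (trans (sym (Holds.i₅≡ h)) e₅)) }) ,
               λ e₅ → reject₁ j j<n λ (a′ , ea′ , d) → e₅ (trans (Holds.i₅≡ h)
                 (cong modeIndex (trans (cong mode (same (trans (sym ea) ea′))) d))) })
        where
        s₁ = effect (reset 5) (effect (constant 5 1#) (effect (constant 4 1#) (effect (constant 3 1#)
               (effect (add 10 10 11) (effect (multiply 11 2 2) (effect (load 2 7)
                 (effect (copyIndex 9 13) (effect (copyIndex 8 14) s))))))))
        same : ∀ {a a′ : Config} → just a ≡ just a′ → a ≡ a′
        same refl = refl
        mode-done : ∀ m → modeIndex m ≡ 7 → m ≡ done
        mode-done done refl = refl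
        finished : ∀ i → i < j ⊎ i ≡ j → Row.Done j n → Row.Done i n
        finished i (inj₁ i<j)  _ = Between.finish B i i<j
        finished i (inj₂ refl) d = d
        last-row : ∀ {m} → MemoryInv j n m → ∀ i q → i < j ⊎ i ≡ j → q < n → m (n ℕ.+ (i ℕ.* n ℕ.+ q)) ≡ Row.valueAt i q
        last-row inv i q (inj₁ i<j)  q<n = MemoryInv.rows inv i q i<j q<n
        last-row inv i q (inj₂ refl) q<n = MemoryInv.current inv q q<n
        v≡ : m (ι 7) ≡ row j 0
        v≡ = trans (cong m (trans (Between.i₇≡ B) (cong (n ℕ.+_) (sym (ℕ.+-identityʳ _)))))
          (Between.guesses B _ (ℕ.m≤m+n (j ℕ.* n) 0) (matrix-address j<n (ℕ.≤-<-trans z≤n j<n)))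
        begun : InPass j 0 s₁
        begun = _ , _ , _ , refl ,
          record { r₀≡ = Between.r₀≡ B ; r₁≡ = Between.r₁≡ B ; r₈≡ = refl ; r₉≡ = refl
                 ; r₁₀≡ = cong₂ _+_ (Between.r₁₀≡ B) (cong₂ _*_ v≡ v≡) ; i₀≡ = Between.i₀≡ B
                 ; i₇≡ = trans (Between.i₇≡ B) (cong (n ℕ.+_) (sym (ℕ.+-identityʳ _)))
                 ; i₈≡ = trans (Between.i₁₄≡ B) (sym (ℕ.+-identityʳ names)) ; i₁₃≡ = Between.i₁₃≡ B ; i₁₄≡ = Between.i₁₄≡ B
                 ; mem = record { input = Between.input B
                                ; guesses = λ a le → Between.guesses B a (ℕ.≤-trans (ℕ.m≤m+n (j ℕ.* n) 0) le)
                                ; rows = Between.rows B ; current = λ q () ; named = λ q () } } ,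
          holds v≡ refl refl refl refl (Between.i₁₃≡ B)

      product : ℕ → ℕ → ℕ → Carrier
      product p q j = Row.valueAt j p * Row.valueAt j q

      AllDone : Set
      AllDone = ∀ j → j < n → Row.Done j n

      -- All passes write their names to the same cells, so those of the last pass, `ℕ.pred n`, are
      -- what the final comparison finds.
      Opposite : ℕ → ℕ → Set
      Opposite p q = Row.nameAt (ℕ.pred n) p + Row.nameAt (ℕ.pred n) q ≈ 0#

      Orthogonal : ℕ → ℕ → Set
      Orthogonal p q = Opposite p q → sumTo n (product p q) ≈ 0#

      module _ (reject₂ : AllDone → squares n ≈ 0# → H false)
               (reject₃ : AllDone → ∀ p q → p < n → q < n → ¬ Orthogonal p q → H false)
               (accept  : AllDone → squares n ≉ 0# → (∀ p q → p < n → q < n → Orthogonal p q) → H true) where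

        record Final (r₀ : Carrier) (i₀ i₁₄ : ℕ) (m : ℕ → Carrier) : Set where
          field
            r₀≡  : r₀ ≡ 0#
            i₀≡  : i₀ ≡ n
            i₁₄≡ : i₁₄ ≡ names
            rows    : ∀ i q → i < n → q < n → m (n ℕ.+ (i ℕ.* n ℕ.+ q)) ≡ Row.valueAt i q
            named   : ∀ q → q < n → m (names ℕ.+ q) ≡ Row.nameAt (ℕ.pred n) q
            finish  : AllDone

        InFinal : Store → Set
        InFinal (store r m i) = Final (r 0) (i 0) (i 14) m

        InRow : ℕ → Store → Set
        InRow p (store r m i) = InFinal (store r m i) × i 15 ≡ n ℕ.+ p × i 16 ≡ names ℕ.+ p ×
          (∀ p′ q → p′ < p → q < n → Orthogonal p′ q)

        InPair : ℕ → ℕ → Store → Set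
        InPair p q (store r m i) = InRow p (store r m i) × i 17 ≡ n ℕ.+ q × i 18 ≡ names ℕ.+ q ×
          (∀ q′ → q′ < q → Orthogonal p q′)

        InSum : ℕ → ℕ → ℕ → ℕ → Store → Set
        InSum p q j k (store r m i) = InPair p q (store r m i) × i 19 ≡ n ℕ.+ (j ℕ.* n ℕ.+ p) ℕ.+ k ×
          i 20 ≡ n ℕ.+ (j ℕ.* n ℕ.+ q) ℕ.+ k

        private
          next-row : ∀ {a} j p → a ≡ n ℕ.+ (j ℕ.* n ℕ.+ p) ℕ.+ n → a ≡ n ℕ.+ (suc j ℕ.* n ℕ.+ p) ℕ.+ 0
          next-row j p e = trans e (solve 3 (λ n m p → n :+ (m :+ p) :+ n := n :+ ((n :+ m) :+ p) :+ con 0) refl n (j ℕ.* n) p)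
            where open +-*-Solver

        checkPair-correct : ∀ p q s → p < n → q < n → InPair p q s →
          wp checkPair (λ s′ → InPair p (suc q) (effect (increment 4) s′)) s
        checkPair-correct p q s p<n q<n inp@((f , e₁₅ , _) , e₁₇ , _) =
          for-rule _ (λ j s → InSum p q j 0 s × register s 12 ≡ sumTo j (product p q))
            (effect (constant 12 0#) (effect (copyIndex 20 17) (effect (copyIndex 19 15) s))) (Final.i₀≡ f)
            ((inp , trans e₁₅ (sym (ℕ.+-identityʳ _)) , trans e₁₇ (sym (ℕ.+-identityʳ _))) , refl)
            (λ { j s@(store r m ι) j<n _ _ (ins@(inp@((f , _) , _) , e₁₉ , e₂₀) , e₁₂) →
              for-rule _ (λ k s → InSum p q j k s × register s 12 ≡ sumTo (suc j) (product p q))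
                (effect (add 12 12 13) (effect (multiply 13 13 14) (effect (load 14 20) (effect (load 13 19) s)))) (Final.i₀≡ f)
                (ins , cong₂ _+_ e₁₂ (cong₂ _*_
                  (trans (cong m (trans e₁₉ (ℕ.+-identityʳ _))) (Final.rows f j p j<n p<n))
                  (trans (cong m (trans e₂₀ (ℕ.+-identityʳ _))) (Final.rows f j q j<n q<n))))
                (λ { k s _ _ _ ((inp , e₁₉ , e₂₀) , e₁₂) →
                  (inp , trans (cong suc e₁₉) (sym (ℕ.+-suc _ k)) , trans (cong suc e₂₀) (sym (ℕ.+-suc _ k))) , e₁₂ })
                λ { s _ ((inp , e₁₉ , e₂₀) , e₁₂) → (inp , next-row j p e₁₉ , next-row j q e₂₀) , e₁₂ } })
            λ { s@(store r m ι) _ ((((f , e₁₅ , e₁₆ , ort) , e₁₇ , e₁₈ , ort′) , _) , e₁₂) →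
              let np = trans (cong m e₁₆) (Final.named f p p<n)
                  nq = trans (cong m e₁₈) (Final.named f q q<n)
                  finish : Orthogonal p q → InPair p (suc q) (effect (increment 4) (effect (increment 18) (effect (increment 17)
                    (effect (add 13 13 14) (effect (load 14 18) (effect (load 13 16) s))))))
                  finish o = (f , e₁₅ , e₁₆ , ort) , trans (cong suc e₁₇) (sym (ℕ.+-suc n q)) ,
                    trans (cong suc e₁₈) (sym (ℕ.+-suc names q)) ,
                    λ q′ q′≤q → extend o ort′ q′ (ℕ.m≤n⇒m<n∨m≡n (ℕ.≤-pred q′≤q))
              in (λ opp →
                    (λ e → finish λ _ → K.trans (K.reflexive (sym e₁₂)) (K.trans e (K.reflexive (Final.r₀≡ f)))) ,
                    λ ne → reject₃ (Final.finish f) p q p<n q<n λ o →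
                      ne (K.trans (K.reflexive e₁₂) (K.trans
                        (o (K.trans (K.reflexive (sym (cong₂ _+_ np nq))) (K.trans opp (K.reflexive (Final.r₀≡ f)))))
                        (K.reflexive (sym (Final.r₀≡ f)))))) ,
                 λ ne → finish λ opp → ⊥-elim (ne (K.trans (K.reflexive (cong₂ _+_ np nq)) (K.trans opp (K.reflexive (sym (Final.r₀≡ f)))))) }
          where
          extend : Orthogonal p q → (∀ q′ → q′ < q → Orthogonal p q′) → ∀ q′ → q′ < q ⊎ q′ ≡ q → Orthogonal p q′
          extend o f q′ (inj₁ lt)   = f q′ lt
          extend o f q′ (inj₂ refl) = o

        checkPairs-correct : ∀ s → InFinal s → register s 10 ≡ squares n → squares n ≉ 0# → wp checkPairs (λ _ → H true) s
        checkPairs-correct s f e₁₀ sq≉0 =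
          for-rule _ InRow (effect (copyIndex 16 14) (effect (copyIndex 15 0) s)) (Final.i₀≡ f)
            (f , trans (Final.i₀≡ f) (sym (ℕ.+-identityʳ n)) , trans (Final.i₁₄≡ f) (sym (ℕ.+-identityʳ names)) , λ _ _ ())
            (λ { p s p<n _ _ inr@(f , _) →
              for-rule checkPair (InPair p) (effect (copyIndex 18 14) (effect (copyIndex 17 0) s)) (Final.i₀≡ f)
                (inr , trans (Final.i₀≡ f) (sym (ℕ.+-identityʳ n)) , trans (Final.i₁₄≡ f) (sym (ℕ.+-identityʳ names)) , λ _ ())
                (λ q s q<n _ _ inp → checkPair-correct p q s p<n q<n inp)
                λ { s _ ((f , e₁₅ , e₁₆ , ort) , _ , _ , ort′) →
                  f , trans (cong suc e₁₅) (sym (ℕ.+-suc n p)) , trans (cong suc e₁₆) (sym (ℕ.+-suc names p)) ,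
                  λ p′ q p′≤p → extend p ort ort′ p′ q (ℕ.m≤n⇒m<n∨m≡n (ℕ.≤-pred p′≤p)) } })
            λ { s _ (f , _ , _ , ort) → accept (Final.finish f) sq≉0 ort }
          where
          extend : ∀ p → (∀ p′ q → p′ < p → q < n → Orthogonal p′ q) → (∀ q → q < n → Orthogonal p q) →
            ∀ p′ q → p′ < p ⊎ p′ ≡ p → q < n → Orthogonal p′ q
          extend p f g p′ q (inj₁ lt)   = f p′ q lt
          extend p f g p′ q (inj₂ refl) = g q

        passes-correct : ∀ s → register s 0 ≡ 0# → register s 10 ≡ 0# → index s 0 ≡ n → index s 7 ≡ names →
          (∀ k → k < n → memory s k ≡ bit (word k)) → (∀ a → a < n ℕ.* n → memory s (n ℕ.+ a) ≡ G a) →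
          wp (setup ⨾ for 1 pass ⨾ if≈ 10 0 (halt false) skip ⨾ checkPairs) (λ _ → H true) s
        passes-correct s e₀ e₁₀ i₀ i₇ inp gs =
          for-rule _ Inv (effect (copyIndex 13 7) (effect (copyIndex 14 7) s)) i₀
            (e₀ , e₁₀ , i₀ , i₇ , trans i₇ (sym (ℕ.+-identityʳ names)) , inp , gs)
            (λ { k s _ _ _ (e₀ , e₁₀ , i₀ , i₁₄ , i₁₃ , inp , gs) →
              e₀ , e₁₀ , i₀ , i₁₄ , trans (cong suc i₁₃) (sym (ℕ.+-suc names k)) , inp , gs })
            λ { s _ (e₀ , e₁₀ , i₀ , i₁₄ , i₁₃ , inp , gs) →
              for-rule pass BetweenPasses (effect (copyIndex 7 0) (effect (constant 1 1#) s)) i₀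
                (record { r₀≡ = e₀ ; r₁≡ = refl ; r₁₀≡ = e₁₀ ; i₀≡ = i₀ ; i₇≡ = trans i₀ (sym (ℕ.+-identityʳ n))
                        ; i₁₃≡ = i₁₃ ; i₁₄≡ = i₁₄ ; input = inp ; guesses = λ a _ → gs a
                        ; rows = λ _ _ () ; named = λ _ () ; finish = λ _ () })
                (λ j s j<n _ _ B → pass-correct j s j<n B)
                λ { s _ B →
                  (λ e → reject₂ (Between.finish B) (K.trans (K.reflexive (sym (Between.r₁₀≡ B))) (K.trans e (K.reflexive (Between.r₀≡ B))))) ,
                  λ ne → checkPairs-correct s
                    (record { r₀≡ = Between.r₀≡ B ; i₀≡ = Between.i₀≡ B ; i₁₄≡ = Between.i₁₄≡ B ; rows = Between.rows B
                            ; named = λ q q<n → Between.named B q (ℕ.≤-<-trans z≤n q<n) q<n ; finish = Between.finish B })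
                    (Between.r₁₀≡ B)
                    λ e → ne (K.trans (K.reflexive (Between.r₁₀≡ B)) (K.trans e (K.reflexive (sym (Between.r₀≡ B))))) } }
          where
          Inv : ℕ → Store → Set
          Inv k (store r m i) = r 0 ≡ 0# × r 10 ≡ 0# × i 0 ≡ n × i 14 ≡ names × i 13 ≡ names ℕ.+ k ×
            (∀ k → k < n → m k ≡ bit (word k)) × (∀ a → a < n ℕ.* n → m (n ℕ.+ a) ≡ G a)

  wordOf : List Bool → ℕ → Bool
  wordOf w k = fromMaybe false (nth w k)

  -- Row j of the matrix G holds the guesses for coordinate j, one for each position in w.
  Certificate : List Bool → (ℕ → Carrier) → Set
  Certificate w G = AllDone × sumTo n (λ j → root j * root j) ≉ 0# ×
                    (∀ p q → p < n → q < n → Orthogonal p q)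
    where
    n = length w
    module Row j = Trace (wordOf w) (λ q → G (j ℕ.* n ℕ.+ q))
    AllDone : Set
    AllDone = ∀ j → j < n → Row.Done j n
    root : ℕ → Carrier
    root j = G (j ℕ.* n ℕ.+ 0)
    Orthogonal : ℕ → ℕ → Set
    Orthogonal p q = Row.nameAt (ℕ.pred n) p + Row.nameAt (ℕ.pred n) q ≈ 0# →
                     sumTo n (λ j → Row.valueAt j p * Row.valueAt j q) ≈ 0#

  private
    bits-memory : ∀ w k → k < length w → fromMaybe 0# (nth (map bit w) k) ≡ bit (wordOf w k)
    bits-memory (b ∷ w) zero    _       = refl
    bits-memory (b ∷ w) (suc k) (s≤s l) = bits-memory w k l

    -- Admissible guesses are described by the address in index register 7 at which they are about
    -- to be stored. A prescribed matrix thereby becomes a restriction on guesses.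
    module Guessing (Φ : ℕ → Carrier → Set) (H : Bool → Set) (w : List Bool) where

      n = length w
      open WP (λ s → Φ (index s 7)) H

      Guessed : ℕ → Store → Set
      Guessed c (store r m i) = r 0 ≡ 0# × r 10 ≡ 0# × i 0 ≡ n × i 7 ≡ n ℕ.+ c ×
        (∀ k → k < n → m k ≡ bit (wordOf w k)) × (∀ a → a < c → Φ (n ℕ.+ a) (m (n ℕ.+ a)))

      guess-correct : ∀ {Q : Store → Set} s → Guessed 0 (effect (copyIndex 7 0) s) →
        (∀ s → Guessed (n ℕ.* n) s → Q s) → wp guessMatrix Q s
      guess-correct s e k = for-rule _ (λ j → Guessed (j ℕ.* n)) (effect (copyIndex 7 0) s) (proj₁ (proj₂ (proj₂ e))) e
        (λ { j s _ _ _ e → for-rule _ (λ p → Guessed (j ℕ.* n ℕ.+ p)) s (proj₁ (proj₂ (proj₂ e)))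
          (subst (λ c → Guessed c s) (sym (ℕ.+-identityʳ _)) e)
          (λ { p s@(store r m i) p<n _ _ (e₀ , e₁₀ , i₀ , i₇ , inp , φ) g ok →
            e₀ , e₁₀ , i₀ , trans (cong suc i₇) (trans (sym (ℕ.+-suc n _)) (cong (n ℕ.+_) (sym (ℕ.+-suc (j ℕ.* n) p)))) ,
            (λ k k<n → trans (update-≢ m (ℕ.<⇒≢ (ℕ.<-≤-trans k<n (subst (n ≤_) (sym i₇) (ℕ.m≤m+n n _))))) (inp k k<n)) ,
            λ a a≤ → extend {m} i₇ φ ok a (ℕ.m≤n⇒m<n∨m≡n (ℕ.≤-pred (subst (a <_) (ℕ.+-suc (j ℕ.* n) p) a≤))) })
          λ s _ → subst (λ c → Guessed c s) (ℕ.+-comm (j ℕ.* n) n) })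
        λ s _ → k s
        where
        extend : ∀ {m c a₇ g} → a₇ ≡ n ℕ.+ c → (∀ a → a < c → Φ (n ℕ.+ a) (m (n ℕ.+ a))) → Φ a₇ g →
          ∀ a → a < c ⊎ a ≡ c → Φ (n ℕ.+ a) ((m [ a₇ ≔ g ]) (n ℕ.+ a))
        extend {m} {c} {g = g} refl φ ok a (inj₁ a<c) =
          subst (Φ _) (sym (update-≢ m (ℕ.<⇒≢ (ℕ.+-monoʳ-< n a<c)))) (φ a a<c)
        extend {m} {c} {g = g} refl φ ok a (inj₂ refl) = subst (Φ _) (sym (update-≡ m {n = n ℕ.+ a} refl)) ok

      verifier-correct :
        (∀ m → (∀ a → a < n ℕ.* n → Φ (n ℕ.+ a) (m (n ℕ.+ a))) →
          ∃ λ G → (∀ a → a < n ℕ.* n → m (n ℕ.+ a) ≡ G a) × (¬ Certificate w G → H false) × (Certificate w G → H true)) →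
        wp verifier (λ _ → H true) (initialStore (map bit w))
      verifier-correct f = guess-correct {Q = wp (setup ⨾ for 1 pass ⨾ if≈ 10 0 (halt false) skip ⨾ checkPairs) (λ _ → H true)}
        (initialStore (map bit w))
        (refl , refl , length-map bit w , trans (length-map bit w) (sym (ℕ.+-identityʳ n)) , bits-memory w , λ _ ())
        λ { s@(store r m i) (e₀ , e₁₀ , i₀ , i₇ , inp , φ) →
          let (G , gs , rej , acc) = f m φ
              open Correctness (λ s → Φ (index s 7)) H n (wordOf w) G
          in passes-correct (λ j j<n nd → rej λ (d , _) → nd (d j j<n))
               (λ _ e → rej λ (_ , ne , _) → ne e)
               (λ _ p q p<n q<n no-orth → rej λ (_ , _ , o) → no-orth (o p q p<n q<n))
               (λ d ne o → acc (d , ne , o)) s e₀ e₁₀ i₀ i₇ inp gs }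

  accepts⇔certificate : ∀ w → Accepts (program verifier) (map bit w) ⇔ ∃ (Certificate w)
  accepts⇔certificate w = mk⇔
    (accepts-sound verifier (map bit w)
      (WP.wp-mono (λ _ _ → ⊤) (λ b → b ≡ true → ∃ (Certificate w)) verifier
        {Q = λ _ → true ≡ true → ∃ (Certificate w)} {Q′ = λ _ → ∃ (Certificate w)}
        (λ _ f → f refl) (initialStore (map bit w)) (verifier-correct (λ _ _ → ⊤) (λ b → b ≡ true → ∃ (Certificate w)) w
        λ m _ → (λ a → m (length w ℕ.+ a)) , (λ _ _ → refl) , (λ _ ()) , (λ c _ → (λ a → m (length w ℕ.+ a)) , c))))
    λ (G , c) → accepts-complete verifier {Ok = λ s g → g ≡ G (index s 7 ℕ.∸ length w)} (map bit w) (λ s → _ , refl)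
      (WP.wp-mono (λ s g → g ≡ G (index s 7 ℕ.∸ length w)) (_≡ true) verifier
        {Q = λ _ → true ≡ true} {Q′ = λ _ → ⊤} (λ _ _ → tt) (initialStore (map bit w)) (verifier-correct (λ a g → g ≡ G (a ℕ.∸ length w)) (_≡ true) w
        λ m φ → G , (λ a a< → trans (φ a a<) (cong G (ℕ.m+n∸m≡n (length w) a))) , (λ nc → ⊥-elim (nc c)) , λ _ → refl))
    where open Guessing

  -- Sealed, so that the compiled program is not unfolded in later proofs.
  abstract
    certificate-NP : ∃ λ M → PolynomialTime M × (∀ w → Accepts M (map bit w) ⇔ ∃ (Certificate w))
    certificate-NP = program verifier , program-polynomial verifier , accepts⇔certificate

-- Distribution of a vector to the leaves of a term

module Spreads where

  open import Data.Bool.Base using (Bool; true; false; if_then_else_) renaming (not to notᵇ)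
  open import Data.Empty using (⊥)
  open import Data.List.Base using (length; _++_)
  open import Data.List.Properties using (length-++)
  open import Data.Nat.Base as ℕ using (ℕ; suc; _≤_; _<_; s≤s; _+_; _∸_)
  import Data.Nat.Properties as ℕ
  import Data.Nat.Binary.Base as ℕᵇ
  open import Data.Product.Base using (∃; _×_; _,_; proj₁; proj₂)
  open import Data.Sum.Base using (_⊎_; inj₁; inj₂)
  open import Relation.Binary.PropositionalEquality using (_≡_; refl; sym; trans; cong; subst)
  open import Relation.Nullary.Decidable.Core using (yes; no)

  width : Term → ℕ
  width t = length (encode t)

  indexWidth : ℕ → ℕ
  indexWidth i = length (encodeIndex (ℕᵇ.fromℕ i))

  module _ {V : Set} (Null : V → Set) (_⊝_ : V → V → V) where

    left right : Bool → V → V → V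
    left  split v g = if split then g else v
    right split v g = if split then v ⊝ g else v

    -- v is distributed to the leaves of t, which starts at position p of the word: in order that
    -- v lies in s ∨ t, or in the orthocomplement of s ∧ t, it is split as the guess g plus v ⊝ g.
    -- P holds at the leaves, Z at the other positions.
    Spread : (P : ℕ → Bool → ℕ → V → Set) (Z : ℕ → Set) → Bool → Term → ℕ → V → (ℕ → V) → Set
    Spread P Z σ (var i)   p v g = (∀ k → k < suc (indexWidth i) → Z (k + p)) × P (indexWidth i + suc p) σ i v
    Spread P Z σ bottom    p v g = (∀ k → k < 4 → Z (k + p)) × (σ ≡ true → Null v)
    Spread P Z σ top       p v g = (∀ k → k < 4 → Z (k + p)) × (σ ≡ false → Null v)
    Spread P Z σ (not t)   p v g = (∀ k → k < 2 → Z (k + p)) × Spread P Z (notᵇ σ) t (2 + p) v g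
    Spread P Z σ (s and t) p v g = (∀ k → k < 2 → Z (k + p)) ×
      Spread P Z σ s (2 + p) (left (notᵇ σ) v (g (1 + p))) g ×
      Spread P Z σ t (width s + (2 + p)) (right (notᵇ σ) v (g (1 + p))) g
    Spread P Z σ (s or t)  p v g = (∀ k → k < 3 → Z (k + p)) ×
      Spread P Z σ s (3 + p) (left σ v (g (2 + p))) g ×
      Spread P Z σ t (width s + (3 + p)) (right σ v (g (2 + p))) g

  private
    module Positions (a : ℕ) (s t : Term) (p : ℕ) where

      total : width s + width t + (a + p) ≡ a + length (encode s ++ encode t) + p
      total = trans (cong (_+ (a + p)) (sym (length-++ (encode s))))
        (trans (sym (ℕ.+-assoc _ a p)) (cong (_+ p) (ℕ.+-comm _ a)))

      left-bound : width s + (a + p) ≤ a + length (encode s ++ encode t) + p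
      left-bound = ℕ.≤-trans (ℕ.+-monoˡ-≤ (a + p) (ℕ.m≤m+n (width s) (width t))) (ℕ.≤-reflexive total)

      right-end : width t + (width s + (a + p)) ≡ a + length (encode s ++ encode t) + p
      right-end = trans (trans (sym (ℕ.+-assoc (width t) (width s) (a + p))) (cong (_+ (a + p)) (ℕ.+-comm (width t) (width s)))) total

      right-bound : width t + (width s + (a + p)) ≤ a + length (encode s ++ encode t) + p
      right-bound = ℕ.≤-reflexive right-end

      in-left : ∀ {q} → a + p < q → q < width s + (a + p) → p < q × q < a + length (encode s ++ encode t) + p
      in-left le lt = ℕ.≤-<-trans (ℕ.m≤n+m p a) le ,
        ℕ.<-≤-trans lt left-bound

      in-right : ∀ {q} → width s + (a + p) < q → q < width t + (width s + (a + p)) →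
        p < q × q < a + length (encode s ++ encode t) + p
      in-right {q} le lt = ℕ.≤-<-trans (ℕ.m≤n+m p (width s + a)) (ℕ.≤-<-trans (ℕ.≤-reflexive (ℕ.+-assoc (width s) a p)) le) ,
        subst (q <_) right-end lt

      split : ∀ {q} → a + p ≤ q → q < a + length (encode s ++ encode t) + p →
        q < width s + (a + p) ⊎ (width s + (a + p) ≤ q × q < width t + (width s + (a + p)))
      split {q} le lt with q ℕ.<? width s + (a + p)
      ... | yes y = inj₁ y
      ... | no  n = inj₂ (ℕ.≮⇒≥ n , subst (q <_) (sym right-end) lt)

  module _ {V V′ : Set} {Null : V → Set} {_⊝_ : V → V → V} {Null′ : V′ → Set} {_⊝′_ : V′ → V′ → V′}
    {P : ℕ → Bool → ℕ → V → Set} {P′ : ℕ → Bool → ℕ → V′ → Set} {Z Z′ : ℕ → Set}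
    (R : V → V′ → Set)
    (R-⊝ : ∀ {v g v′ g′} → R v v′ → R g g′ → R (v ⊝ g) (v′ ⊝′ g′))
    (R-null : ∀ {v v′} → R v v′ → Null v → Null′ v′)
    (R-P : ∀ {q σ i v v′} → R v v′ → P q σ i v → P′ q σ i v′)
    (R-Z : ∀ {q} → Z q → Z′ q)
    where

    private
      R-left : ∀ b {v g v′ g′} → R v v′ → R g g′ → R (left Null _⊝_ b v g) (left Null′ _⊝′_ b v′ g′)
      R-left true  v~ g~ = g~
      R-left false v~ g~ = v~

      R-right : ∀ b {v g v′ g′} → R v v′ → R g g′ → R (right Null _⊝_ b v g) (right Null′ _⊝′_ b v′ g′)
      R-right true  v~ g~ = R-⊝ v~ g~
      R-right false v~ g~ = v~

    -- A spread uses nothing but differences and the test for zero, so it is carried along any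
    -- relation that respects these. Guesses matter only strictly inside the codeword: its first
    -- position never splits.
    spread-map : ∀ σ t p {v v′ g g′} → (∀ q → p < q → q < width t + p → R (g q) (g′ q)) → R v v′ →
      Spread Null _⊝_ P Z σ t p v g → Spread Null′ _⊝′_ P′ Z′ σ t p v′ g′
    spread-map σ (var i) p g~ v~ (z , x) = (λ k lt → R-Z (z k lt)) , R-P v~ x
    spread-map σ bottom  p g~ v~ (z , x) = (λ k lt → R-Z (z k lt)) , λ e → R-null v~ (x e)
    spread-map σ top     p g~ v~ (z , x) = (λ k lt → R-Z (z k lt)) , λ e → R-null v~ (x e)
    spread-map σ (not t) p g~ v~ (z , x) = (λ k lt → R-Z (z k lt)) ,
      spread-map (notᵇ σ) t (2 + p)
        (λ q le lt → g~ q (ℕ.≤-<-trans (ℕ.m≤n+m p 2) le)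
          (subst (q <_) (trans (ℕ.+-suc (width t) (suc p)) (cong suc (ℕ.+-suc (width t) p))) lt)) v~ x
    spread-map σ (s and t) p g~ v~ (z , x , y) = (λ k lt → R-Z (z k lt)) ,
      spread-map σ s (2 + p) (λ q le lt → let (a , b) = in-left le lt in g~ q a b) (R-left (notᵇ σ) v~ here) x ,
      spread-map σ t (width s + (2 + p)) (λ q le lt → let (a , b) = in-right le lt in g~ q a b) (R-right (notᵇ σ) v~ here) y
      where
      open Positions 2 s t p
      here = g~ (1 + p) ℕ.≤-refl (s≤s (s≤s (ℕ.m≤n+m p _)))
    spread-map σ (s or t) p g~ v~ (z , x , y) = (λ k lt → R-Z (z k lt)) ,
      spread-map σ s (3 + p) (λ q le lt → let (a , b) = in-left le lt in g~ q a b) (R-left σ v~ here) x ,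
      spread-map σ t (width s + (3 + p)) (λ q le lt → let (a , b) = in-right le lt in g~ q a b) (R-right σ v~ here) y
      where
      open Positions 3 s t p
      here = g~ (2 + p) (ℕ.m≤n+m (suc p) 1) (s≤s (s≤s (s≤s (ℕ.m≤n+m p _))))

  LeafOf : {V : Set} → (ℕ → Bool → ℕ → V → Set) → ℕ → Set
  LeafOf P q = ∃ λ σ → ∃ λ i → ∃ λ v → P q σ i v

  module _ {V : Set} {Null : V → Set} {_⊝_ : V → V → V} where

    spread-zip : ∀ {P P′ Z Z′} σ t p {v g} → Spread Null _⊝_ P Z σ t p v g → Spread Null _⊝_ P′ Z′ σ t p v g →
      Spread Null _⊝_ (λ q σ i v → P q σ i v × P′ q σ i v) (λ q → Z q × Z′ q) σ t p v g
    spread-zip σ (var i)   p (z , x) (z′ , x′) = (λ k lt → z k lt , z′ k lt) , (x , x′)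
    spread-zip σ bottom    p (z , x) (z′ , x′) = (λ k lt → z k lt , z′ k lt) , x
    spread-zip σ top       p (z , x) (z′ , x′) = (λ k lt → z k lt , z′ k lt) , x
    spread-zip σ (not t)   p (z , x) (z′ , x′) = (λ k lt → z k lt , z′ k lt) , spread-zip (notᵇ σ) t _ x x′
    spread-zip σ (s and t) p (z , x , y) (z′ , x′ , y′) =
      (λ k lt → z k lt , z′ k lt) , spread-zip σ s _ x x′ , spread-zip σ t _ y y′
    spread-zip σ (s or t)  p (z , x , y) (z′ , x′ , y′) =
      (λ k lt → z k lt , z′ k lt) , spread-zip σ s _ x x′ , spread-zip σ t _ y y′

    private
      leading : ∀ {Z : ℕ → Set} a {p q} → (∀ k → k < a → Z (k + p)) → p ≤ q → q < a + p → Z q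
      leading {Z} a {p} {q} z le lt = subst Z (ℕ.m∸n+n≡m le)
        (z (q ∸ p) (ℕ.+-cancelʳ-< p _ _ (subst (_< a + p) (sym (ℕ.m∸n+n≡m le)) lt)))

      prefix : ∀ a {p q} → q < a + p ⊎ a + p ≤ q
      prefix a {p} {q} with q ℕ.<? a + p
      ... | yes y = inj₁ y
      ... | no  n = inj₂ (ℕ.≮⇒≥ n)

    -- The verifier compares all pairs of positions and not just leaves, so every position of the
    -- word has to be accounted for.
    classify : ∀ {P Z} σ t p {v g} → Spread Null _⊝_ P Z σ t p v g →
      ∀ q → p ≤ q → q < width t + p → Z q ⊎ LeafOf P q
    classify {P} {Z} σ (var i) p {v} (z , x) q le lt with prefix (suc (indexWidth i)) {p} {q}
    ... | inj₁ l = inj₁ (leading {Z} (suc (indexWidth i)) z le l)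
    ... | inj₂ l = inj₂ (σ , i , v , subst (λ q → P q σ i v) (ℕ.≤-antisym
            (ℕ.≤-trans (ℕ.≤-reflexive (ℕ.+-suc (indexWidth i) p)) l)
            (ℕ.≤-trans (ℕ.≤-pred lt) (ℕ.≤-reflexive (sym (ℕ.+-suc (indexWidth i) p))))) x)
    classify {P} {Z} σ bottom p (z , x) q le lt = inj₁ (leading {Z} 4 z le lt)
    classify {P} {Z} σ top    p (z , x) q le lt = inj₁ (leading {Z} 4 z le lt)
    classify {P} {Z} σ (not t) p (z , x) q le lt with prefix 2 {p} {q}
    ... | inj₁ l = inj₁ (leading {Z} 2 z le l)
    ... | inj₂ l = classify {P} {Z} (notᵇ σ) t (2 + p) x q l
            (subst (q <_) (sym (trans (ℕ.+-suc (width t) (suc p)) (cong suc (ℕ.+-suc (width t) p)))) lt)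
    classify {P} {Z} σ (s and t) p (z , x , y) q le lt with prefix 2 {p} {q}
    ... | inj₁ l = inj₁ (leading {Z} 2 z le l)
    ... | inj₂ l with Positions.split 2 s t p l lt
    ...   | inj₁ lt′         = classify {P} {Z} σ s (2 + p) x q l lt′
    ...   | inj₂ (le′ , lt′) = classify {P} {Z} σ t (width s + (2 + p)) y q le′ lt′
    classify {P} {Z} σ (s or t) p (z , x , y) q le lt with prefix 3 {p} {q}
    ... | inj₁ l = inj₁ (leading {Z} 3 z le l)
    ... | inj₂ l with Positions.split 3 s t p l lt
    ...   | inj₁ lt′         = classify {P} {Z} σ s (3 + p) x q l lt′
    ...   | inj₂ (le′ , lt′) = classify {P} {Z} σ t (width s + (3 + p)) y q le′ lt′

  module _ {V : Set} {Null : V → Set} {_⊝_ : V → V → V} {P : ℕ → Bool → ℕ → V → Set} {Z : ℕ → Set} where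

    private
      weaken : ∀ σ t p {v g} {m m′} → m ≤ m′ → Spread Null _⊝_ (λ q σ i v → P q σ i v × q < m) Z σ t p v g →
        Spread Null _⊝_ (λ q σ i v → P q σ i v × q < m′) Z σ t p v g
      weaken σ t p m≤ = spread-map _≡_ (λ { refl refl → refl }) (λ { refl z → z })
        (λ { refl (x , lt) → x , ℕ.<-≤-trans lt m≤ }) (λ z → z) σ t p (λ _ _ _ → refl) refl

    -- Orthogonality is tested only for positions below the length of the word; leaves must be known
    -- to lie there.
    spread-within : ∀ σ t p {v g} → Spread Null _⊝_ P Z σ t p v g →
      Spread Null _⊝_ (λ q σ i v → P q σ i v × q < width t + p) Z σ t p v g
    spread-within σ (var i) p (z , x) = z , x , s≤s (ℕ.≤-reflexive (ℕ.+-suc (indexWidth i) p))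
    spread-within σ bottom  p (z , x) = z , x
    spread-within σ top     p (z , x) = z , x
    spread-within σ (not t) p (z , x) = z ,
      weaken (notᵇ σ) t (2 + p) (ℕ.≤-reflexive (trans (ℕ.+-suc (width t) (suc p)) (cong suc (ℕ.+-suc (width t) p))))
        (spread-within (notᵇ σ) t (2 + p) x)
    spread-within σ (s and t) p (z , x , y) = z ,
      weaken σ s (2 + p) (Positions.left-bound 2 s t p) (spread-within σ s (2 + p) x) ,
      weaken σ t (width s + (2 + p)) (Positions.right-bound 2 s t p) (spread-within σ t (width s + (2 + p)) y)
    spread-within σ (s or t) p (z , x , y) = z ,
      weaken σ s (3 + p) (Positions.left-bound 3 s t p) (spread-within σ s (3 + p) x) ,
      weaken σ t (width s + (3 + p)) (Positions.right-bound 3 s t p) (spread-within σ t (width s + (3 + p)) y)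

  module _ {J V : Set} {Null : V → Set} {_⊝_ : V → V → V}
    {P : J → ℕ → Bool → ℕ → V → Set} {Z : J → ℕ → Set} where

    private
      Null* : (J → V) → Set
      Null* v = ∀ j → Null (v j)

      _⊝*_ : (J → V) → (J → V) → J → V
      (v ⊝* g) j = v j ⊝ g j

      left* : ∀ b {v g : J → V} j → left Null* _⊝*_ b v g j ≡ left Null _⊝_ b (v j) (g j)
      left* true  j = refl
      left* false j = refl

      right* : ∀ b {v g : J → V} j → right Null* _⊝*_ b v g j ≡ right Null _⊝_ b (v j) (g j)
      right* true  j = refl
      right* false j = refl

    -- Signs and connectives alone decide where to split, hence all coordinates split at the same
    -- places and combine to a spread of vectors.
    spread-pointwise : ∀ σ t p {v : J → V} {g : ℕ → J → V} →
      (∀ j → Spread Null _⊝_ (P j) (Z j) σ t p (v j) (λ q → g q j)) →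
      Spread Null* _⊝*_ (λ q σ i v → ∀ j → P j q σ i (v j)) (λ q → ∀ j → Z j q) σ t p v g
    spread-pointwise σ (var i) p x = (λ k lt j → proj₁ (x j) k lt) , λ j → proj₂ (x j)
    spread-pointwise σ bottom  p x = (λ k lt j → proj₁ (x j) k lt) , λ e j → proj₂ (x j) e
    spread-pointwise σ top     p x = (λ k lt j → proj₁ (x j) k lt) , λ e j → proj₂ (x j) e
    spread-pointwise σ (not t) p x = (λ k lt j → proj₁ (x j) k lt) , spread-pointwise (notᵇ σ) t (2 + p) (λ j → proj₂ (x j))
    spread-pointwise σ (s and t) p {v} {g} x = (λ k lt j → proj₁ (x j) k lt) ,
      spread-pointwise σ s (2 + p) (λ j → subst (λ v → Spread Null _⊝_ (P j) (Z j) σ s (2 + p) v (λ q → g q j))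
        (sym (left* (notᵇ σ) j)) (proj₁ (proj₂ (x j)))) ,
      spread-pointwise σ t (width s + (2 + p)) (λ j → subst (λ v → Spread Null _⊝_ (P j) (Z j) σ t _ v (λ q → g q j))
        (sym (right* (notᵇ σ) j)) (proj₂ (proj₂ (x j))))
    spread-pointwise σ (s or t) p {v} {g} x = (λ k lt j → proj₁ (x j) k lt) ,
      spread-pointwise σ s (3 + p) (λ j → subst (λ v → Spread Null _⊝_ (P j) (Z j) σ s (3 + p) v (λ q → g q j))
        (sym (left* σ j)) (proj₁ (proj₂ (x j)))) ,
      spread-pointwise σ t (width s + (3 + p)) (λ j → subst (λ v → Spread Null _⊝_ (P j) (Z j) σ t _ v (λ q → g q j))
        (sym (right* σ j)) (proj₂ (proj₂ (x j))))

-- Runs of the automaton and encodings of terms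

module Parse (K : OrderedField) where

  open import Data.Bool.Base using (Bool; true; false) renaming (not to notᵇ)
  open import Data.Empty using (⊥; ⊥-elim)
  open import Data.Integer.Base using (+_)
  open import Data.List.Base using (List; []; _∷_; _++_; length)
  open import Data.List.Properties using (length-++; ++-assoc)
  open import Data.Maybe.Base using (Maybe; just; nothing; _>>=_)
  open import Data.Nat.Base as ℕ using (ℕ; zero; suc; _≤_; _<_; z≤n; s≤s)
  import Data.Nat.Properties as ℕ
  open import Data.Nat.Binary.Base as ℕᵇ using (ℕᵇ; 2[1+_]; 1+[2_])
  import Data.Nat.Binary.Properties as ℕᵇ
  open import Data.Product.Base using (∃; ∃₂; _×_; proj₁; proj₂; _,_)
  open import Data.Sum.Base using (_⊎_; inj₁; inj₂)
  open import Data.Unit.Base using (⊤; tt)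
  open import Relation.Binary.PropositionalEquality using (_≡_; refl; sym; trans; cong; cong₂; subst)
  open import Relation.Nullary.Decidable.Core using (yes; no)
  open import Relation.Nullary.Negation.Core using (¬_)

  private module K = OrderedField K
  open OrderedField K using (Carrier; _≈_; _+_; _*_; _-_; 0#; 1#; _≟_)
  open OrderedFieldProperties K using (_·_; ×-homo-+; solve; _:=_; _:+_; _:*_; con)
  open Automata K hiding (left; right)
  open Spreads hiding (Spread)
  Spread = Spreads.Spread (_≈ 0#) _-_

  varName : Bool → ℕ → Carrier
  varName σ i = sgn σ * (suc i · 1#)

  Reads : (ℕ → Bool) → ℕ → List Bool → Set
  Reads word p []      = ⊤
  Reads word p (b ∷ u) = word p ≡ b × Reads word (suc p) u

  reads-++ : ∀ {word} p u {u′} → Reads word p (u ++ u′) → Reads word p u × Reads word (length u ℕ.+ p) u′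
  reads-++ p []               r       = tt , r
  reads-++ {word} p (b ∷ u) {u′} (e , r) =
    let (r₁ , r₂) = reads-++ (suc p) u r
    in (e , r₁) , subst (λ k → Reads word k u′) (ℕ.+-suc (length u) p) r₂

  module _ (word : ℕ → Bool) (g : ℕ → Carrier) where

    open Trace word g

    AtLeaf : ℕ → Bool → ℕ → Carrier → Set
    AtLeaf q σ i v = valueAt q ≈ v × nameAt q ≈ varName σ i

    Silent : ℕ → Set
    Silent q = valueAt q ≈ 0#

    PopsAt : ℕ → List (Bool × Carrier) → Set
    PopsAt q st = ∃ λ a → trace q ≡ just (pop a) × stack a ≡ st

    private
      step : ∀ {p a b} → trace p ≡ just a → word p ≡ b → trace (suc p) ≡ δ b (g p) a
      step {p} e refl = trace-step {p} e

      value-at : ∀ {p a b} → trace p ≡ just a → word p ≡ b → valueAt p ≡ outValue b a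
      value-at {p} e refl = valueAt-≡ {p} e

      name-at : ∀ {p a b} → trace p ≡ just a → word p ≡ b → nameAt p ≡ outName b a
      name-at {p} e refl = nameAt-≡ {p} e

      silent : ∀ {p a b} → trace p ≡ just a → word p ≡ b → outValue b a ≡ 0# → Silent p
      silent {p} e r o = K.reflexive (trans (value-at {p} e r) o)

    trace-dead : ∀ k p → trace p ≡ nothing → trace (k ℕ.+ p) ≡ nothing
    trace-dead zero    p e = e
    trace-dead (suc k) p e rewrite trace-dead k p e = refl

    -- The accumulator `c` and the weight `w` reflect the digits already read, so the remaining
    -- index `x` contributes `w` times its value. The output appears at the last bit of the
    -- codeword.
    IndexRead : ℕ → Bool → Carrier → Carrier → Carrier → List (Bool × Carrier) → ℕᵇ → Set
    IndexRead p σ v w c st x = ∃ λ l → length (encodeIndex x) ≡ suc l × (∀ k → k < l → Silent (k ℕ.+ p)) ×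
      valueAt (l ℕ.+ p) ≈ v × nameAt (l ℕ.+ p) ≈ sgn σ * (c + w * (ℕᵇ.toℕ x · 1#)) × PopsAt (suc l ℕ.+ p) st

    private
      two-more : ∀ {p σ v w w′ c c′ st x y} →
        Silent p → Silent (suc p) → length (encodeIndex y) ≡ 2 ℕ.+ length (encodeIndex x) →
        c′ + w′ * (ℕᵇ.toℕ x · 1#) ≈ c + w * (ℕᵇ.toℕ y · 1#) →
        IndexRead (2 ℕ.+ p) σ v w′ c′ st x → IndexRead p σ v w c st y
      two-more {p} {σ} {v} {w′ = w′} {c′ = c′} {st = st} {x = x} z₀ z₁ ly ce (l , el , z , ev , en , pops) =
        2 ℕ.+ l , trans ly (cong (2 ℕ.+_) el) ,
        (λ { zero _ → z₀ ; (suc zero) _ → z₁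
           ; (suc (suc k)) (s≤s (s≤s k<l)) → subst Silent (shift k) (z k k<l) }) ,
        subst (λ q → valueAt q ≈ v) (shift l) ev ,
        K.trans (subst (λ q → nameAt q ≈ sgn σ * (c′ + w′ * (ℕᵇ.toℕ x · 1#))) (shift l) en) (K.*-congˡ ce) ,
        subst (λ q → PopsAt q st) (cong suc (shift l)) pops
        where
        shift : ∀ k → k ℕ.+ (2 ℕ.+ p) ≡ 2 ℕ.+ k ℕ.+ p
        shift k = trans (ℕ.+-suc k (suc p)) (cong suc (ℕ.+-suc k p))

    index-read : ∀ x {p σ v w c st} → trace p ≡ just (conf flag σ v w c st) → Reads word p (encodeIndex x) →
      IndexRead p σ v w c st x
    index-read ℕᵇ.zero {p} {σ} {v} {w} {c} {st} e (r , _) = 0 , refl , (λ _ ()) ,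
      K.trans (K.reflexive (value-at {p} e r)) (K.+-identityʳ v) ,
      K.trans (K.reflexive (name-at {p} e r)) (K.*-congˡ (K.sym (K.trans (K.+-congˡ (K.zeroʳ w)) (K.+-identityʳ c)))) ,
      conf start σ v w c st , step {p} e r , refl
    index-read 2[1+ x ] {p} {σ} {v} {w} {c} {st} e (r , r′ , rs) = two-more {x = x} {2[1+ x ]}
      (silent {p} e r refl) (silent {suc p} (step {p} e r) r′ refl) refl
      -- The index is 2 + 2 x: the digit adds twice the old weight, and `x` is read with the doubled
      -- one.
      (K.trans (solve 3 (λ c w x → c :+ w :+ w :+ (w :+ w) :* x := c :+ w :* (x :+ x :+ (con (+ 1) :+ con (+ 1)))) K.refl c w (ℕᵇ.toℕ x · 1#))
               (K.+-congˡ (K.*-congˡ (K.sym double))))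
      (index-read x (step {suc p} (step {p} e r) r′) rs)
      where
      double : (2 ℕ.* suc (ℕᵇ.toℕ x)) · 1# ≈ ℕᵇ.toℕ x · 1# + ℕᵇ.toℕ x · 1# + (1# + 1#)
      double = K.trans (×-homo-+ 1# (suc (ℕᵇ.toℕ x)) (1 ℕ.* suc (ℕᵇ.toℕ x)))
        (K.trans (K.+-congˡ (K.trans (K.reflexive (cong (_· 1#) (ℕ.*-identityˡ (suc (ℕᵇ.toℕ x))))) K.refl))
          (solve 2 (λ o x → o :+ x :+ (o :+ x) := x :+ x :+ (o :+ o)) K.refl 1# (ℕᵇ.toℕ x · 1#)))
    index-read 1+[2 x ] {p} {σ} {v} {w} {c} {st} e (r , r′ , rs) = two-more {x = x} {1+[2 x ]}
      (silent {p} e r refl) (silent {suc p} (step {p} e r) r′ refl) refl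
      (K.trans (solve 3 (λ c w x → c :+ w :+ (w :+ w) :* x := c :+ w :* (con (+ 1) :+ (x :+ x))) K.refl c w (ℕᵇ.toℕ x · 1#))
               (K.+-congˡ (K.*-congˡ (K.sym (K.+-congˡ double)))))
      (index-read x (step {suc p} (step {p} e r) r′) rs)
      where
      double : (2 ℕ.* ℕᵇ.toℕ x) · 1# ≈ ℕᵇ.toℕ x · 1# + ℕᵇ.toℕ x · 1#
      double = K.trans (×-homo-+ 1# (ℕᵇ.toℕ x) (1 ℕ.* ℕᵇ.toℕ x))
        (K.+-congˡ (K.reflexive (cong (_· 1#) (ℕ.*-identityˡ (ℕᵇ.toℕ x)))))

    Always : ℕ → Bool → ℕ → Carrier → Set
    Always _ _ _ _ = ⊤

    -- On the encoding of a term the automaton can fail only at a constant that requires zero.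
    -- Failure therefore excludes even a spread with no condition on its leaves, which makes such a
    -- spread sufficient for success.
    Parsed : Bool → Term → ℕ → Carrier → List (Bool × Carrier) → Set
    Parsed σ t p v st =
      (PopsAt (width t ℕ.+ p) st × Spread AtLeaf Silent σ t p v g) ⊎
      (trace (width t ℕ.+ p) ≡ nothing × ¬ Spread Always (λ _ → ⊤) σ t p v g)

    private
      pops-next : ∀ q {σ v st} → PopsAt q ((σ , v) ∷ st) → ∃₂ λ w c → trace q ≡ just (conf start σ v w c st)
      pops-next _ (conf _ _ _ w c _ , e , refl) = w , c , e

    private
      zeroTest : ∀ {q σ τ v w c st} → trace q ≡ requireZero τ (conf start σ v w c st) →
        (PopsAt q st × (τ ≡ true → v ≈ 0#)) ⊎ (trace q ≡ nothing × ¬ (τ ≡ true → v ≈ 0#))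
      zeroTest {τ = false} e = inj₁ ((_ , e , refl) , λ ())
      zeroTest {τ = true} {v = v} e with v ≟ 0#
      ... | yes z = inj₁ ((_ , e , refl) , λ _ → z)
      ... | no nz = inj₂ (e , λ z → nz (z refl))

    parse : ∀ t {p σ v w c st} → trace p ≡ just (conf start σ v w c st) → Reads word p (encode t) → Parsed σ t p v st

    private
      parse-two : ∀ s t {p q q′ b σ v x w c st} → trace q ≡ just (fork b x (conf start σ v w c st)) →
        q′ ≡ width s ℕ.+ width t ℕ.+ q → Reads word q (encode s ++ encode t) →
        (PopsAt q′ st × Spread AtLeaf Silent σ s q (left (_≈ 0#) _-_ b v x) g ×
                        Spread AtLeaf Silent σ t (width s ℕ.+ q) (right (_≈ 0#) _-_ b v x) g) ⊎
        (trace q′ ≡ nothing × ¬ (Spread Always (λ _ → ⊤) σ s q (left (_≈ 0#) _-_ b v x) g ×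
                                 Spread Always (λ _ → ⊤) σ t (width s ℕ.+ q) (right (_≈ 0#) _-_ b v x) g))
      parse-two s t {q = q} {b = b} {σ} {v} {x} {st = st} e refl r
        with (r₁ , r₂) ← reads-++ q (encode s) r
        with parse s e r₁
      ... | inj₂ (dead , ¬s) = inj₂
              (subst (λ k → trace k ≡ nothing) (trans (sym (ℕ.+-assoc (width t) (width s) q)) (cong (ℕ._+ q) (ℕ.+-comm (width t) (width s))))
                (trace-dead (width t) _ dead) , λ (d , _) → ¬s d)
      ... | inj₁ (pops , ss) with parse t (proj₂ (proj₂ (pops-next (width s ℕ.+ q) pops))) r₂
      ...   | inj₁ (pops′ , st′) = inj₁ (subst (λ k → PopsAt k st) arith pops′ , ss , st′)
        where arith = trans (sym (ℕ.+-assoc (width t) (width s) q)) (cong (ℕ._+ q) (ℕ.+-comm (width t) (width s)))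
      ...   | inj₂ (dead , ¬t) = inj₂ (subst (λ k → trace k ≡ nothing)
                (trans (sym (ℕ.+-assoc (width t) (width s) q)) (cong (ℕ._+ q) (ℕ.+-comm (width t) (width s)))) dead , λ (_ , d) → ¬t d)

    parse (var i) {p} {σ} {v} {w} {c} {st} e (r , r′ , rs) =
      let e₁ = step {p} e r
          (l , el , z , ev , en , pops) = index-read (ℕᵇ.fromℕ i) (step {suc p} e₁ r′) rs
          shift : ∀ k → k ℕ.+ (2 ℕ.+ p) ≡ suc k ℕ.+ suc p
          shift k = ℕ.+-suc k (suc p)
          leaf : l ℕ.+ (2 ℕ.+ p) ≡ indexWidth i ℕ.+ suc p
          leaf = trans (shift l) (cong (ℕ._+ suc p) (sym el))
      in inj₁ (subst (λ q → PopsAt q st) (trans (cong suc leaf) (trans (cong suc (ℕ.+-suc (indexWidth i) p)) refl)) pops ,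
           (λ { zero _ → silent {p} e r refl ; (suc zero) _ → silent {suc p} e₁ r′ refl
              ; (suc (suc k)) (s≤s lt) → subst Silent (trans (shift k) (cong suc (ℕ.+-suc k p)))
                  (z k (ℕ.≤-pred (subst (suc (suc k) ≤_) el lt))) }) ,
           subst (λ q → valueAt q ≈ v) leaf ev ,
           K.trans (subst (λ q → nameAt q ≈ sgn σ * (1# + 1# * (ℕᵇ.toℕ (ℕᵇ.fromℕ i) · 1#))) leaf en) (K.*-congˡ (K.+-congˡ (K.trans (K.*-identityˡ _)
             (K.reflexive (cong (_· 1#) (ℕᵇ.toℕ-fromℕ i)))))))
    parse bottom {p} e (r , r′ , r″ , r‴ , _) with zeroTest {4 ℕ.+ p} (step {3 ℕ.+ p} (step {2 ℕ.+ p} (step {1 ℕ.+ p} (step {p} e r) r′) r″) r‴)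
    ... | inj₁ (pops , z) = inj₁ (pops ,
            (λ { 0 _ → silent {p} e r refl ; 1 _ → silent {suc p} (step {p} e r) r′ refl
               ; 2 _ → silent {2 ℕ.+ p} (step {1 ℕ.+ p} (step {p} e r) r′) r″ refl
               ; 3 _ → silent {3 ℕ.+ p} (step {2 ℕ.+ p} (step {1 ℕ.+ p} (step {p} e r) r′) r″) r‴ refl
               ; (suc (suc (suc (suc k)))) (s≤s (s≤s (s≤s (s≤s ())))) }) , z)
    ... | inj₂ (dead , nz) = inj₂ (dead , λ (_ , z) → nz z)
    parse top {p} {σ} e (r , r′ , r″ , r‴ , _) with zeroTest {4 ℕ.+ p} (step {3 ℕ.+ p} (step {2 ℕ.+ p} (step {1 ℕ.+ p} (step {p} e r) r′) r″) r‴)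
    ... | inj₁ (pops , z) = inj₁ (pops ,
            (λ { 0 _ → silent {p} e r refl ; 1 _ → silent {suc p} (step {p} e r) r′ refl
               ; 2 _ → silent {2 ℕ.+ p} (step {1 ℕ.+ p} (step {p} e r) r′) r″ refl
               ; 3 _ → silent {3 ℕ.+ p} (step {2 ℕ.+ p} (step {1 ℕ.+ p} (step {p} e r) r′) r″) r‴ refl
               ; (suc (suc (suc (suc k)))) (s≤s (s≤s (s≤s (s≤s ())))) }) , λ { refl → z refl })
    ... | inj₂ (dead , nz) = inj₂ (dead , λ (_ , z) → nz λ e → z (not-true σ e))
      where
      not-true : ∀ σ → notᵇ σ ≡ true → σ ≡ false
      not-true false _ = refl
    parse (not t) {p} {st = st} e (r , r′ , rs) with parse t (step {1 ℕ.+ p} (step {p} e r) r′) rs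
    ... | inj₁ (pops , sp) = inj₁ (subst (λ k → PopsAt k st) (trans (ℕ.+-suc (width t) (suc p)) (cong suc (ℕ.+-suc (width t) p))) pops ,
            (λ { 0 _ → silent {p} e r refl ; 1 _ → silent {suc p} (step {p} e r) r′ refl
               ; (suc (suc k)) (s≤s (s≤s ())) }) , sp)
    ... | inj₂ (dead , ns) = inj₂ (subst (λ k → trace k ≡ nothing) (trans (ℕ.+-suc (width t) (suc p)) (cong suc (ℕ.+-suc (width t) p))) dead , λ (_ , d) → ns d)
    parse (s and t) {p} {σ} {v} {st = st} e (r , r′ , rs)
      with parse-two s t {p} {2 ℕ.+ p} {width (s and t) ℕ.+ p} {notᵇ σ} {σ} {v} {g (1 ℕ.+ p)} (step {1 ℕ.+ p} (step {p} e r) r′)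
             (trans (cong (λ k → 2 ℕ.+ k ℕ.+ p) (length-++ (encode s))) (sym (trans (ℕ.+-suc (width s ℕ.+ width t) (suc p)) (cong suc (ℕ.+-suc (width s ℕ.+ width t) p))))) rs
    ... | inj₁ (pops , sp) = inj₁ (pops ,
            (λ { 0 _ → silent {p} e r refl ; 1 _ → silent {suc p} (step {p} e r) r′ refl
               ; (suc (suc k)) (s≤s (s≤s ())) }) , sp)
    ... | inj₂ (dead , ns) = inj₂ (dead , λ (_ , d) → ns d)
    parse (s or t) {p} {σ} {v} {st = st} e (r , r′ , r″ , rs)
      with parse-two s t {p} {3 ℕ.+ p} {width (s or t) ℕ.+ p} {σ} {σ} {v} {g (2 ℕ.+ p)} (step {2 ℕ.+ p} (step {1 ℕ.+ p} (step {p} e r) r′) r″)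
             (trans (cong (λ k → 3 ℕ.+ k ℕ.+ p) (length-++ (encode s)))
                (sym (trans (ℕ.+-suc (width s ℕ.+ width t) (2 ℕ.+ p)) (cong suc
                  (trans (ℕ.+-suc (width s ℕ.+ width t) (suc p)) (cong suc (ℕ.+-suc (width s ℕ.+ width t) p))))))) rs
    ... | inj₁ (pops , sp) = inj₁ (pops ,
            (λ { 0 _ → silent {p} e r refl ; 1 _ → silent {suc p} (step {p} e r) r′ refl
               ; 2 _ → silent {2 ℕ.+ p} (step {1 ℕ.+ p} (step {p} e r) r′) r″ refl
               ; (suc (suc (suc k))) (s≤s (s≤s (s≤s ()))) }) , sp)
    ... | inj₂ (dead , ns) = inj₂ (dead , λ (_ , d) → ns d)

    private
      Stuck : ℕ → Set
      Stuck q = ¬ Done q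

      stuck-at : ∀ {q} {a} → trace q ≡ just a → ¬ mode a ≡ done → Stuck q
      stuck-at e ne (a , e′ , d) with trans (sym e) e′
      ... | refl = ne d

      dead-stuck : ∀ q → trace q ≡ nothing → Stuck q
      dead-stuck q e (a , e′ , d) with trans (sym e) e′
      ... | ()

      later : ∀ {q q′} → q ≡ q′ → Stuck q → Stuck q′
      later refl s = s

      index-or-stuck : ∀ u {p σ v w c st} → trace p ≡ just (conf flag σ v w c st) → Reads word p u →
        (∃₂ λ x r → u ≡ encodeIndex x ++ r) ⊎ Stuck (length u ℕ.+ p)
      index-or-stuck [] {p}           e _ = inj₂ (stuck-at {p} e λ ())
      index-or-stuck (false ∷ u)      e _ = inj₁ (ℕᵇ.zero , u , refl)
      index-or-stuck (true ∷ [])  {p} e (r , _) = inj₂ (stuck-at {suc p} (step {p} e r) λ ())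
      index-or-stuck (true ∷ false ∷ u) {p} e (r , r′ , rs) with index-or-stuck u (step {suc p} (step {p} e r) r′) rs
      ... | inj₁ (x , r , refl) = inj₁ (2[1+ x ] , r , refl)
      ... | inj₂ s              = inj₂ (later (trans (ℕ.+-suc (length u) (suc p)) (cong suc (ℕ.+-suc (length u) p))) s)
      index-or-stuck (true ∷ true ∷ u) {p} e (r , r′ , rs) with index-or-stuck u (step {suc p} (step {p} e r) r′) rs
      ... | inj₁ (x , r , refl) = inj₁ (1+[2 x ] , r , refl)
      ... | inj₂ s              = inj₂ (later (trans (ℕ.+-suc (length u) (suc p)) (cong suc (ℕ.+-suc (length u) p))) s)

      shift₂ : ∀ (u : List Bool) p → length u ℕ.+ (2 ℕ.+ p) ≡ 2 ℕ.+ length u ℕ.+ p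
      shift₂ u p = trans (ℕ.+-suc (length u) (suc p)) (cong suc (ℕ.+-suc (length u) p))

      Recognised : List Bool → ℕ → Set
      Recognised u p = (∃₂ λ t r → u ≡ encode t ++ r) ⊎ Stuck (length u ℕ.+ p)

      -- The second operand starts in a remainder that is known only after the first has been
      -- recognised, so the recursion is not structural; `fuel` bounds the length of the word.
      recognise : ∀ fuel u {p σ v w c st} → length u ≤ fuel → trace p ≡ just (conf start σ v w c st) → Reads word p u →
        Recognised u p

      recognise-two : ∀ fuel u {p b x σ v w c st} → length u ≤ fuel →
        trace p ≡ just (fork b x (conf start σ v w c st)) → Reads word p u →
        (∃₂ λ s t → ∃ λ r → u ≡ encode s ++ encode t ++ r) ⊎ Stuck (length u ℕ.+ p)
      recognise-two fuel u {p} le e r with recognise fuel u le e r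
      ... | inj₂ s = inj₂ s
      -- Recognition tells that a term comes first; `parse` tells in which configuration the
      -- automaton leaves it.
      ... | inj₁ (s , u′ , refl) with (r₁ , r₂) ← reads-++ p (encode s) r with parse s e r₁
      ...   | inj₂ (dead , _) = inj₂ (dead-stuck (length (encode s ++ u′) ℕ.+ p) (subst (λ k → trace k ≡ nothing)
                (trans (sym (ℕ.+-assoc (length u′) (width s) p))
                  (cong (ℕ._+ p) (trans (ℕ.+-comm (length u′) (width s)) (sym (length-++ (encode s))))))
                (trace-dead (length u′) (width s ℕ.+ p) dead)))
      ...   | inj₁ (pops , _) with recognise fuel u′
                (ℕ.≤-trans (subst (length u′ ≤_) (sym (length-++ (encode s))) (ℕ.m≤n+m (length u′) (width s))) le)
                (proj₂ (proj₂ (pops-next (width s ℕ.+ p) pops))) r₂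
      ...     | inj₁ (t , r , refl) = inj₁ (s , t , r , refl)
      ...     | inj₂ st = inj₂ (later (trans (sym (ℕ.+-assoc (length u′) (width s) p))
                  (cong (ℕ._+ p) (trans (ℕ.+-comm (length u′) (width s)) (sym (length-++ (encode s)))))) st)

      recognise fuel [] {p}      le e _ = inj₂ (stuck-at {p} e λ ())
      recognise fuel (false ∷ []) {p} le e (r , _) = inj₂ (stuck-at {suc p} (step {p} e r) λ ())
      recognise fuel (true ∷ [])  {p} le e (r , _) = inj₂ (stuck-at {suc p} (step {p} e r) λ ())
      recognise fuel (false ∷ false ∷ u) {p} le e (r , r′ , rs) with index-or-stuck u (step {suc p} (step {p} e r) r′) rs
      ... | inj₁ (x , u′ , refl) = inj₁ (var (ℕᵇ.toℕ x) , u′ ,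
              cong (λ x → false ∷ false ∷ encodeIndex x ++ u′) (sym (ℕᵇ.fromℕ-toℕ x)))
      ... | inj₂ s = inj₂ (later (shift₂ u p) s)
      recognise (suc fuel) (false ∷ true ∷ u) {p} (s≤s le) e (r , r′ , rs)
        with recognise fuel u (ℕ.≤-trans (ℕ.n≤1+n _) le) (step {suc p} (step {p} e r) r′) rs
      ... | inj₁ (t , u′ , refl) = inj₁ (not t , u′ , refl)
      ... | inj₂ s = inj₂ (later (shift₂ u p) s)
      recognise (suc fuel) (true ∷ false ∷ u) {p} {σ} {v} (s≤s le) e (r , r′ , rs)
        with recognise-two fuel u {b = notᵇ σ} {g (1 ℕ.+ p)} {σ} {v} (ℕ.≤-trans (ℕ.n≤1+n _) le) (step {suc p} (step {p} e r) r′) rs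
      ... | inj₁ (s , t , u′ , refl) = inj₁ ((s and t) , u′ ,
              cong (λ z → true ∷ false ∷ z) (sym (++-assoc (encode s) (encode t) u′)))
      ... | inj₂ s = inj₂ (later (shift₂ u p) s)
      recognise fuel (true ∷ true ∷ []) {p} le e (r , r′ , _) =
        inj₂ (stuck-at {2 ℕ.+ p} (step {suc p} (step {p} e r) r′) λ ())
      recognise (suc fuel) (true ∷ true ∷ false ∷ u) {p} {σ} {v} (s≤s le) e (r , r′ , r″ , rs)
        with recognise-two fuel u {b = σ} {g (2 ℕ.+ p)} {σ} {v} (ℕ.≤-trans (ℕ.n≤1+n _) (ℕ.≤-trans (ℕ.n≤1+n _) le))
               (step {2 ℕ.+ p} (step {suc p} (step {p} e r) r′) r″) rs
      ... | inj₁ (s , t , u′ , refl) = inj₁ ((s or t) , u′ ,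
              cong (λ z → true ∷ true ∷ false ∷ z) (sym (++-assoc (encode s) (encode t) u′)))
      ... | inj₂ s = inj₂ (later (trans (ℕ.+-suc (length u) (2 ℕ.+ p)) (cong suc (shift₂ u p))) s)
      recognise fuel (true ∷ true ∷ true ∷ []) {p} le e (r , r′ , r″ , _) =
        inj₂ (stuck-at {3 ℕ.+ p} (step {2 ℕ.+ p} (step {suc p} (step {p} e r) r′) r″) λ ())
      recognise fuel (true ∷ true ∷ true ∷ false ∷ u) le e _ = inj₁ (bottom , u , refl)
      recognise fuel (true ∷ true ∷ true ∷ true ∷ u)  le e _ = inj₁ (top , u , refl)

      pop-empty : ∀ a → stack a ≡ [] → mode (pop a) ≡ done
      pop-empty (conf _ _ _ _ _ []) refl = refl

    spread⇒done : ∀ t → Reads word 0 (encode t) → Spread Always (λ _ → ⊤) true t 0 (g 0) g → Done (width t)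
    spread⇒done t r sp with parse t refl r
    ... | inj₁ ((a , e , s) , _) = pop a , subst (λ k → trace k ≡ just (pop a)) (ℕ.+-identityʳ (width t)) e , pop-empty a s
    ... | inj₂ (_ , ns)          = ⊥-elim (ns sp)

    done⇒spread : ∀ t → Reads word 0 (encode t) → Done (width t) → Spread AtLeaf Silent true t 0 (g 0) g
    done⇒spread t r d with parse t refl r
    ... | inj₁ (_ , sp)  = sp
    ... | inj₂ (dead , _) = ⊥-elim (dead-stuck (width t ℕ.+ 0) dead (subst Done (sym (ℕ.+-identityʳ (width t))) d))

    done⇒encoding : ∀ u → Reads word 0 u → Done (length u) → ∃ λ t → u ≡ encode t
    done⇒encoding u r d with recognise (length u) u ℕ.≤-refl refl r
    ... | inj₂ s = ⊥-elim (s (subst Done (sym (ℕ.+-identityʳ (length u))) d))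
    ... | inj₁ (t , [] , e)     = t , trans e (++-[] (encode t))
      where
      ++-[] : ∀ (u : List Bool) → u ++ [] ≡ u
      ++-[] []      = refl
      ++-[] (b ∷ u) = cong (b ∷_) (++-[] u)
    ... | inj₁ (t , b ∷ u′ , refl) with (r₁ , r₂) ← reads-++ 0 (encode t) r with parse t refl r₁
    ...   | inj₂ (dead , _) = ⊥-elim (dead-stuck (suc (length u′) ℕ.+ (width t ℕ.+ 0)) (trace-dead (suc (length u′)) (width t ℕ.+ 0) dead) (subst Done longer d))
      where
      longer : length (encode t ++ b ∷ u′) ≡ suc (length u′) ℕ.+ (width t ℕ.+ 0)
      longer = trans (length-++ (encode t)) (trans (ℕ.+-comm (width t) _) (cong (suc (length u′) ℕ.+_) (sym (ℕ.+-identityʳ _))))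
    ...   | inj₁ ((a , e , s) , _) = ⊥-elim (dead-stuck (length u′ ℕ.+ suc (width t ℕ.+ 0)) (trace-dead (length u′) (suc (width t ℕ.+ 0)) halted) (subst Done longer d))
      where
      longer : length (encode t ++ b ∷ u′) ≡ length u′ ℕ.+ suc (width t ℕ.+ 0)
      longer = trans (length-++ (encode t)) (trans (ℕ.+-comm (width t) _) (trans (cong (suc (length u′) ℕ.+_) (sym (ℕ.+-identityʳ _)))
        (sym (ℕ.+-suc (length u′) _))))
      δ-done : ∀ b x a → mode a ≡ done → δ b x a ≡ nothing
      δ-done false x (conf done _ _ _ _ _) refl = refl
      δ-done true  x (conf done _ _ _ _ _) refl = refl
      halted : trace (suc (width t ℕ.+ 0)) ≡ nothing
      halted = trans (trace-step {width t ℕ.+ 0} e) (δ-done (word (width t ℕ.+ 0)) (g (width t ℕ.+ 0)) (pop a) (pop-empty a s))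

-- Orthogonal projection and Gram-Schmidt over an ordered field

module LinearAlgebra (em : ∀ {ℓ} → ExcludedMiddle ℓ) (K : OrderedField) where

  open import Data.Empty using (⊥; ⊥-elim)
  open import Data.Fin.Base using (Fin; zero; suc)
  open import Data.Integer.Base using (+_)
  open import Data.Nat.Base using (ℕ; zero; suc)
  open import Data.Product.Base using (∃; _×_; _,_; proj₁; proj₂)
  open import Data.Vec.Functional using (Vector; []; _∷_; head; tail)
  open import Function.Base using (id; _∘_)
  open import Relation.Nullary.Decidable.Core using (yes; no)
  open import Relation.Nullary.Negation.Core using (¬_)
  open import Relation.Unary using (_∈_)

  open OrderedField K hiding (zero)
  open OrderedFieldProperties K using (sum; sum-cong-≋; ∑-distrib-+; sum²≈0; inverse; inverseʳ; solve; _:=_; _:+_; _:*_; _:-_; :-_; con)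
  open import Algebra.Properties.Semiring.Sum semiring using (*-distribˡ-sum)
  open import Relation.Binary.Reasoning.Setoid setoid

  private
    variable
      d m : ℕ

  infix  4 _≋_
  infixl 6 _⊕_ _⊖_
  infixr 7 _⊙_

  Vect : ℕ → Set
  Vect d = Vector Carrier d

  _≋_ : Vect d → Vect d → Set
  x ≋ y = ∀ i → x i ≈ y i

  𝟎 : Vect d
  𝟎 _ = 0#

  _⊕_ _⊖_ : Vect d → Vect d → Vect d
  (x ⊕ y) i = x i + y i
  (x ⊖ y) i = x i - y i

  _⊙_ : Carrier → Vect d → Vect d
  (c ⊙ x) i = c * x i

  Sub : ℕ → Set₁
  Sub d = Subspace (OrderedField.commutativeRing K) id d

  open Subspace

  dot : Vect d → Vect d → Carrier
  dot x y = sum (λ i → x i * y i)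

  dot-cong : ∀ {x x′ y y′ : Vect d} → x ≋ x′ → y ≋ y′ → dot x y ≈ dot x′ y′
  dot-cong p q = sum-cong-≋ (λ i → *-cong (p i) (q i))

  dot-congˡ : ∀ (x : Vect d) {y y′} → y ≋ y′ → dot x y ≈ dot x y′
  dot-congˡ x = dot-cong {x = x} (λ _ → refl)

  dot-comm : ∀ (x y : Vect d) → dot x y ≈ dot y x
  dot-comm x y = sum-cong-≋ (λ i → *-comm (x i) (y i))

  dot-+ : ∀ (x y z : Vect d) → dot x (y ⊕ z) ≈ dot x y + dot x z
  dot-+ x y z = trans (sum-cong-≋ (λ i → distribˡ (x i) (y i) (z i))) (∑-distrib-+ (λ i → x i * y i) (λ i → x i * z i))

  dot-* : ∀ c (x y : Vect d) → dot x (c ⊙ y) ≈ c * dot x y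
  dot-* c x y = trans (sum-cong-≋ (λ i → solve 3 (λ c x y → x :* (c :* y) := c :* (x :* y)) refl c (x i) (y i)))
    (sym (*-distribˡ-sum c (λ i → x i * y i)))

  dot-0 : ∀ (x : Vect d) → dot x 𝟎 ≈ 0#
  dot-0 x = trans (dot-congˡ x {𝟎} {0# ⊙ 𝟎} (λ _ → sym (zeroˡ 0#))) (trans (dot-* 0# x 𝟎) (zeroˡ _))

  dot-- : ∀ (x y z : Vect d) → dot x (y ⊖ z) ≈ dot x y - dot x z
  dot-- x y z = begin
    dot x (y ⊖ z)                    ≈⟨ dot-congˡ x (λ i → solve 2 (λ y z → y :- z := y :+ (:- con (+ 1)) :* z) refl (y i) (z i)) ⟩
    dot x (y ⊕ (- 1# ⊙ z))          ≈⟨ dot-+ x y (- 1# ⊙ z) ⟩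
    dot x y + dot x (- 1# ⊙ z)       ≈⟨ +-congˡ (dot-* (- 1#) x z) ⟩
    dot x y + - 1# * dot x z          ≈⟨ solve 2 (λ y z → y :+ (:- con (+ 1)) :* z := y :- z) refl (dot x y) (dot x z) ⟩
    dot x y - dot x z                 ∎

  dot-positive : ∀ (x : Vect d) → dot x x ≈ 0# → x ≋ 𝟎
  dot-positive = sum²≈0

  -‿closed : ∀ (A : Sub d) {x y} → x ∈ member A → y ∈ member A → (x ⊖ y) ∈ member A
  -‿closed A {x} {y} p q = resp A (λ i → solve 2 (λ x y → x :+ (:- con (+ 1)) :* y := x :- y) refl (x i) (y i))
    (+-closed A p (*-closed A (- 1#) q))

  private
    tailSpace : Sub (suc d) → Sub d
    tailSpace A = record
      { member   = λ x → (0# ∷ x) ∈ member A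
      ; resp     = λ e → resp A (λ { zero → refl ; (suc i) → e i })
      ; 0∈       = resp A (λ { zero → refl ; (suc i) → refl }) (0∈ A)
      ; +-closed = λ p q → resp A (λ { zero → +-identityˡ 0# ; (suc i) → refl }) (+-closed A p q)
      ; *-closed = λ c p → resp A (λ { zero → zeroʳ c ; (suc i) → refl }) (*-closed A c p)
      }

    dot-0∷ : ∀ (x : Vect d) (y : Vect (suc d)) → dot (0# ∷ x) y ≈ dot x (tail y)
    dot-0∷ x y = trans (+-congʳ (zeroˡ _)) (+-identityˡ _)

  -- Subspaces are given as predicates, without a basis, so the induction is on the dimension of the
  -- surrounding space. Excluded middle decides whether some vector of `A` has a nonzero first
  -- coordinate; if so, `A` is the orthogonal sum of the line of one such vector and of the part
  -- with first coordinate zero.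
  projection : ∀ (A : Sub d) v → ∃ λ a → a ∈ member A × (∀ {x} → x ∈ member A → dot x (v ⊖ a) ≈ 0#)
  projection {zero}  A v = 𝟎 , 0∈ A , λ _ → refl
  projection {suc d} A v with em {P = ∃ λ u → u ∈ member A × head u ≉ 0#}
  ... | no all0 =
    let (a , a∈ , ⊥a) = projection (tailSpace A) (tail v)
    in (0# ∷ a) , a∈ , λ {x} x∈ →
      let x₀≈0 : head x ≈ 0#
          x₀≈0 = vanishes x x∈
      in begin
        head x * (head v - 0#) + dot (tail x) (tail v ⊖ a)   ≈⟨ +-cong (trans (*-congʳ x₀≈0) (zeroˡ _))
                                                                  (⊥a (resp A (λ { zero → x₀≈0 ; (suc i) → refl }) x∈)) ⟩
        0# + 0#                                                ≈⟨ +-identityˡ 0# ⟩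
        0#                                                     ∎
    where
    vanishes : ∀ x → x ∈ member A → head x ≈ 0#
    vanishes x x∈ with head x ≟ 0#
    ... | yes e = e
    ... | no ne = ⊥-elim (all0 (x , x∈ , ne))
  ... | yes (u , u∈ , u₀≉0) = a , a∈ , orthogonal
    where
    T = tailSpace A
    a₀ = proj₁ (projection T (tail u))
    -- Subtracting from `u` its projection to `T` makes it orthogonal to `T` and keeps its first
    -- coordinate, so `w` spans the line in question.
    w = u ⊖ (0# ∷ a₀)
    w∈ : w ∈ member A
    w∈ = -‿closed A u∈ (proj₁ (proj₂ (projection T (tail u))))
    w₀≈u₀ : head w ≈ head u
    w₀≈u₀ = trans (+-congˡ -0#≈0#) (+-identityʳ _)
      where open import Algebra.Properties.Ring ring
    w₀≉0 : head w ≉ 0#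
    w₀≉0 e = u₀≉0 (trans (sym w₀≈u₀) e)
    w⊥T : ∀ {y} → y ∈ member T → dot (0# ∷ y) w ≈ 0#
    w⊥T {y} y∈ = trans (dot-0∷ y w) (proj₂ (proj₂ (projection T (tail u))) y∈)
    ww≉0 : dot w w ≉ 0#
    ww≉0 e = w₀≉0 (dot-positive w e zero)
    -- The Fourier coefficient of `v` along `w`; the remainder `r` is then projected to `T`.
    c = dot w v * inverse ww≉0
    r = v ⊖ (c ⊙ w)
    w⊥r : dot w r ≈ 0#
    w⊥r = begin
      dot w r                                     ≈⟨ dot-- w v (c ⊙ w) ⟩
      dot w v - dot w (c ⊙ w)                    ≈⟨ +-congˡ (-‿cong (dot-* c w w)) ⟩
      dot w v - dot w v * inverse ww≉0 * dot w w  ≈⟨ solve 3 (λ a b c → a :- a :* b :* c := a :- a :* (c :* b)) refl (dot w v) (inverse ww≉0) (dot w w) ⟩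
      dot w v - dot w v * (dot w w * inverse ww≉0) ≈⟨ +-congˡ (-‿cong (*-congˡ (inverseʳ ww≉0))) ⟩
      dot w v - dot w v * 1#                      ≈⟨ +-congˡ (-‿cong (*-identityʳ _)) ⟩
      dot w v - dot w v                           ≈⟨ -‿inverseʳ _ ⟩
      0#                                          ∎
    a₁ = proj₁ (projection T (tail r))
    a₁∈ = proj₁ (proj₂ (projection T (tail r)))
    a = (c ⊙ w) ⊕ (0# ∷ a₁)
    a∈ : a ∈ member A
    a∈ = +-closed A (*-closed A c w∈) a₁∈
    s = r ⊖ (0# ∷ a₁)
    w⊥s : dot w s ≈ 0#
    w⊥s = trans (dot-- w r (0# ∷ a₁)) (trans (+-cong w⊥r (-‿cong (trans (dot-comm w (0# ∷ a₁)) (w⊥T a₁∈)))) (-‿inverseʳ 0#))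
    orthogonal : ∀ {x} → x ∈ member A → dot x (v ⊖ a) ≈ 0#
    orthogonal {x} x∈ = begin
      dot x (v ⊖ a)                      ≈⟨ dot-cong x≋ (λ i → solve 3 (λ v c a → v :- (c :+ a) := v :- c :- a) refl (v i) (c * w i) ((0# ∷ a₁) i)) ⟩
      dot ((k ⊙ w) ⊕ (0# ∷ x′)) s       ≈⟨ trans (dot-comm ((k ⊙ w) ⊕ (0# ∷ x′)) s) (trans (dot-+ s (k ⊙ w) (0# ∷ x′)) (+-cong (dot-* k s w) (dot-comm s (0# ∷ x′)))) ⟩
      k * dot s w + dot (0# ∷ x′) s       ≈⟨ +-cong (*-congˡ (trans (dot-comm s w) w⊥s)) (trans (dot-0∷ x′ s) (proj₂ (proj₂ (projection T (tail r))) x′∈)) ⟩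
      k * 0# + 0#                         ≈⟨ trans (+-congʳ (zeroʳ k)) (+-identityˡ 0#) ⟩
      0#                                  ∎
      where
      -- Chosen to cancel the first coordinate, so that `x` becomes a multiple of `w` plus a vector
      -- of `T`.
      k = head x * inverse w₀≉0
      y = x ⊖ (k ⊙ w)
      x′ = tail y
      y₀≈0 : head y ≈ 0#
      y₀≈0 = begin
        head x - head x * inverse w₀≉0 * head w   ≈⟨ solve 3 (λ a b c → a :- a :* b :* c := a :- a :* (c :* b)) refl (head x) (inverse w₀≉0) (head w) ⟩
        head x - head x * (head w * inverse w₀≉0) ≈⟨ +-congˡ (-‿cong (trans (*-congˡ (inverseʳ w₀≉0)) (*-identityʳ _))) ⟩
        head x - head x                           ≈⟨ -‿inverseʳ _ ⟩
        0#                                        ∎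
      y≋ : y ≋ (0# ∷ x′)
      y≋ zero    = y₀≈0
      y≋ (suc i) = refl
      x′∈ : (0# ∷ x′) ∈ member A
      x′∈ = resp A {y} {0# ∷ x′} y≋ (-‿closed A x∈ (*-closed A k w∈))
      x≋ : x ≋ ((k ⊙ w) ⊕ (0# ∷ x′))
      x≋ i = trans (solve 2 (λ x c → x := c :+ (x :- c)) refl (x i) (k * w i)) (+-congˡ (y≋ i))

  module _ (A : Sub d) where

    private
      A⊥ = _⊥ₛ (OrderedField.commutativeRing K) id d A

    ⊆⊥⊥ : ∀ {v} → v ∈ member A → v ∈ member (_⊥ₛ (OrderedField.commutativeRing K) id d A⊥)
    ⊆⊥⊥ {v} v∈ {x} x∈ = trans (dot-comm x v) (x∈ v∈)

    -- The component b of v orthogonal to A is orthogonal to v and to v - b, hence to itself.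
    ⊥⊥⊆ : ∀ {v} → v ∈ member (_⊥ₛ (OrderedField.commutativeRing K) id d A⊥) → v ∈ member A
    ⊥⊥⊆ {v} v∈ =
      let (a , a∈ , ⊥a) = projection A v
          b = v ⊖ a
          bb≈0 = trans (dot-- b v a) (trans (+-cong (v∈ {b} ⊥a) (-‿cong (trans (dot-comm b a) (⊥a a∈)))) (-‿inverseʳ 0#))
      in resp A (λ i → trans (sym (+-identityʳ (a i))) (trans (+-congˡ (sym (dot-positive b bb≈0 i)))
           (solve 2 (λ a v → a :+ (v :- a) := v) refl (a i) (v i)))) a∈

  -- Let c be the projection of `v` to the sum of the orthocomplements. The remainder is orthogonal
  -- to both of them, so by `⊥⊥⊆` it lies in the intersection. Hence it is orthogonal to `v`, and
  -- also to c, so to itself, and vanishes.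
  ∩⊥⊆⊥+⊥ : ∀ (A B : Sub d) {v} → v ∈ member (_⊥ₛ (OrderedField.commutativeRing K) id d (_∩ₛ_ (OrderedField.commutativeRing K) id d A B)) →
    ∃ λ x → x ∈ member (_⊥ₛ (OrderedField.commutativeRing K) id d A) × (v ⊖ x) ∈ member (_⊥ₛ (OrderedField.commutativeRing K) id d B)
  ∩⊥⊆⊥+⊥ {d} A B {v} v∈ with projection (_+ₛ_ (OrderedField.commutativeRing K) id d (_⊥ₛ (OrderedField.commutativeRing K) id d A) (_⊥ₛ (OrderedField.commutativeRing K) id d B)) v
  ... | c , c∈@(x , y , x∈ , y∈ , c≋) , ⊥c = x , x∈ , resp B⊥ v-x y∈
    where
    A⊥ = _⊥ₛ (OrderedField.commutativeRing K) id d A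
    B⊥ = _⊥ₛ (OrderedField.commutativeRing K) id d B
    e = v ⊖ c
    e∈A : e ∈ member A
    e∈A = ⊥⊥⊆ A λ {z} z∈ → ⊥c (z , 𝟎 , (λ {y} → z∈ {y}) , (λ {y} _ → dot-0 y) , λ i → sym (+-identityʳ (z i)))
    e∈B : e ∈ member B
    e∈B = ⊥⊥⊆ B λ {z} z∈ → ⊥c (𝟎 , z , (λ {y} _ → dot-0 y) , (λ {y} → z∈ {y}) , λ i → sym (+-identityˡ (z i)))
    ee≈0 : dot e e ≈ 0#
    ee≈0 = trans (dot-- e v c) (trans (+-cong (v∈ (e∈A , e∈B)) (-‿cong (trans (dot-comm e c) (⊥c c∈)))) (-‿inverseʳ 0#))
    v-x : y ≋ (v ⊖ x)
    v-x i = begin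
      y i               ≈⟨ solve 3 (λ v x y → y := v :- x :- (v :- (x :+ y))) refl (v i) (x i) (y i) ⟩
      v i - x i - (v i - (x i + y i)) ≈⟨ +-congˡ (-‿cong (+-congˡ (-‿cong (c≋ i)))) ⟨
      v i - x i - e i   ≈⟨ +-congˡ (-‿cong (dot-positive e ee≈0 i)) ⟩
      v i - x i - 0#    ≈⟨ solve 1 (λ z → z :- con (+ 0) := z) refl (v i - x i) ⟩
      v i - x i         ∎

  -- Closure under differences without scalar multiples is enough here, as spreads combine vectors
  -- only by `_⊖_`.
  data Span {m} (g : Vector (Vect d) m) : Vect d → Set where
    generator : ∀ i → Span g (g i)
    origin    : Span g 𝟎
    minus     : ∀ {x y} → Span g x → Span g y → Span g (x ⊖ y)
    respects  : ∀ {x y} → x ≋ y → Span g x → Span g y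

  Pythagorean : Set
  Pythagorean = ∀ {n} (x : Vect n) → ∃ λ y → dot x x ≈ y * y

  -- The map respects differences everywhere, but preserves inner products only on the span, since
  -- the orthonormal system need not reach further.
  record Isometry (g : Vector (Vect d) m) : Set where
    field
      map       : Vect d → Vect m
      map-cong  : ∀ {x y} → x ≋ y → map x ≋ map y
      map--     : ∀ x y → map (x ⊖ y) ≋ (map x ⊖ map y)
      isometric : ∀ {x y} → Span g x → Span g y → dot (map x) (map y) ≈ dot x y

  module _ (pythagorean : Pythagorean) where

    private
      -- The vector `e` is `g` normalised, or zero if `g` is. The equation says that `dot e e` acts
      -- as 1 on all coefficients in either case, so dependent generators need not be discarded and
      -- there is one coordinate for each generator.
      unit : ∀ {d} (g : Vect d) → ∃ λ e → (∀ x → dot e e * dot e x ≈ dot e x) × (g ≋ (dot e g ⊙ e))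
      unit {d} g with pythagorean g
      ... | r , gg≈rr with r ≟ 0#
      ...   | yes r≈0 = 𝟎 , (λ x → trans (*-cong (dot-0 {d} 𝟎) (trans (dot-comm 𝟎 x) (dot-0 x))) (trans (zeroˡ 0#) (sym (trans (dot-comm 𝟎 x) (dot-0 x))))) ,
        λ i → trans (dot-positive g (trans gg≈rr (trans (*-congʳ r≈0) (zeroˡ r))) i) (sym (zeroʳ _))
      ...   | no r≉0 = e , (λ x → trans (*-congʳ ee≈1) (*-identityˡ _)) , λ i → begin
          g i                                ≈⟨ *-identityˡ (g i) ⟨
          1# * g i                           ≈⟨ *-congʳ (inverseʳ r≉0) ⟨
          r * h * g i                        ≈⟨ *-assoc r h (g i) ⟩
          r * (h * g i)                      ≈⟨ *-congʳ eg≈r ⟨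
          dot e g * (h * g i)                ∎
        where
        h = inverse r≉0
        e = h ⊙ g
        eg≈r : dot e g ≈ r
        eg≈r = trans (dot-comm e g) (trans (dot-* h g g) (trans (*-congˡ gg≈rr)
          (trans (solve 2 (λ h r → h :* (r :* r) := r :* h :* r) refl h r) (trans (*-congʳ (inverseʳ r≉0)) (*-identityˡ r)))))
        ee≈1 : dot e e ≈ 1#
        ee≈1 = trans (dot-* h e g) (trans (*-congˡ eg≈r) (trans (*-comm h r) (inverseʳ r≉0)))

      span-empty : ∀ {g : Vector (Vect d) 0} {x} → Span g x → x ≋ 𝟎
      span-empty origin         i = refl
      span-empty (minus p q)    i = trans (+-cong (span-empty p i) (-‿cong (span-empty q i))) (-‿inverseʳ 0#)
      span-empty (respects e p) i = trans (sym (e i)) (span-empty p i)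

    -- Gram–Schmidt: the coordinates with respect to an orthonormal basis of the span.
    isometry : ∀ (g : Vector (Vect d) m) → Isometry g
    isometry {m = zero} g = record
      { map = λ _ → [] ; map-cong = λ _ () ; map-- = λ _ _ ()
      ; isometric = λ {x} {y} _ q → sym (trans (dot-congˡ x (span-empty q)) (dot-0 x)) }
    isometry {d} {suc m} g with unit (g zero)
    ... | e , idem , g₀≋ = record
      { map       = λ x → dot e x ∷ I.map (P x)
      ; map-cong  = λ {x} {y} x≋y → λ { zero → dot-congˡ e x≋y ; (suc i) → I.map-cong (P-cong x≋y) i }
      ; map--     = λ x y → λ { zero → dot-- e x y ; (suc i) → trans (I.map-cong (P-- x y) i) (I.map-- (P x) (P y) i) }
      ; isometric = λ {x} {y} p q → trans (+-congˡ (I.isometric (P-span p) (P-span q))) (sym (decompose x y))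
      }
      where
      P : Vect d → Vect d
      P x = x ⊖ (dot e x ⊙ e)
      module I = Isometry (isometry (λ i → P (g (suc i))))
      P-cong : ∀ {x y} → x ≋ y → P x ≋ P y
      P-cong x≋y i = +-cong (x≋y i) (-‿cong (*-congʳ (dot-congˡ e x≋y)))
      P-- : ∀ x y → P (x ⊖ y) ≋ (P x ⊖ P y)
      P-- x y i = trans (+-congˡ (-‿cong (*-congʳ (dot-- e x y))))
        (solve 5 (λ x y a b e → x :- y :- (a :- b) :* e := x :- a :* e :- (y :- b :* e)) refl (x i) (y i) (dot e x) (dot e y) (e i))
      P-span : ∀ {x} → Span g x → Span (λ i → P (g (suc i))) (P x)
      P-span (generator zero)    = respects (λ i → sym (trans (+-congʳ (g₀≋ i)) (-‿inverseʳ _))) origin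
      P-span (generator (suc i)) = generator i
      P-span origin              = respects (λ i → sym (trans (+-congˡ (-‿cong (trans (*-congʳ (dot-0 e)) (zeroˡ _)))) (-‿inverseʳ 0#))) origin
      P-span (minus {x} {y} p q) = respects (λ i → sym (P-- x y i)) (minus (P-span p) (P-span q))
      P-span (respects x≋y p)    = respects (P-cong x≋y) (P-span p)
      -- The theorem of Pythagoras for the parts along `e` and the remainders; `idem` makes the
      -- extra terms cancel even if `e` is zero.
      decompose : ∀ x y → dot x y ≈ dot e x * dot e y + dot (P x) (P y)
      decompose x y = sym (begin
        ex * ey + dot (P x) (P y)              ≈⟨ +-congˡ (dot-- (P x) y (ey ⊙ e)) ⟩
        ex * ey + (dot (P x) y - dot (P x) (ey ⊙ e)) ≈⟨ +-congˡ (+-cong (P· y) (-‿cong (trans (dot-* ey (P x) e) (*-congˡ (P· e))))) ⟩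
        ex * ey + (dot x y - ex * ey - ey * (dot x e - ex * dot e e)) ≈⟨ +-congˡ (+-congˡ (-‿cong (*-congˡ (+-cong (dot-comm x e) (-‿cong (trans (*-comm ex _) (idem x))))))) ⟩
        ex * ey + (dot x y - ex * ey - ey * (ex - ex)) ≈⟨ solve 3 (λ a b c → a :* b :+ (c :- a :* b :- b :* (a :- a)) := c) refl ex ey (dot x y) ⟩
        dot x y                                ∎)
        where
        ex = dot e x
        ey = dot e y
        P· : ∀ z → dot (P x) z ≈ dot x z - ex * dot e z
        P· z = trans (dot-comm (P x) z) (trans (dot-- z x (ex ⊙ e))
          (+-cong (dot-comm z x) (-‿cong (trans (dot-* ex z e) (*-congˡ (dot-comm z e))))))

-- Transfer of satisfiability between lattices of subspaces

module _ (F : CommutativeRing 0ℓ 0ℓ) (conj : Op₁ (CommutativeRing.Carrier F)) (t : Term) where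

  -- Records, because comparing two unfolded subspace ortholattices is slow.
  record Weak* : Set₁ where
    constructor weak*
    field
      dimension   : ℕ
      nonZero     : NonZero dimension
      satisfiable : WeaklySatisfiable (subspaceOrtholattice F conj dimension) t

  record Strong* : Set₁ where
    constructor strong*
    field
      dimension   : ℕ
      nonZero     : NonZero dimension
      satisfiable : StronglySatisfiable (subspaceOrtholattice F conj dimension) t

module LatticeTransfer
  (F : CommutativeRing 0ℓ 0ℓ) (conj : Op₁ (CommutativeRing.Carrier F)) (d : ℕ)
  (K : CommutativeRing 0ℓ 0ℓ) (conj′ : Op₁ (CommutativeRing.Carrier K)) (d′ : ℕ)
  where

  open import Data.Product.Base using (proj₁; proj₂)
  open import Data.Unit.Base using (tt)
  open import Function.Bundles using (_⇔_; mk⇔; Equivalence)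
  open import Relation.Unary using (_∈_)

  private
    module F = CommutativeRing F
    module K = CommutativeRing K
    L = subspaceOrtholattice F conj d
    L′ = subspaceOrtholattice K conj′ d′
    VF = V F conj d
    VK = V K conj′ d′
    SF = Subspace F conj d
    SK = Subspace K conj′ d′

  open Subspace

  infix 4 _≋_ _≋′_
  _≋_ : VF → VF → Set
  x ≋ y = ∀ i → x i F.≈ y i
  _≋′_ : VK → VK → Set
  x ≋′ y = ∀ i → x i K.≈ y i

  module _ {I : Set} (i₀ : I) (φ : I → VF → VK)
    (φ-cong : ∀ k {x y} → x ≋ y → φ k x ≋′ φ k y)
    (φ-injective : ∀ {x y} → (∀ k → φ k x ≋′ φ k y) → x ≋ y)
    (φ-+ : ∀ k x y → φ k (λ i → x i F.+ y i) ≋′ (λ i → φ k x i K.+ φ k y i))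
    (φ-0 : ∀ k → φ k (λ _ → F.0#) ≋′ (λ _ → K.0#))
    (φ-onto : ∀ (f : I → VK) → ∃ λ x → ∀ k → φ k x ≋′ f k)
    where

    -- A single map suffices for restriction of scalars. Complexification has two, the real and the
    -- imaginary part, and both have to land in the same `B`.
    Matches : SF → SK → Set
    Matches A B = ∀ x → x ∈ member A ⇔ (∀ k → φ k x ∈ member B)

    module _ (⊥-matches : ∀ {A B} → Matches A B → Matches (_⊥ₛ F conj d A) (_⊥ₛ K conj′ d′ B))
             (a : ℕ → SF) (b : ℕ → SK) (a~b : ∀ n → Matches (a n) (b n)) where

      open Equivalence

      ⟦⟧-matches : ∀ t → Matches (⟦_⟧ L t a) (⟦_⟧ L′ t b)
      ⟦⟧-matches (var n)   = a~b n
      ⟦⟧-matches bottom    = λ x → mk⇔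
        (λ x≋0 k i → K.trans (φ-cong k x≋0 i) (φ-0 k i))
        (λ e → φ-injective λ k i → K.trans (e k i) (K.sym (φ-0 k i)))
      ⟦⟧-matches top       = λ x → mk⇔ (λ _ _ → tt) (λ _ → tt)
      ⟦⟧-matches (not t)   = ⊥-matches {⟦_⟧ L t a} {⟦_⟧ L′ t b} (⟦⟧-matches t)
      ⟦⟧-matches (s and t) = λ x → mk⇔
        (λ (p , q) k → to (⟦⟧-matches s x) p k , to (⟦⟧-matches t x) q k)
        (λ f → from (⟦⟧-matches s x) (λ k → proj₁ (f k)) , from (⟦⟧-matches t x) (λ k → proj₂ (f k)))
      ⟦⟧-matches (s or t)  = λ x → mk⇔
        (λ (y , z , y∈ , z∈ , e) k → φ k y , φ k z , to (⟦⟧-matches s y) y∈ k , to (⟦⟧-matches t z) z∈ k ,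
           λ i → K.trans (φ-cong k e i) (φ-+ k y z i))
        λ f →
          -- There is one decomposition for each `k`; joint surjectivity assembles them into a
          -- decomposition over F.
          let (y , ye) = φ-onto (λ k → proj₁ (f k))
              (z , ze) = φ-onto (λ k → proj₁ (proj₂ (f k)))
          in y , z ,
             from (⟦⟧-matches s y) (λ k → resp (⟦_⟧ L′ s b) (λ i → K.sym (ye k i)) (proj₁ (proj₂ (proj₂ (f k))))) ,
             from (⟦⟧-matches t z) (λ k → resp (⟦_⟧ L′ t b) (λ i → K.sym (ze k i)) (proj₁ (proj₂ (proj₂ (proj₂ (f k)))))) ,
             φ-injective λ k i → K.trans (proj₂ (proj₂ (proj₂ (proj₂ (f k)))) i)
               (K.sym (K.trans (φ-+ k y z i) (K.+-cong (ye k i) (ze k i))))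

      0-matches : ∀ t → RawOrtholattice._≈_ L (⟦_⟧ L t a) (RawOrtholattice.0# L) ⇔
                        RawOrtholattice._≈_ L′ (⟦_⟧ L′ t b) (RawOrtholattice.0# L′)
      0-matches t = mk⇔
        (λ (⊆0 , _) → (λ {u} u∈ i →
            let (x , xe) = φ-onto (λ _ → u)
                x≋0 = ⊆0 (from (⟦⟧-matches t x) λ k → resp (⟦_⟧ L′ t b) (λ i → K.sym (xe k i)) u∈)
            in K.trans (K.sym (xe i₀ i)) (K.trans (φ-cong i₀ x≋0 i) (φ-0 i₀ i))) ,
          λ e → resp (⟦_⟧ L′ t b) (λ i → K.sym (e i)) (0∈ (⟦_⟧ L′ t b)))
        (λ (⊆0 , _) → (λ {x} x∈ → φ-injective λ k i → K.trans (⊆0 (to (⟦⟧-matches t x) x∈ k) i) (K.sym (φ-0 k i))) ,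
          λ e → resp (⟦_⟧ L t a) (λ i → F.sym (e i)) (0∈ (⟦_⟧ L t a)))

      1-matches : ∀ t → RawOrtholattice._≈_ L (⟦_⟧ L t a) (RawOrtholattice.1# L) ⇔
                        RawOrtholattice._≈_ L′ (⟦_⟧ L′ t b) (RawOrtholattice.1# L′)
      1-matches t = mk⇔
        (λ (_ , ⊇1) → (λ _ → tt) , λ {u} _ →
            let (x , xe) = φ-onto (λ _ → u)
            in resp (⟦_⟧ L′ t b) (xe i₀) (to (⟦⟧-matches t x) (⊇1 tt) i₀))
        (λ (_ , ⊇1) → (λ _ → tt) , λ {x} _ → from (⟦⟧-matches t x) λ k → ⊇1 tt)

-- F seen through two coordinates in K. This treats different presentations of the real field at
-- once; `kind` records the standing assumption: imaginary parts vanish, or all pairs of coordinates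
-- occur.
record StarExtension (K F : CommutativeRing 0ℓ 0ℓ) (conj : Op₁ (CommutativeRing.Carrier F)) : Set where
  private
    module K = CommutativeRing K
    module F = CommutativeRing F
  field
    re im     : F.Carrier → K.Carrier
    re-cong   : ∀ {x y} → x F.≈ y → re x K.≈ re y
    im-cong   : ∀ {x y} → x F.≈ y → im x K.≈ im y
    injective : ∀ {x y} → re x K.≈ re y → im x K.≈ im y → x F.≈ y
    re-0      : re F.0# K.≈ K.0#
    im-0      : im F.0# K.≈ K.0#
    re-+      : ∀ x y → re (x F.+ y) K.≈ re x K.+ re y
    im-+      : ∀ x y → im (x F.+ y) K.≈ im x K.+ im y
    re-*      : ∀ x y → re (x F.* y) K.≈ re x K.* re y K.- im x K.* im y
    im-*      : ∀ x y → im (x F.* y) K.≈ re x K.* im y K.+ im x K.* re y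
    re-conj   : ∀ x → re (conj x) K.≈ re x
    im-conj   : ∀ x → im (conj x) K.≈ K.- im x
    kind      : ((∀ x → im x K.≈ K.0#) × (∀ k → ∃ λ x → re x K.≈ k)) ⊎
                (∀ k l → ∃ λ x → re x K.≈ k × im x K.≈ l)

-- Restriction of scalars and complexification

module Extension (K F : CommutativeRing 0ℓ 0ℓ) (conj : Op₁ (CommutativeRing.Carrier F)) (E : StarExtension K F conj) where

  open import Algebra.Definitions using (Congruent₁)
  import Algebra.Properties.CommutativeMonoid.Sum as Sum
  import Algebra.Properties.Ring as RingProperties
  open import Data.Bool.Base using (Bool; true; false)
  open import Data.Integer.Base using (+_)
  open import Data.Fin.Base using (Fin; zero; suc; _↑ˡ_; _↑ʳ_; splitAt)
  import Data.Fin.Properties as Fin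
  open import Data.Nat.Base as ℕ using (zero; suc)
  import Data.Nat.Properties as ℕ
  open import Data.Product.Base using (proj₁; proj₂)
  open import Data.Sum.Base using (inj₁; inj₂; [_,_])
  open import Data.Unit.Base using (⊤; tt)
  open import Data.Vec.Functional using (Vector; _++_)
  open import Data.Vec.Functional.Properties using (lookup-++ˡ; lookup-++ʳ)
  open import Function.Base using (_∘_)
  open import Function.Bundles using (_⇔_; mk⇔; Equivalence)
  open import Relation.Binary.PropositionalEquality as ≡ using (_≡_; subst₂)
  open import Relation.Unary using (_∈_)

  private
    module K = CommutativeRing K
    module F = CommutativeRing F
    module ΣK = Sum K.+-commutativeMonoid
    module ΣF = Sum F.+-commutativeMonoid
  open StarExtension E
  open IntegerRingSolver K using (solve; _:=_; _:+_; _:*_; _:-_; :-_; con)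
  open Subspace

  private
    inner : ∀ {d} → Vector F.Carrier d → Vector F.Carrier d → F.Carrier
    inner x y = ΣF.sum (λ i → conj (x i) F.* y i)

    dot : ∀ {d} → Vector K.Carrier d → Vector K.Carrier d → K.Carrier
    dot x y = ΣK.sum (λ i → x i K.* y i)

    additive-sum : ∀ (f : F.Carrier → K.Carrier) → f F.0# K.≈ K.0# → (∀ x y → f (x F.+ y) K.≈ f x K.+ f y) →
      ∀ {d} (x : Vector F.Carrier d) → f (ΣF.sum x) K.≈ ΣK.sum (f ∘ x)
    additive-sum f f0 f+ {zero}  x = f0
    additive-sum f f0 f+ {suc d} x = K.trans (f+ _ _) (K.+-congˡ (additive-sum f f0 f+ (x ∘ suc)))

    re-inner : ∀ {d} (x y : Vector F.Carrier d) → re (inner x y) K.≈ dot (re ∘ x) (re ∘ y) K.+ dot (im ∘ x) (im ∘ y)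
    re-inner x y = K.trans (additive-sum re re-0 re-+ (λ i → conj (x i) F.* y i)) (K.trans
      (ΣK.sum-cong-≋ (λ i → K.trans (re-* (conj (x i)) (y i)) (K.trans
        (K.+-cong (K.*-congʳ (re-conj (x i))) (K.-‿cong (K.*-congʳ (im-conj (x i)))))
        (solve 4 (λ a b c d → a :* c :- (:- b) :* d := a :* c :+ b :* d) K.refl (re (x i)) (im (x i)) (re (y i)) (im (y i))))))
      (ΣK.∑-distrib-+ (λ i → re (x i) K.* re (y i)) (λ i → im (x i) K.* im (y i))))

    im-inner : ∀ {d} (x y : Vector F.Carrier d) →
      im (inner x y) K.≈ dot (re ∘ x) (im ∘ y) K.+ dot (λ i → K.- im (x i)) (re ∘ y)
    im-inner x y = K.trans (additive-sum im im-0 im-+ (λ i → conj (x i) F.* y i)) (K.trans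
      (ΣK.sum-cong-≋ (λ i → K.trans (im-* (conj (x i)) (y i))
        (K.+-cong (K.*-congʳ (re-conj (x i))) (K.*-congʳ (im-conj (x i))))))
      (ΣK.∑-distrib-+ (λ i → re (x i) K.* im (y i)) (λ i → K.- im (x i) K.* re (y i))))

    dot-0ʳ : ∀ {d} (x : Vector K.Carrier d) {y} → (∀ i → y i K.≈ K.0#) → dot x y K.≈ K.0#
    dot-0ʳ {zero}  x y≋0 = K.refl
    dot-0ʳ {suc d} x y≋0 = K.trans (K.+-cong (K.trans (K.*-congˡ (y≋0 zero)) (K.zeroʳ _)) (dot-0ʳ (x ∘ suc) (y≋0 ∘ suc))) (K.+-identityʳ _)

    dot-comm : ∀ {d} (x y : Vector K.Carrier d) → dot x y K.≈ dot y x
    dot-comm x y = ΣK.sum-cong-≋ (λ i → K.*-comm (x i) (y i))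

    dot-0ˡ : ∀ {d} {x : Vector K.Carrier d} y → (∀ i → x i K.≈ K.0#) → dot x y K.≈ K.0#
    dot-0ˡ {x = x} y x≋0 = K.trans (dot-comm x y) (dot-0ʳ y x≋0)

    dot-neg : ∀ {d} (x y : Vector K.Carrier d) → dot x y K.≈ K.0# → dot (λ i → K.- x i) y K.≈ K.0#
    dot-neg {d} x y e = K.trans (go x y) (K.trans (K.-‿cong e) (RingProperties.-0#≈0# K.ring))
      where
      go : ∀ {d} (x y : Vector K.Carrier d) → dot (λ i → K.- x i) y K.≈ K.- dot x y
      go {zero}  x y = K.sym (RingProperties.-0#≈0# K.ring)
      go {suc d} x y = K.trans (K.+-congˡ (go (x ∘ suc) (y ∘ suc)))
        (solve 3 (λ a b c → (:- a) :* b :+ (:- c) := :- (a :* b :+ c)) K.refl (x zero) (y zero) (dot (x ∘ suc) (y ∘ suc)))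

    dot-cong : ∀ {d} {x x′ y y′ : Vector K.Carrier d} → (∀ i → x i K.≈ x′ i) → (∀ i → y i K.≈ y′ i) → dot x y K.≈ dot x′ y′
    dot-cong p q = ΣK.sum-cong-≋ (λ i → K.*-cong (p i) (q i))

    0+0 : ∀ {x y} → x K.≈ K.0# → y K.≈ K.0# → x K.+ y K.≈ K.0#
    0+0 p q = K.trans (K.+-cong p q) (K.+-identityʳ K.0#)

  -- The lattice of F^d embeds into that of K^e, if x ↦ φ x identifies F^d with K^e so that
  -- the real part of the inner product of F^d becomes the inner product of K^e.
  module Restriction {d e : ℕ} (φ : Vector F.Carrier d → Vector K.Carrier e)
    (φ-cong : ∀ {x y} → (∀ i → x i F.≈ y i) → ∀ i → φ x i K.≈ φ y i)
    (φ-injective : ∀ {x y} → (∀ i → φ x i K.≈ φ y i) → ∀ i → x i F.≈ y i)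
    (φ-+ : ∀ x y i → φ (λ i → x i F.+ y i) i K.≈ φ x i K.+ φ y i)
    (φ-0 : ∀ i → φ (λ _ → F.0#) i K.≈ K.0#)
    (φ-onto : ∀ (u : Vector K.Carrier e) → ∃ λ x → ∀ i → φ x i K.≈ u i)
    (φ-* : ∀ c → ∃ λ c′ → ∀ x i → φ (λ i → c′ F.* x i) i K.≈ c K.* φ x i)
    (φ-dot : ∀ x y → re (inner x y) K.≈ dot (φ x) (φ y))
    (re-⊥ : ∀ (A : Subspace F conj d) y → (∀ {x} → x ∈ member A → re (inner x y) K.≈ K.0#) →
              ∀ {x} → x ∈ member A → inner x y F.≈ F.0#)
    where

    private
      module T = LatticeTransfer F conj d K id e

      Matches : Subspace F conj d → Subspace K id e → Set
      Matches = T.Matches tt (λ _ → φ) (λ _ → φ-cong) (λ f → φ-injective (f tt)) (λ _ → φ-+) (λ _ → φ-0)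
        (λ f → let (x , xe) = φ-onto (f tt) in x , λ _ → xe)

      ⊥-matches : ∀ {A B} → Matches A B → Matches (_⊥ₛ F conj d A) (_⊥ₛ K id e B)
      ⊥-matches {A} {B} m y = mk⇔
        (λ y⊥ _ {u} u∈ →
          let (x , xe) = φ-onto u
              x∈ = Equivalence.from (m x) (λ _ → resp B (λ i → K.sym (xe i)) u∈)
          in K.trans (dot-cong (λ i → K.sym (xe i)) (λ _ → K.refl)) (K.trans (K.sym (φ-dot x y)) (K.trans (re-cong (y⊥ x∈)) re-0)))
        (λ f {x} x∈ → re-⊥ A y (λ {x} x∈ → K.trans (φ-dot x y) (f tt (Equivalence.to (m x) x∈ tt))) x∈)

      image : Subspace F conj d → Subspace K id e
      image A = record
        { member   = λ u → ∃ λ x → x ∈ member A × (∀ i → φ x i K.≈ u i)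
        ; resp     = λ u≋v (x , x∈ , xe) → x , x∈ , λ i → K.trans (xe i) (u≋v i)
        ; 0∈       = _ , 0∈ A , φ-0
        ; +-closed = λ (x , x∈ , xe) (y , y∈ , ye) → _ , +-closed A x∈ y∈ , λ i → K.trans (φ-+ x y i) (K.+-cong (xe i) (ye i))
        ; *-closed = λ c (x , x∈ , xe) → let (c′ , ce) = φ-* c in
            _ , *-closed A c′ x∈ , λ i → K.trans (ce x i) (K.*-congˡ (xe i))
        }

      image-matches : ∀ A → Matches A (image A)
      image-matches A x = mk⇔ (λ x∈ _ → x , x∈ , λ _ → K.refl)
        (λ f → let (y , y∈ , ye) = f tt in resp A (φ-injective ye) y∈)

    private
      0-matches = T.0-matches tt (λ _ → φ) (λ _ → φ-cong) (λ f → φ-injective (f tt)) (λ _ → φ-+) (λ _ → φ-0)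
        (λ f → let (x , xe) = φ-onto (f tt) in x , λ _ → xe) (λ {A} {B} → ⊥-matches {A} {B})
      1-matches = T.1-matches tt (λ _ → φ) (λ _ → φ-cong) (λ f → φ-injective (f tt)) (λ _ → φ-+) (λ _ → φ-0)
        (λ f → let (x , xe) = φ-onto (f tt) in x , λ _ → xe) (λ {A} {B} → ⊥-matches {A} {B})

    extend-weak : (pre : Subspace K id e → Subspace F conj d) → (∀ B x → x ∈ member (pre B) ⇔ φ x ∈ member B) →
      ∀ t → WeaklySatisfiable (subspaceOrtholattice K id e) t → WeaklySatisfiable (subspaceOrtholattice F conj d) t
    extend-weak pre m t (b , ne) = (λ n → pre (b n)) ,
      λ z → ne (Equivalence.to (0-matches (λ n → pre (b n)) b (λ n x → mk⇔ (λ x∈ _ → Equivalence.to (m (b n) x) x∈)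
        (λ f → Equivalence.from (m (b n) x) (f tt))) t) z)

    extend-strong : (pre : Subspace K id e → Subspace F conj d) → (∀ B x → x ∈ member (pre B) ⇔ φ x ∈ member B) →
      ∀ t → StronglySatisfiable (subspaceOrtholattice K id e) t → StronglySatisfiable (subspaceOrtholattice F conj d) t
    extend-strong pre m t (b , eq) = (λ n → pre (b n)) ,
      Equivalence.from (1-matches (λ n → pre (b n)) b (λ n x → mk⇔ (λ x∈ _ → Equivalence.to (m (b n) x) x∈)
        (λ f → Equivalence.from (m (b n) x) (f tt))) t) eq

    restrict-weak : ∀ t → WeaklySatisfiable (subspaceOrtholattice F conj d) t → WeaklySatisfiable (subspaceOrtholattice K id e) t
    restrict-weak t (a , ne) = (λ n → image (a n)) ,
      λ z → ne (Equivalence.from (0-matches a (λ n → image (a n)) (λ n → image-matches (a n)) t) z)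

    restrict-strong : ∀ t → StronglySatisfiable (subspaceOrtholattice F conj d) t → StronglySatisfiable (subspaceOrtholattice K id e) t
    restrict-strong t (a , eq) = (λ n → image (a n)) ,
      Equivalence.to (1-matches a (λ n → image (a n)) (λ n → image-matches (a n)) t) eq

  private
    re∘ im∘ : ∀ {d} → Vector F.Carrier d → Vector K.Carrier d
    re∘ x i = re (x i)
    im∘ x i = im (x i)

  module RealKind (im≈0 : ∀ x → im x K.≈ K.0#) (re-onto : ∀ k → ∃ λ x → re x K.≈ k) {d : ℕ} where

    private
      re-*-real : ∀ x y → re (x F.* y) K.≈ re x K.* re y
      re-*-real x y = K.trans (re-* x y) (K.trans (K.+-congˡ (K.-‿cong (K.trans (K.*-congʳ (im≈0 x)) (K.zeroˡ _))))
        (solve 1 (λ a → a :- con (+ 0) := a) K.refl (re x K.* re y)))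

      re-inner-real : ∀ (x y : Vector F.Carrier d) → re (inner x y) K.≈ dot (re∘ x) (re∘ y)
      re-inner-real x y = K.trans (re-inner x y) (K.trans (K.+-congˡ (dot-0ʳ (im∘ x) (λ i → im≈0 (y i)))) (K.+-identityʳ _))

      re-injective : ∀ {x y : F.Carrier} → re x K.≈ re y → x F.≈ y
      re-injective e = injective e (K.trans (im≈0 _) (K.sym (im≈0 _)))

      preimage : Subspace K id d → Subspace F conj d
      preimage B = record
        { member   = λ x → re∘ x ∈ member B
        ; resp     = λ e → resp B (λ i → re-cong (e i))
        ; 0∈       = resp B (λ _ → K.sym re-0) (0∈ B)
        ; +-closed = λ {x} {y} p q → resp B (λ i → K.sym (re-+ (x i) (y i))) (+-closed B p q)
        ; *-closed = λ c {x} p → resp B (λ i → K.sym (re-*-real c (x i))) (*-closed B (re c) p)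
        }

      scaling : ∀ c → ∃ λ c′ → ∀ (x : Vector F.Carrier d) i → re (c′ F.* x i) K.≈ c K.* re (x i)
      scaling c = let (c′ , e) = re-onto c in c′ , λ x i → K.trans (re-*-real c′ (x i)) (K.*-congʳ e)

      module R = Restriction {d} {d} re∘ (λ e i → re-cong (e i)) (λ e i → re-injective (e i)) (λ x y i → re-+ (x i) (y i)) (λ _ → re-0)
        (λ u → (λ i → proj₁ (re-onto (u i))) , λ i → proj₂ (re-onto (u i)))
        scaling re-inner-real (λ A y f x∈ → re-injective (K.trans (f x∈) (K.sym re-0)))

    restrict-weak : ∀ t → WeaklySatisfiable (subspaceOrtholattice F conj d) t → WeaklySatisfiable (subspaceOrtholattice K id d) t
    restrict-weak = R.restrict-weak

    extend-weak : ∀ t → WeaklySatisfiable (subspaceOrtholattice K id d) t → WeaklySatisfiable (subspaceOrtholattice F conj d) t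
    extend-weak = R.extend-weak preimage (λ B x → mk⇔ (λ p → p) (λ p → p))

    restrict-strong : ∀ t → StronglySatisfiable (subspaceOrtholattice F conj d) t → StronglySatisfiable (subspaceOrtholattice K id d) t
    restrict-strong = R.restrict-strong

    extend-strong : ∀ t → StronglySatisfiable (subspaceOrtholattice K id d) t → StronglySatisfiable (subspaceOrtholattice F conj d) t
    extend-strong = R.extend-strong preimage (λ B x → mk⇔ (λ p → p) (λ p → p))

  module ComplexKind (pair : ∀ k l → ∃ λ x → re x K.≈ k × im x K.≈ l) {d : ℕ} where

    private
      ⌜_⌝ : K.Carrier → F.Carrier
      ⌜ k ⌝ = proj₁ (pair k K.0#)

      re-scale : ∀ k x → re (⌜ k ⌝ F.* x) K.≈ k K.* re x
      re-scale k x = K.trans (re-* ⌜ k ⌝ x) (K.trans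
        (K.+-cong (K.*-congʳ (proj₁ (proj₂ (pair k K.0#)))) (K.-‿cong (K.trans (K.*-congʳ (proj₂ (proj₂ (pair k K.0#)))) (K.zeroˡ _))))
        (solve 1 (λ a → a :- con (+ 0) := a) K.refl (k K.* re x)))

      im-scale : ∀ k x → im (⌜ k ⌝ F.* x) K.≈ k K.* im x
      im-scale k x = K.trans (im-* ⌜ k ⌝ x) (K.trans
        (K.+-cong (K.*-congʳ (proj₁ (proj₂ (pair k K.0#)))) (K.trans (K.*-congʳ (proj₂ (proj₂ (pair k K.0#)))) (K.zeroˡ _)))
        (K.+-identityʳ _))

      i : F.Carrier
      i = proj₁ (pair K.0# K.1#)

      re-i : ∀ x → re (i F.* x) K.≈ K.- im x
      re-i x = K.trans (re-* i x) (K.trans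
        (K.+-cong (K.trans (K.*-congʳ (proj₁ (proj₂ (pair K.0# K.1#)))) (K.zeroˡ _)) (K.-‿cong (K.trans (K.*-congʳ (proj₂ (proj₂ (pair K.0# K.1#)))) (K.*-identityˡ _))))
        (K.+-identityˡ _))

      im-i : ∀ x → im (i F.* x) K.≈ re x
      im-i x = K.trans (im-* i x) (K.trans
        (K.+-cong (K.trans (K.*-congʳ (proj₁ (proj₂ (pair K.0# K.1#)))) (K.zeroˡ _)) (K.trans (K.*-congʳ (proj₂ (proj₂ (pair K.0# K.1#)))) (K.*-identityˡ _)))
        (K.+-identityˡ _))

      realify : Vector F.Carrier d → Vector K.Carrier (d ℕ.+ d)
      realify x = re∘ x ++ im∘ x

      everywhere : ∀ {ℓ} {P : Fin (d ℕ.+ d) → Set ℓ} → (∀ i → P (i ↑ˡ d)) → (∀ i → P (d ↑ʳ i)) → ∀ i → P i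
      everywhere {P = P} p q i with splitAt d i in eq
      ... | inj₁ j = ≡.subst P (Fin.splitAt⁻¹-↑ˡ eq) (p j)
      ... | inj₂ j = ≡.subst P (Fin.splitAt⁻¹-↑ʳ eq) (q j)

      at-re : ∀ x (i : Fin d) → realify x (i ↑ˡ d) ≡ re (x i)
      at-re x = lookup-++ˡ (re∘ x) (im∘ x)

      at-im : ∀ x (i : Fin d) → realify x (d ↑ʳ i) ≡ im (x i)
      at-im x = lookup-++ʳ (re∘ x) (im∘ x)

      sum-++ : ∀ m {n} (f : Fin (m ℕ.+ n) → K.Carrier) → ΣK.sum f K.≈ ΣK.sum (λ i → f (i ↑ˡ n)) K.+ ΣK.sum (λ i → f (m ↑ʳ i))
      sum-++ zero    f = K.sym (K.+-identityˡ _)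
      sum-++ (suc m) f = K.trans (K.+-congˡ (sum-++ m (f ∘ suc))) (K.sym (K.+-assoc _ _ _))

      realify-dot : ∀ x y → re (inner x y) K.≈ dot (realify x) (realify y)
      realify-dot x y = K.trans (re-inner x y) (K.sym (K.trans (sum-++ d (λ i → realify x i K.* realify y i))
        (K.+-cong (ΣK.sum-cong-≋ (λ i → K.reflexive (≡.cong₂ K._*_ (at-re x i) (at-re y i))))
                  (ΣK.sum-cong-≋ (λ i → K.reflexive (≡.cong₂ K._*_ (at-im x i) (at-im y i)))))))

      re-⊥ : ∀ (A : Subspace F conj d) y → (∀ {x} → x ∈ member A → re (inner x y) K.≈ K.0#) →
        ∀ {x} → x ∈ member A → inner x y F.≈ F.0#
      re-⊥ A y f {x} x∈ = injective (K.trans (f x∈) (K.sym re-0)) (K.trans im≈0 (K.sym im-0))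
        where
        -- The real part of ⟨ i x , y ⟩ is the imaginary part of ⟨ x , y ⟩.
        im≈0 : im (inner x y) K.≈ K.0#
        im≈0 = K.trans (K.trans (im-inner x y) (K.trans (K.+-comm _ _) (K.sym (K.trans (re-inner (λ j → i F.* x j) y)
          (K.+-cong (dot-cong (λ j → re-i (x j)) (λ _ → K.refl)) (dot-cong (λ j → im-i (x j)) (λ _ → K.refl)))))))
          (f (*-closed A i x∈))

      module R = Restriction {d} {d ℕ.+ d} realify
        (λ {x} {y} e → everywhere (λ i → subst₂ K._≈_ (≡.sym (at-re x i)) (≡.sym (at-re y i)) (re-cong (e i)))
                          (λ i → subst₂ K._≈_ (≡.sym (at-im x i)) (≡.sym (at-im y i)) (im-cong (e i))))
        (λ {x} {y} e i → injective (subst₂ K._≈_ (at-re x i) (at-re y i) (e (i ↑ˡ d))) (subst₂ K._≈_ (at-im x i) (at-im y i) (e (d ↑ʳ i))))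
        (λ x y → everywhere
          (λ i → subst₂ K._≈_ (≡.sym (at-re _ i)) (≡.sym (≡.cong₂ K._+_ (at-re x i) (at-re y i))) (re-+ (x i) (y i)))
          (λ i → subst₂ K._≈_ (≡.sym (at-im _ i)) (≡.sym (≡.cong₂ K._+_ (at-im x i) (at-im y i))) (im-+ (x i) (y i))))
        (everywhere (λ i → K.trans (K.reflexive (at-re _ i)) re-0) (λ i → K.trans (K.reflexive (at-im _ i)) im-0))
        (λ u → (λ i → proj₁ (pair (u (i ↑ˡ d)) (u (d ↑ʳ i)))) , everywhere
          (λ i → K.trans (K.reflexive (at-re _ i)) (proj₁ (proj₂ (pair (u (i ↑ˡ d)) (u (d ↑ʳ i))))))
          (λ i → K.trans (K.reflexive (at-im _ i)) (proj₂ (proj₂ (pair (u (i ↑ˡ d)) (u (d ↑ʳ i)))))))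
        (λ c → ⌜ c ⌝ , λ x → everywhere
          (λ i → subst₂ K._≈_ (≡.sym (at-re _ i)) (≡.sym (≡.cong (c K.*_) (at-re x i))) (re-scale c (x i)))
          (λ i → subst₂ K._≈_ (≡.sym (at-im _ i)) (≡.sym (≡.cong (c K.*_) (at-im x i))) (im-scale c (x i))))
        realify-dot re-⊥

    restrict-weak : ∀ t → WeaklySatisfiable (subspaceOrtholattice F conj d) t → WeaklySatisfiable (subspaceOrtholattice K id (d ℕ.+ d)) t
    restrict-weak = R.restrict-weak

    restrict-strong : ∀ t → StronglySatisfiable (subspaceOrtholattice F conj d) t → StronglySatisfiable (subspaceOrtholattice K id (d ℕ.+ d)) t
    restrict-strong = R.restrict-strong

    private
      complexify : Subspace K id d → Subspace F conj d
      complexify B = record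
        { member   = λ x → re∘ x ∈ member B × im∘ x ∈ member B
        ; resp     = λ e (p , q) → resp B (λ i → re-cong (e i)) p , resp B (λ i → im-cong (e i)) q
        ; 0∈       = resp B (λ _ → K.sym re-0) (0∈ B) , resp B (λ _ → K.sym im-0) (0∈ B)
        ; +-closed = λ {x} {y} (p , q) (p′ , q′) →
            resp B (λ i → K.sym (re-+ (x i) (y i))) (+-closed B p p′) , resp B (λ i → K.sym (im-+ (x i) (y i))) (+-closed B q q′)
        ; *-closed = λ c {x} (p , q) →
            resp B (λ i → K.trans (solve 4 (λ a b x y → a :* x :+ (:- b) :* y := a :* x :- b :* y) K.refl (re c) (im c) (re (x i)) (im (x i)))
                     (K.sym (re-* c (x i)))) (+-closed B (*-closed B (re c) p) (*-closed B (K.- im c) q)) ,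
            resp B (λ i → K.sym (im-* c (x i))) (+-closed B (*-closed B (re c) q) (*-closed B (im c) p))
        }

      part : Bool → Vector F.Carrier d → Vector K.Carrier d
      part true  = re∘
      part false = im∘

      module T = LatticeTransfer F conj d K id d

      part-cong : ∀ k {x y} → (∀ i → x i F.≈ y i) → ∀ i → part k x i K.≈ part k y i
      part-cong true  e i = re-cong (e i)
      part-cong false e i = im-cong (e i)

      part-+ : ∀ k x y i → part k (λ i → x i F.+ y i) i K.≈ part k x i K.+ part k y i
      part-+ true  x y i = re-+ (x i) (y i)
      part-+ false x y i = im-+ (x i) (y i)

      part-0 : ∀ k (i : Fin d) → part k (λ _ → F.0#) i K.≈ K.0#
      part-0 true  i = re-0
      part-0 false i = im-0

      part-onto : ∀ (f : Bool → Vector K.Carrier d) → ∃ λ x → ∀ k i → part k x i K.≈ f k i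
      part-onto f = (λ i → proj₁ (pair (f true i) (f false i))) , λ where
        true  i → proj₁ (proj₂ (pair (f true i) (f false i)))
        false i → proj₂ (proj₂ (pair (f true i) (f false i)))

      Matches : Subspace F conj d → Subspace K id d → Set
      Matches = T.Matches true part part-cong (λ e i → injective (e true i) (e false i)) part-+ part-0 part-onto

      complexify-matches : ∀ B → Matches (complexify B) B
      complexify-matches B x = mk⇔ (λ (p , q) → λ { true → p ; false → q }) (λ f → f true , f false)

      ⊥-matches : ∀ {A B} → Matches A B → Matches (_⊥ₛ F conj d A) (_⊥ₛ K id d B)
      ⊥-matches {A} {B} m y = mk⇔ (λ y⊥ k {u} u∈ → down (λ {x} → y⊥ {x}) u∈ k) up
        where
        down : y ∈ member (_⊥ₛ F conj d A) → ∀ {u} → u ∈ member B → ∀ k → dot u (part k y) K.≈ K.0#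
        down y⊥ {u} u∈ = go
          where
          -- The vector `u` with imaginary part zero lies in `A`, and the two parts of its inner
          -- product with `y` are the products of `u` with the two parts of `y`.
          x : Vector F.Carrier d
          x j = ⌜ u j ⌝
          re-x : ∀ j → re (x j) K.≈ u j
          re-x j = proj₁ (proj₂ (pair (u j) K.0#))
          im-x : ∀ j → im (x j) K.≈ K.0#
          im-x j = proj₂ (proj₂ (pair (u j) K.0#))
          x∈ : x ∈ member A
          x∈ = Equivalence.from (m x) λ where
            true  → resp B (λ j → K.sym (re-x j)) u∈
            false → resp B (λ j → K.sym (im-x j)) (0∈ B)
          go : ∀ k → dot u (part k y) K.≈ K.0#
          go true  = K.trans (K.sym (K.trans (re-inner x y) (K.trans
                    (K.+-cong (dot-cong re-x (λ _ → K.refl)) (dot-0ˡ (im∘ y) im-x)) (K.+-identityʳ _)))) (K.trans (re-cong (y⊥ x∈)) re-0)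
          go false = K.trans (K.sym (K.trans (im-inner x y) (K.trans
                    (K.+-cong (dot-cong re-x (λ _ → K.refl)) (dot-neg (im∘ x) (re∘ y) (dot-0ˡ (re∘ y) im-x))) (K.+-identityʳ _)))) (K.trans (im-cong (y⊥ x∈)) im-0)
        up : (∀ k → part k y ∈ member (_⊥ₛ K id d B)) → y ∈ member (_⊥ₛ F conj d A)
        up f {x} x∈ = injective
          (K.trans (re-inner x y) (K.trans (0+0 (f true (Equivalence.to (m x) x∈ true)) (f false (Equivalence.to (m x) x∈ false))) (K.sym re-0)))
          (K.trans (im-inner x y) (K.trans (0+0 (f false (Equivalence.to (m x) x∈ true))
            (dot-neg (im∘ x) (re∘ y) (f true (Equivalence.to (m x) x∈ false)))) (K.sym im-0)))

    extend-weak : ∀ t → WeaklySatisfiable (subspaceOrtholattice K id d) t → WeaklySatisfiable (subspaceOrtholattice F conj d) t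
    extend-weak t (b , ne) = (λ n → complexify (b n)) , λ z → ne (Equivalence.to
      (T.0-matches true part part-cong (λ e i → injective (e true i) (e false i)) part-+ part-0 part-onto
        (λ {A} {B} → ⊥-matches {A} {B}) (λ n → complexify (b n)) b (λ n → complexify-matches (b n)) t) z)

    extend-strong : ∀ t → StronglySatisfiable (subspaceOrtholattice K id d) t → StronglySatisfiable (subspaceOrtholattice F conj d) t
    extend-strong t (b , eq) = (λ n → complexify (b n)) , Equivalence.from
      (T.1-matches true part part-cong (λ e i → injective (e true i) (e false i)) part-+ part-0 part-onto
        (λ {A} {B} → ⊥-matches {A} {B}) (λ n → complexify (b n)) b (λ n → complexify-matches (b n)) t) eq

  private
    double : ∀ {d} → NonZero d → NonZero (d ℕ.+ d)
    double {suc d} _ = _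

  private
    Kind : Set
    Kind = ((∀ x → im x K.≈ K.0#) × (∀ k → ∃ λ x → re x K.≈ k)) ⊎ (∀ k l → ∃ λ x → re x K.≈ k × im x K.≈ l)

    -- Restriction of scalars doubles the dimension in the complex case, so the comparison is of
    -- satisfiability in some dimension and not in each.
    restrict-weak-by : Kind → ∀ t → Weak* F conj t → Weak* K id t
    restrict-weak-by (inj₁ (im≈0 , re-onto)) t (weak* d nz w) = weak* d nz (RealKind.restrict-weak im≈0 re-onto t w)
    restrict-weak-by (inj₂ pair)             t (weak* d nz w) = weak* (d ℕ.+ d) (double nz) (ComplexKind.restrict-weak pair t w)

    extend-weak-by : Kind → ∀ t → Weak* K id t → Weak* F conj t
    extend-weak-by (inj₁ (im≈0 , re-onto)) t (weak* d nz w) = weak* d nz (RealKind.extend-weak im≈0 re-onto t w)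
    extend-weak-by (inj₂ pair)             t (weak* d nz w) = weak* d nz (ComplexKind.extend-weak pair t w)

    restrict-strong-by : Kind → ∀ t → Strong* F conj t → Strong* K id t
    restrict-strong-by (inj₁ (im≈0 , re-onto)) t (strong* d nz w) = strong* d nz (RealKind.restrict-strong im≈0 re-onto t w)
    restrict-strong-by (inj₂ pair)             t (strong* d nz w) = strong* (d ℕ.+ d) (double nz) (ComplexKind.restrict-strong pair t w)

    extend-strong-by : Kind → ∀ t → Strong* K id t → Strong* F conj t
    extend-strong-by (inj₁ (im≈0 , re-onto)) t (strong* d nz w) = strong* d nz (RealKind.extend-strong im≈0 re-onto t w)
    extend-strong-by (inj₂ pair)             t (strong* d nz w) = strong* d nz (ComplexKind.extend-strong pair t w)

  restrict-weak : ∀ t → Weak* F conj t → Weak* K id t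
  restrict-weak = restrict-weak-by kind

  extend-weak : ∀ t → Weak* K id t → Weak* F conj t
  extend-weak = extend-weak-by kind

  restrict-strong : ∀ t → Strong* F conj t → Strong* K id t
  restrict-strong = restrict-strong-by kind

  extend-strong : ∀ t → Strong* K id t → Strong* F conj t
  extend-strong = extend-strong-by kind

-- Spreads and membership in the value of a term

module TermSemantics (em : ∀ {ℓ} → ExcludedMiddle ℓ) (K : OrderedField) where

  open import Data.Bool.Base using (Bool; true; false) renaming (not to notᵇ)
  open import Data.Empty using (⊥; ⊥-elim)
  open import Data.Nat.Base as ℕ using (ℕ; zero; suc; _≤_; _<_; s≤s; _∸_)
  import Data.Nat.Properties as ℕ
  open import Data.Product.Base using (∃; _×_; _,_; proj₁; proj₂)
  open import Data.Unit.Base using (⊤; tt)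
  open import Function.Base using (id)
  open import Relation.Binary.PropositionalEquality as ≡ using (_≡_; _≢_; refl; cong; subst)
  open import Relation.Nullary.Decidable.Core using (yes; no)
  open import Relation.Nullary.Negation.Core using (¬_)
  open import Relation.Unary using (_∈_)

  private module K = OrderedField K
  open OrderedField K using (Carrier; _≈_; 0#)
  open OrderedFieldProperties K using (solve; _:=_; _:+_; _:-_)
  open LinearAlgebra em K
  open Subspace
  open Spreads

  private
    -- The operands occupy disjoint ranges of positions, separated at `m`, so their guesses merge
    -- into one sequence; position `p`, just before both ranges, carries the vector split off.
    glue : ∀ {V : Set} → ℕ → V → ℕ → (ℕ → V) → (ℕ → V) → ℕ → V
    glue p x m g g′ q with q ℕ.≟ p | q ℕ.<? m
    ... | yes _ | _     = x
    ... | no _  | yes _ = g q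
    ... | no _  | no _  = g′ q

    glue-here : ∀ {V : Set} {x : V} p m {g g′} → x ≡ glue p x m g g′ p
    glue-here p m with p ℕ.≟ p | p ℕ.<? m
    ... | yes _ | _ = refl
    ... | no ne | _ = ⊥-elim (ne refl)

    glue-left : ∀ {V : Set} {x : V} {p m g g′ q} → p < q → q < m → g q ≡ glue p x m g g′ q
    glue-left {p = p} {m} {q = q} p<q q<m with q ℕ.≟ p | q ℕ.<? m
    ... | yes e | _     = ⊥-elim (ℕ.<⇒≢ p<q (≡.sym e))
    ... | no _  | yes _ = refl
    ... | no _  | no n  = ⊥-elim (n q<m)

    glue-right : ∀ {V : Set} {x : V} {p m g g′ q} → p < q → m ≤ q → g′ q ≡ glue p x m g g′ q
    glue-right {p = p} {m} {q = q} p<q m≤q with q ℕ.≟ p | q ℕ.<? m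
    ... | yes e | _     = ⊥-elim (ℕ.<⇒≢ p<q (≡.sym e))
    ... | no _  | yes l = ⊥-elim (ℕ.<⇒≱ l m≤q)
    ... | no _  | no _  = refl

  module _ {d : ℕ} where

    Null : Vect d → Set
    Null v = v ≋ 𝟎

    In : Bool → Sub d → Vect d → Set
    In true  A v = v ∈ member A
    In false A v = v ∈ member (_⊥ₛ (OrderedField.commutativeRing K) id d A)

    private
      sum-split : ∀ (v x : Vect d) → v ≋ (x ⊕ (v ⊖ x))
      sum-split v x i = solve 2 (λ v x → v := x :+ (v :- x)) K.refl (v i) (x i)

    module _ (a : ℕ → Sub d) where

      Leaf : ℕ → Bool → ℕ → Vect d → Set
      Leaf _ σ i v = In σ (a i) v

      private
        S : Bool → Term → ℕ → Vect d → (ℕ → Vect d) → Set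
        S = Spread Null _⊖_ Leaf (λ _ → ⊤)

        ⟦_⟧ₐ : Term → Sub d
        ⟦ t ⟧ₐ = ⟦_⟧ (subspaceOrtholattice (OrderedField.commutativeRing K) id d) t a

        transfer : ∀ σ t p {v v′ g g′} → (∀ q → p < q → q < width t ℕ.+ p → g q ≡ g′ q) → v ≡ v′ → S σ t p v g → S σ t p v′ g′
        transfer = spread-map _≡_ (λ { refl refl → refl }) (λ { refl z → z }) (λ { refl x → x }) id

      spread⇒in : ∀ σ t p {v g} → S σ t p v g → In σ ⟦ t ⟧ₐ v
      spread⇒in true  (var i) p (_ , x) = x
      spread⇒in false (var i) p (_ , x) = x
      spread⇒in true  bottom p (_ , z) = z refl
      spread⇒in false bottom p {v} (_ , z) {x} x≋0 = K.trans (dot-comm x v) (K.trans (dot-congˡ v x≋0) (dot-0 v))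
      spread⇒in true  top p _ = tt
      spread⇒in false top p (_ , z) {x} _ = K.trans (dot-congˡ x (z refl)) (dot-0 x)
      spread⇒in true  (not t) p (_ , x) = spread⇒in false t (2 ℕ.+ p) x
      spread⇒in false (not t) p (_ , x) = ⊆⊥⊥ ⟦ t ⟧ₐ (spread⇒in true t (2 ℕ.+ p) x)
      spread⇒in true  (s and t) p (_ , x , y) = spread⇒in true s (2 ℕ.+ p) x , spread⇒in true t (width s ℕ.+ (2 ℕ.+ p)) y
      spread⇒in false (s and t) p {v} {g} (_ , x , y) {u} (us , ut) =
        K.trans (dot-congˡ u (sum-split v (g (1 ℕ.+ p)))) (K.trans (dot-+ u (g (1 ℕ.+ p)) (v ⊖ g (1 ℕ.+ p)))
          (K.trans (K.+-cong (spread⇒in false s (2 ℕ.+ p) x us) (spread⇒in false t (width s ℕ.+ (2 ℕ.+ p)) y ut)) (K.+-identityˡ 0#)))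
      spread⇒in true  (s or t) p {v} {g} (_ , x , y) =
        g (2 ℕ.+ p) , v ⊖ g (2 ℕ.+ p) , spread⇒in true s (3 ℕ.+ p) x , spread⇒in true t (width s ℕ.+ (3 ℕ.+ p)) y ,
        sum-split v (g (2 ℕ.+ p))
      spread⇒in false (s or t) p {v} (_ , x , y) {u} (u₁ , u₂ , us , ut , u≋) =
        K.trans (dot-comm u v) (K.trans (dot-congˡ v u≋) (K.trans (dot-+ v u₁ u₂) (K.trans
          (K.+-cong (K.trans (dot-comm v u₁) (spread⇒in false s (3 ℕ.+ p) x us))
                    (K.trans (dot-comm v u₂) (spread⇒in false t (width s ℕ.+ (3 ℕ.+ p)) y ut))) (K.+-identityˡ 0#))))

      private
        dup : ∀ σ s t a p {v} (x : Vect d) → (∃ λ g → S σ s (suc a ℕ.+ p) v g) → (∃ λ g → S σ t (width s ℕ.+ (suc a ℕ.+ p)) v g) →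
          ∃ λ g → S σ s (suc a ℕ.+ p) v g × S σ t (width s ℕ.+ (suc a ℕ.+ p)) v g
        dup σ s t a p x (g , sp) (g′ , sp′) = glue (a ℕ.+ p) x (width s ℕ.+ (suc a ℕ.+ p)) g g′ ,
          transfer σ s _ (λ q lt lt′ → glue-left (ℕ.<-trans ℕ.≤-refl lt) lt′) refl sp ,
          transfer σ t _ (λ q lt lt′ → glue-right (ℕ.≤-<-trans (ℕ.m≤n+m (a ℕ.+ p) (suc (width s)))
            (ℕ.≤-<-trans (ℕ.≤-reflexive (≡.sym (ℕ.+-suc (width s) (a ℕ.+ p)))) lt)) (ℕ.<⇒≤ lt)) refl sp′

        split : ∀ σ s t a p {v} (x : Vect d) → (∃ λ g → S σ s (suc a ℕ.+ p) x g) →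
          (∃ λ g → S σ t (width s ℕ.+ (suc a ℕ.+ p)) (v ⊖ x) g) →
          ∃ λ g → S σ s (suc a ℕ.+ p) (g (a ℕ.+ p)) g × S σ t (width s ℕ.+ (suc a ℕ.+ p)) (v ⊖ g (a ℕ.+ p)) g
        split σ s t a p {v} x (g , sp) (g′ , sp′) = glue (a ℕ.+ p) x (width s ℕ.+ (suc a ℕ.+ p)) g g′ ,
          transfer σ s _ (λ q lt lt′ → glue-left (ℕ.<-trans ℕ.≤-refl lt) lt′) (glue-here (a ℕ.+ p) _) sp ,
          transfer σ t _ (λ q lt lt′ → glue-right (ℕ.≤-<-trans (ℕ.m≤n+m (a ℕ.+ p) (suc (width s)))
            (ℕ.≤-<-trans (ℕ.≤-reflexive (≡.sym (ℕ.+-suc (width s) (a ℕ.+ p)))) lt)) (ℕ.<⇒≤ lt))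
            (cong (v ⊖_) (glue-here (a ℕ.+ p) _)) sp′

      -- Two cases use that the lattice comes from a finite-dimensional space with an anisotropic
      -- form: `not` under the negative sign rests on `⊥⊥⊆`, and `and` under the negative sign on
      -- `∩⊥⊆⊥+⊥`.
      in⇒spread : ∀ σ t p {v} → In σ ⟦ t ⟧ₐ v → ∃ λ g → S σ t p v g
      in⇒spread true  (var i) p {v} x = (λ _ → v) , (λ _ _ → tt) , x
      in⇒spread false (var i) p {v} x = (λ _ → v) , (λ _ _ → tt) , x
      in⇒spread true  bottom p {v} x = (λ _ → v) , (λ _ _ → tt) , λ _ → x
      in⇒spread false bottom p {v} x = (λ _ → v) , (λ _ _ → tt) , λ ()
      in⇒spread true  top p {v} x = (λ _ → v) , (λ _ _ → tt) , λ ()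
      -- Being orthogonal to everything, `v` is orthogonal to itself.
      in⇒spread false top p {v} x = (λ _ → v) , (λ _ _ → tt) , λ _ → dot-positive v (x tt)
      in⇒spread true  (not t) p x = let (g , sp) = in⇒spread false t (2 ℕ.+ p) x in g , (λ _ _ → tt) , sp
      in⇒spread false (not t) p x = let (g , sp) = in⇒spread true t (2 ℕ.+ p) (⊥⊥⊆ ⟦ t ⟧ₐ x) in g , (λ _ _ → tt) , sp
      in⇒spread true  (s and t) p {v} (x , y) =
        let (g , sp) = dup true s t 1 p v (in⇒spread true s _ x) (in⇒spread true t _ y) in g , (λ _ _ → tt) , sp
      in⇒spread false (s and t) p {v} v∈ =
        let (x , x∈ , y∈) = ∩⊥⊆⊥+⊥ ⟦ s ⟧ₐ ⟦ t ⟧ₐ v∈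
            (g , sp) = split false s t 1 p x (in⇒spread false s _ x∈) (in⇒spread false t _ y∈)
        in g , (λ _ _ → tt) , sp
      in⇒spread true  (s or t) p {v} (x , y , x∈ , y∈ , e) =
        let y≋ : y ≋ (v ⊖ x)
            y≋ i = K.trans (solve 2 (λ x y → y := x :+ y :- x) K.refl (x i) (y i)) (K.+-congʳ (K.sym (e i)))
            (g , sp) = split true s t 2 p x (in⇒spread true s _ x∈) (in⇒spread true t _ (resp ⟦ t ⟧ₐ y≋ y∈))
        in g , (λ _ _ → tt) , sp
      in⇒spread false (s or t) p {v} v∈ =
        let (g , sp) = dup false s t 2 p v
              (in⇒spread false s _ λ {u} u∈ → v∈ (u , 𝟎 , u∈ , 0∈ ⟦ t ⟧ₐ , λ i → K.sym (K.+-identityʳ (u i))))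
              (in⇒spread false t _ λ {u} u∈ → v∈ (𝟎 , u , 0∈ ⟦ s ⟧ₐ , u∈ , λ i → K.sym (K.+-identityˡ (u i))))
        in g , (λ _ _ → tt) , sp

-- Certificates and weak satisfiability

module Certificates (em : ∀ {ℓ} → ExcludedMiddle ℓ) (K : OrderedField) where

  open import Data.Bool.Base using (Bool; true; false)
  open import Data.Empty using (⊥; ⊥-elim)
  open import Data.Integer.Base using (+_)
  open import Data.Fin.Base using (Fin; toℕ; fromℕ<) renaming (zero to fzero; suc to fsuc)
  import Data.Fin.Properties as Fin
  open import Data.List.Base using (List; []; _∷_; length)
  open import Data.Nat.Base as ℕ using (ℕ; zero; suc; _≤_; _<_; s≤s; z≤n)
  import Data.Nat.DivMod as ℕ
  import Data.Nat.Divisibility as ℕ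
  import Data.Nat.Properties as ℕ
  open import Data.Product.Base using (∃; _×_; _,_; proj₁; proj₂)
  open import Data.Sum.Base using (_⊎_; inj₁; inj₂)
  open import Data.Unit.Base using (⊤; tt)
  open import Relation.Binary.PropositionalEquality as ≡ using (_≡_; _≢_; refl; cong; cong₂; subst)
  open import Relation.Nullary.Decidable.Core using (Dec; yes; no)
  open import Relation.Nullary.Negation.Core using (¬_)
  open import Function.Base using (id)
  open import Relation.Unary using (_∈_)

  private module K = OrderedField K
  open OrderedField K using (Carrier; _≈_; _≉_; _+_; _*_; _-_; -_; 0#; 1#)
  open OrderedFieldProperties K
    using (sum; sum-cong-≋; irrefl; 0<x+y; 0<[1+n]·1; ·1-injective; <-respʳ-≈; _·_; solve; _:=_; _:+_; _:*_; :-_; con)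
  open Automata K using (module Trace; sgn; sumTo)
  open Verifiers K using (Certificate; wordOf)
  open Parse K using (varName; Reads; AtLeaf; Silent; Always; spread⇒done; done⇒spread; done⇒encoding)
  open LinearAlgebra em K
  open TermSemantics em K
  open Spreads
  open Subspace

  private
    sumTo-suc : ∀ n (f : ℕ → Carrier) → sumTo (suc n) f ≈ f 0 + sumTo n (λ j → f (suc j))
    sumTo-suc zero    f = K.+-comm 0# (f 0)
    sumTo-suc (suc n) f = K.trans (K.+-congʳ (sumTo-suc n f)) (K.+-assoc _ _ _)

    sumTo≈sum : ∀ n (f : ℕ → Carrier) → sumTo n f ≈ sum {n} (λ j → f (toℕ j))
    sumTo≈sum zero    f = K.refl
    sumTo≈sum (suc n) f = K.trans (sumTo-suc n f) (K.+-congˡ (sumTo≈sum n (λ j → f (suc j))))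

    reads-self : ∀ w → Reads (wordOf w) 0 w
    reads-self []      = tt
    reads-self (b ∷ w) = refl , later b w 0 w (reads-self w)
      where
      later : ∀ b w p u → Reads (wordOf w) p u → Reads (wordOf (b ∷ w)) (suc p) u
      later b w p []      _       = tt
      later b w p (_ ∷ u) (e , r) = e , later b w (suc p) u r

    width-positive : ∀ t → 0 < width t
    width-positive (var x)   = s≤s z≤n
    width-positive bottom    = s≤s z≤n
    width-positive top       = s≤s z≤n
    width-positive (not t)   = s≤s z≤n
    width-positive (s and t) = s≤s z≤n
    width-positive (s or t)  = s≤s z≤n

    opposite-names : ∀ i → varName false i + varName true i ≈ 0#
    opposite-names i = solve 1 (λ c → (:- con (+ 1)) :* c :+ con (+ 1) :* c := con (+ 0)) K.refl (suc i · 1#)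

    -- Names of equal sign add up to something positive or negative, never to zero. If the signs
    -- differ, the sum vanishes only for equal indices, by characteristic zero.
    names-opposite : ∀ σ i τ j → varName σ i + varName τ j ≈ 0# → (i ≡ j) × ((σ ≡ true × τ ≡ false) ⊎ (σ ≡ false × τ ≡ true))
    names-opposite true  i true  j e = ⊥-elim (irrefl (K.sym e) (<-respʳ-≈
      (solve 2 (λ a b → a :+ b := con (+ 1) :* a :+ con (+ 1) :* b) K.refl (suc i · 1#) (suc j · 1#))
      (0<x+y (0<[1+n]·1 i) (0<[1+n]·1 j))))
    names-opposite false i false j e = ⊥-elim (irrefl (K.sym (K.trans (K.-‿cong e) (solve 0 (:- con (+ 0) := con (+ 0)) K.refl)))
      (<-respʳ-≈ (solve 2 (λ a b → a :+ b := :- ((:- con (+ 1)) :* a :+ (:- con (+ 1)) :* b)) K.refl (suc i · 1#) (suc j · 1#))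
      (0<x+y (0<[1+n]·1 i) (0<[1+n]·1 j))))
    names-opposite true  i false j e = ℕ.suc-injective (·1-injective (suc i) (suc j) (K.trans
      (solve 2 (λ a b → a := (con (+ 1) :* a :+ (:- con (+ 1)) :* b) :+ b) K.refl (suc i · 1#) (suc j · 1#))
      (K.trans (K.+-congʳ e) (K.+-identityˡ _)))) , inj₁ (refl , refl)
    names-opposite false i true  j e = ≡.sym (ℕ.suc-injective (·1-injective (suc j) (suc i) (K.trans
      (solve 2 (λ a b → b := ((:- con (+ 1)) :* a :+ con (+ 1) :* b) :+ a) K.refl (suc i · 1#) (suc j · 1#))
      (K.trans (K.+-congʳ e) (K.+-identityˡ _))))) , inj₂ (refl , refl)

    opposite-orthogonal : ∀ {d} (a : ℕ → Sub d) {σ i τ k u u′} → In σ (a i) u → In τ (a k) u′ →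
      (i ≡ k) × ((σ ≡ true × τ ≡ false) ⊎ (σ ≡ false × τ ≡ true)) → dot u u′ ≈ 0#
    opposite-orthogonal a x y (refl , inj₁ (refl , refl)) = y x
    opposite-orthogonal a {u = u} {u′} x y (refl , inj₂ (refl , refl)) = K.trans (dot-comm u u′) (x y)

  module _ (t : Term) (G : ℕ → Carrier) where

    private
      n = width t
      word = wordOf (encode t)
      row : ℕ → ℕ → Carrier
      row j q = G (j ℕ.* n ℕ.+ q)
      module Row j = Trace word (row j)
      reads = reads-self (encode t)
      X : ℕ → Vect n
      X q j = Row.valueAt (toℕ j) q
      N : ℕ → Carrier
      N = Row.nameAt (ℕ.pred n)
      -- The pass whose names make up `N`; it exists because an encoding is never empty.
      last : Fin n
      last = fromℕ< {ℕ.pred n} (ℕ.≤-reflexive (ℕ.suc-pred n {{ℕ.>-nonZero (width-positive t)}}))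
      toℕ-last : toℕ last ≡ ℕ.pred n
      toℕ-last = Fin.toℕ-fromℕ< _

      dot-X : ∀ q q′ → sumTo n (λ j → Row.valueAt j q * Row.valueAt j q′) ≈ dot (X q) (X q′)
      dot-X q q′ = sumTo≈sum n (λ j → Row.valueAt j q * Row.valueAt j q′)

    root : Vect n
    root j = row (toℕ j) 0

    -- The length of the word serves as the dimension. Under the assignment read off from the
    -- outputs, the root vector lies in the value of the term, and the certificate says that it is
    -- not zero.
    certificate⇒satisfiable : Certificate (encode t) G → Weak* (OrderedField.commutativeRing K) id t
    certificate⇒satisfiable (done , sq≉0 , orth) = weak* n (ℕ.>-nonZero (width-positive t)) (a , λ (⊆0 , _) →
      sq≉0 (K.trans (sumTo≈sum n (λ j → row j 0 * row j 0)) (K.trans (dot-congˡ root (⊆0 root∈)) (dot-0 root))))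
      where
      -- The variable i is interpreted by the orthocomplement of the vectors at its negative occurrences.
      a : ℕ → Sub n
      a i = record
        { member   = λ x → ∀ q → q < n → N q ≈ varName false i → dot (X q) x ≈ 0#
        ; resp     = λ x≋y p q lt e → K.trans (dot-congˡ (X q) (λ i → K.sym (x≋y i))) (p q lt e)
        ; 0∈       = λ q _ _ → dot-0 (X q)
        ; +-closed = λ {x} {y} p p′ q lt e → K.trans (dot-+ (X q) x y) (K.trans (K.+-cong (p q lt e) (p′ q lt e)) (K.+-identityˡ 0#))
        ; *-closed = λ c {x} p q lt e → K.trans (dot-* c (X q) x) (K.trans (K.*-congˡ (p q lt e)) (K.zeroʳ c))
        }
      leaf : ∀ {q σ i} {v : Vect n} → (∀ j → AtLeaf word (row (toℕ j)) q σ i (v j)) × q < n ℕ.+ 0 → In σ (a i) v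
      leaf {q} {σ} {i} {v} (at , lt) = go σ named
        where
        q<n = subst (q <_) (ℕ.+-identityʳ n) lt
        named : N q ≈ varName σ i
        named = subst (λ j → Row.nameAt j q ≈ varName σ i) toℕ-last (proj₂ (at last))
        X≋v : X q ≋ v
        X≋v j = proj₁ (at j)
        go : ∀ σ → N q ≈ varName σ i → In σ (a i) v
        -- The certificate makes the vector at a positive occurrence orthogonal to those at all
        -- negative ones, which is membership in `a i`.
        go true  e q′ q′<n e′ = K.trans (dot-congˡ (X q′) (λ j → K.sym (X≋v j))) (K.trans (K.sym (dot-X q′ q))
          (orth q′ q q′<n q<n (K.trans (K.+-cong e′ e) (opposite-names i))))
        go false e {x} x∈ = K.trans (dot-congˡ x (λ j → K.sym (X≋v j))) (K.trans (dot-comm x (X q)) (x∈ q q<n e))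
      root∈ : root ∈ member (⟦_⟧ (subspaceOrtholattice (OrderedField.commutativeRing K) id n) t a)
      root∈ = spread⇒in a true t 0 (spread-map _≡_ (λ { refl refl → refl }) (λ { refl z → z }) (λ {q} {σ} {i} → λ { refl x → leaf {q} {σ} {i} x }) (λ _ → tt)
        true t 0 {g = λ q j → row (toℕ j) q} (λ _ _ _ → refl) refl (spread-within true t 0 (spread-pointwise true t 0
          (λ j → done⇒spread word (row (toℕ j)) t reads (done (toℕ j) (Fin.toℕ<n j))))))

  certificate⇒encoding : ∀ w {G} → Certificate w G → ∃ λ t → w ≡ encode t × Weak* (OrderedField.commutativeRing K) id t
  -- For the empty word the sum of squares is empty, hence zero.
  certificate⇒encoding []          (_ , sq≉0 , _)   = ⊥-elim (sq≉0 K.refl)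
  certificate⇒encoding w@(b ∷ w′) {G} c@(done , _) =
    let (t , e) = done⇒encoding (wordOf w) (λ q → G q) w (reads-self w) (done 0 (s≤s z≤n))
    in t , e , certificate⇒satisfiable t G (subst (λ w → Certificate w G) e c)

  private
    coordinate : ∀ {n} → Vect n → ℕ → Carrier
    coordinate {n} u j with j ℕ.<? n
    ... | yes j<n = u (fromℕ< j<n)
    ... | no _    = 0#

    coordinate-toℕ : ∀ {n} u (j : Fin n) → coordinate u (toℕ j) ≡ u j
    coordinate-toℕ {n} u j with toℕ j ℕ.<? n
    ... | yes lt = cong u (Fin.fromℕ<-toℕ j lt)
    ... | no ne  = ⊥-elim (ne (Fin.toℕ<n j))

    abstract
      -- Row-major storage, decoded by quotient and remainder.
      matrix : ∀ n .{{_ : ℕ.NonZero n}} (f : ℕ → Vect n) →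
        ∃ λ (G : ℕ → Carrier) → ∀ (j : Fin n) {q} → q < n → G (toℕ j ℕ.* n ℕ.+ q) ≡ f q j
      matrix n f = (λ a → coordinate (f (a ℕ.% n)) (a ℕ./ n)) , λ j {q} q<n → ≡.trans (cong₂ (λ r k → coordinate (f r) k)
        (≡.trans (cong (ℕ._% n) (ℕ.+-comm (toℕ j ℕ.* n) q)) (≡.trans (ℕ.[m+kn]%n≡m%n q (toℕ j) n) (ℕ.m<n⇒m%n≡m q<n)))
        (≡.trans (ℕ.+-distrib-/-∣ˡ {toℕ j ℕ.* n} q (ℕ.n∣m*n (toℕ j)))
          (≡.trans (cong₂ ℕ._+_ (ℕ.m*n/n≡m (toℕ j) n) (ℕ.m<n⇒m/n≡0 q<n)) (ℕ.+-identityʳ _))))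
        (coordinate-toℕ (f q) j)

  module _ (pythagorean : Pythagorean) {d : ℕ} (t : Term) (a : ℕ → Sub d)
           {v : Vect d} (v∈ : v ∈ member (⟦_⟧ (subspaceOrtholattice (OrderedField.commutativeRing K) id d) t a)) (v≉0 : ¬ v ≋ 𝟎) where

    private
      n = width t
      instance
        n≢0 : ℕ.NonZero n
        n≢0 = ℕ.>-nonZero (width-positive t)

      spread : ∃ λ g → Spread Null _⊖_ (Leaf a) (λ _ → ⊤) true t 0 v g
      spread = in⇒spread a true t 0 v∈

      -- Position 0 never splits, so its slot is filled with the root vector, and the n generators
      -- comprise all vectors involved.
      g : ℕ → Vect d
      g zero    = v
      g (suc q) = proj₁ spread (suc q)

      open Isometry (isometry pythagorean {m = n} (λ i → g (toℕ i))) renaming (map to Φ; map-cong to Φ-cong; map-- to Φ--)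

      G : ℕ → Carrier
      G = proj₁ (matrix n (λ q → Φ (g q)))

      row : ℕ → ℕ → Carrier
      row j q = G (j ℕ.* n ℕ.+ q)

      row≡ : ∀ (j : Fin n) {q} → q < n → row (toℕ j) q ≡ Φ (g q) j
      row≡ = proj₂ (matrix n (λ q → Φ (g q)))

      word = wordOf (encode t)
      module Row j = Trace word (row j)
      reads = reads-self (encode t)

      Φ-null : ∀ {u} → u ≋ 𝟎 → Φ u ≋ 𝟎
      Φ-null {u} u≋0 i = K.trans (Φ-cong (λ i → K.trans (u≋0 i) (K.sym (K.trans (K.+-cong (u≋0 i) (K.-‿cong (u≋0 i))) (K.-‿inverseʳ 0#)))) i)
        (K.trans (Φ-- u u i) (K.-‿inverseʳ _))

      InSpan : Vect d → Set
      InSpan = Span (λ (i : Fin n) → g (toℕ i))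

      g-span : ∀ {q} → q < n → InSpan (g q)
      g-span {q} q<n = subst (λ k → InSpan (g k)) (Fin.toℕ-fromℕ< q<n) (generator (fromℕ< q<n))

      0<n : 0 < n
      0<n = width-positive t

      range : ∀ {q} → q < n ℕ.+ 0 → q < n
      range = subst (_ <_) (ℕ.+-identityʳ n)

      -- A single coordinate of `Φ` respects differences and zero, so it turns the spread of vectors
      -- into a spread of field elements.
      done-row : ∀ j → Row.Done (toℕ j) n
      done-row j = spread⇒done word (row (toℕ j)) t reads
        (spread-map (λ u x → Φ u j ≈ x)
          (λ {u} {u′} e e′ → K.trans (Φ-- u u′ j) (K.+-cong e (K.-‿cong e′)))
          (λ e z → K.trans (K.sym e) (Φ-null z j)) (λ _ _ → tt) (λ _ → tt) true t 0
          {g = proj₁ spread}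
          (λ { (suc q) _ lt → K.reflexive (≡.sym (row≡ j (range lt))) })
          (K.reflexive (≡.sym (row≡ j 0<n))) (proj₂ spread))

      all-done : ∀ j → j < n → Row.Done j n
      all-done j j<n = subst (λ j → Row.Done j n) (Fin.toℕ-fromℕ< j<n) (done-row (fromℕ< j<n))

      -- A vector at a leaf keeps a preimage in the original space, the only place where membership
      -- in `a i` makes sense.
      Image : ℕ → Bool → ℕ → Vect n → Set
      Image _ σ i x = ∃ λ u → In σ (a i) u × InSpan u × Φ u ≋ x

      image : Spread Null _⊖_ Image (λ _ → ⊤) true t 0 (root t G) (λ q j → row (toℕ j) q)
      image = spread-map (λ u x → InSpan u × Φ u ≋ x)
        (λ {u} {u′} (s , e) (s′ , e′) → minus s s′ , λ i → K.trans (Φ-- u u′ i) (K.+-cong (e i) (K.-‿cong (e′ i))))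
        (λ (_ , e) z i → K.trans (K.sym (e i)) (Φ-null z i))
        (λ {q} {σ} {i} {u} (s , e) x → u , x , s , e) (λ _ → tt) true t 0
        {g = proj₁ spread}
        (λ { (suc q) _ lt → g-span (range lt) , λ j → K.reflexive (≡.sym (row≡ j (range lt))) })
        (g-span 0<n , λ j → K.reflexive (≡.sym (row≡ j 0<n))) (proj₂ spread)

      Output : ℕ → Bool → ℕ → Vect n → Set
      Output q σ i x = (∀ (j : Fin n) → AtLeaf word (row (toℕ j)) q σ i (x j)) × Image q σ i x

      Quiet : ℕ → Set
      Quiet q = (∀ (j : Fin n) → Silent word (row (toℕ j)) q) × ⊤

      outputs : Spread Null _⊖_ Output Quiet true t 0 (root t G) (λ q j → row (toℕ j) q)
      outputs = spread-zip true t 0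
        (spread-pointwise true t 0 (λ j → done⇒spread word (row (toℕ j)) t reads (done-row j))) image

      X : ℕ → Vect n
      X q j = Row.valueAt (toℕ j) q

      dot≈sumTo : ∀ p q → sumTo n (λ j → Row.valueAt j p * Row.valueAt j q) ≈ dot (X p) (X q)
      dot≈sumTo p q = sumTo≈sum n (λ j → Row.valueAt j p * Row.valueAt j q)

      orthogonal : ∀ p q → p < n → q < n → Row.nameAt (ℕ.pred n) p + Row.nameAt (ℕ.pred n) q ≈ 0# →
        sumTo n (λ j → Row.valueAt j p * Row.valueAt j q) ≈ 0#
      orthogonal p q p<n q<n opp = K.trans (dot≈sumTo p q) (go (classify {Null = Null} {_⊖_} {P = Output} {Quiet} true t 0 outputs p z≤n (wide p<n)) (classify {Null = Null} {_⊖_} {P = Output} {Quiet} true t 0 outputs q z≤n (wide q<n)))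
        where
        wide : ∀ {q} → q < n → q < n ℕ.+ 0
        wide = subst (_ <_) (≡.sym (ℕ.+-identityʳ n))
        last : Fin n
        last = fromℕ< {ℕ.pred n} (ℕ.≤-reflexive (ℕ.suc-pred n))
        name : ∀ q {x} → Row.nameAt (toℕ last) q ≈ x → Row.nameAt (ℕ.pred n) q ≈ x
        name q {x} = subst (λ j → Row.nameAt j q ≈ x) (Fin.toℕ-fromℕ< (ℕ.≤-reflexive (ℕ.suc-pred n)))
        go : Quiet p ⊎ LeafOf Output p → Quiet q ⊎ LeafOf Output q → dot (X p) (X q) ≈ 0#
        go (inj₁ (z , _)) _ = K.trans (dot-comm (X p) (X q)) (K.trans (dot-congˡ (X q) z) (dot-0 (X q)))
        go (inj₂ _) (inj₁ (z , _)) = K.trans (dot-congˡ (X p) z) (dot-0 (X p))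
        -- The isometry moves the inner product back to the original space, where vectors at
        -- opposite literals are orthogonal.
        go (inj₂ (σ , i , x , at , u , u∈ , us , ue)) (inj₂ (τ , k , y , at′ , u′ , u′∈ , us′ , ue′)) =
          K.trans (dot-cong (λ j → K.trans (proj₁ (at j)) (K.sym (ue j))) (λ j → K.trans (proj₁ (at′ j)) (K.sym (ue′ j))))
            (K.trans (isometric us us′) (opposite-orthogonal a u∈ u′∈ (names-opposite σ i τ k
              (K.trans (K.sym (K.+-cong (name p (proj₂ (at last))) (name q (proj₂ (at′ last))))) opp))))

      root≉0 : sumTo n (λ j → row j 0 * row j 0) ≉ 0#
      root≉0 e = v≉0 (dot-positive v (K.trans (K.sym (isometric (g-span 0<n) (g-span 0<n)))
        (K.trans (dot-cong (λ j → K.reflexive (≡.sym (row≡ j 0<n))) (λ j → K.reflexive (≡.sym (row≡ j 0<n))))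
          (K.trans (K.sym (sumTo≈sum n (λ j → row j 0 * row j 0))) e))))

    vector⇒certificate : ∃ (Certificate (encode t))
    vector⇒certificate = G , all-done , root≉0 , orthogonal

  -- The hypothesis merely denies that the value is the zero subspace; excluded middle extracts a
  -- nonzero vector from it.
  satisfiable⇒certificate : Pythagorean → ∀ t → Weak* (OrderedField.commutativeRing K) id t → ∃ (Certificate (encode t))
  satisfiable⇒certificate pythagorean t (weak* d _ (a , ne)) = certificate em
    where
    A : Sub d
    A = ⟦_⟧ (subspaceOrtholattice (OrderedField.commutativeRing K) id d) t a
    NonZeroVector = ∃ λ v → v ∈ member A × ¬ v ≋ 𝟎
    ⊆0 : ¬ NonZeroVector → ∀ {v} → v ∈ member A → v ≋ 𝟎
    ⊆0 none {v} v∈ i with v i K.≟ 0#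
    ... | yes z = z
    ... | no nz = ⊥-elim (none (v , v∈ , λ v≋0 → nz (v≋0 i)))
    certificate : Dec NonZeroVector → ∃ (Certificate (encode t))
    certificate (yes (v , v∈ , v≉0)) = vector⇒certificate pythagorean t a v∈ v≉0
    certificate (no none) = ⊥-elim (ne (⊆0 none , λ {v} v≋0 → resp A (λ i → K.sym (v≋0 i)) (0∈ A)))

-- Square roots of nonnegative reals

module SquareRoots (ℝ : RealNumbers) where

  open import Data.Empty using (⊥; ⊥-elim)
  open import Data.Integer.Base using (+_)
  open import Data.Product.Base using (∃; _,_; proj₁; proj₂)
  open import Relation.Binary.Definitions using (tri<; tri≈; tri>)
  open import Relation.Nullary.Negation.Core using (¬_)
  open import Relation.Unary using (_∈_)

  open RealNumbers ℝ hiding (zero)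
  open OrderedFieldProperties orderedField

  private
    -- The inverse h equals x h², a product of positive numbers.
    inverse-positive : ∀ {x} (p : 0# < x) → 0# < inverse (0<x⇒x≉0 p)
    inverse-positive {x} p = <-respʳ-≈ (trans (solve 2 (λ x h → x :* (h :* h) := x :* h :* h) refl x h)
        (trans (*-congʳ (inverseʳ x≉0)) (*-identityˡ h)))
      (*-positive p (≉0⇒0<x² λ h≈0 → 1≉0 (trans (sym (inverseʳ x≉0)) (trans (*-congˡ h≈0) (zeroʳ x)))))
      where
      x≉0 = 0<x⇒x≉0 p
      h = inverse x≉0

    square-mono : ∀ {x y} → 0# < x → x < y → x * x < y * y
    square-mono {x} {y} p q = 0<y-x⇒x<y (<-respʳ-≈
      (solve 2 (λ x y → (y :- x) :* (x :+ y) := y :* y :- x :* x) refl x y)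
      (*-positive (x<y⇒0<y-x q) (0<x+y p (<-trans p q))))

    0≤-cases : ∀ {x} {A : Set} → 0# ≤ x → (0# < x → A) → (x ≈ 0# → A) → A
    0≤-cases {x} p f g with compare x 0#
    ... | tri< x<0 _ _ = ⊥-elim (p x<0)
    ... | tri≈ _ x≈0 _ = g x≈0
    ... | tri> _ _ 0<x = f 0<x

    0<-+0≤ : ∀ {x y} → 0# ≤ x → 0# < y → 0# < x + y
    0<-+0≤ p q = <-respʳ-≈ (+-comm _ _) (0<x+y-≤ q p)

    0≤* : ∀ {x y} → 0# ≤ x → 0# ≤ y → 0# ≤ x * y
    0≤* {x} {y} p q = 0≤-cases p
      (λ 0<x → 0≤-cases q (λ 0<y r → irrefl refl (<-trans r (*-positive 0<x 0<y)))
                          (λ y≈0 r → irrefl (trans (*-congˡ y≈0) (zeroʳ x)) r))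
      (λ x≈0 r → irrefl (trans (*-congʳ x≈0) (zeroˡ y)) r)

  -- The root is the supremum of the numbers whose square does not exceed x. A square below x would
  -- allow a larger such number, and a square above x a smaller upper bound.
  sqrt : ∀ x → 0# ≤ x → ∃ λ y → x ≈ y * y
  sqrt x 0≤x with supremum (λ y → ¬ (x < y * y)) (0# , λ p → 0≤x (<-respʳ-≈ (zeroˡ 0#) p)) (1# + x , bounded)
    where
    bounded : UpperBound (λ y → ¬ (x < y * y)) (1# + x)
    bounded {y} y∈ 1+x<y = y∈ (0<y-x⇒x<y (<-respʳ-≈
      (solve 2 (λ x y → y :* y :- x := y :* y :- x) refl x y)
      -- The bound 1 + x works because its square exceeds x by 1 + x + x².
      (<-respʳ-≈ (solve 2 (λ x y → (y :- (con (+ 1) :+ x)) :* (con (+ 1) :+ x :+ y) :+ (con (+ 1) :+ (x :+ x :* x)) := y :* y :- x) refl x y)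
        (0<x+y (*-positive (x<y⇒0<y-x 1+x<y) (0<x+y 0<1+x (<-trans 0<1+x 1+x<y)))
               (0<x+y-≤ 0<1 (0≤x+y 0≤x (0≤x² x)))))))
      where
      0<1+x : 0# < 1# + x
      0<1+x = 0<x+y-≤ 0<1 0≤x
  ... | s , upper , least with compare (s * s) x
  ...   | tri≈ _ ss≈x _ = s , sym ss≈x
  -- With D = 2 s + 1 + x and ε = (x - s²) / D, the square of s + ε is still below x.
  ...   | tri< ss<x _ _ = ⊥-elim (upper r∈ s<r)
    where
    0≤s : 0# ≤ s
    0≤s = upper λ p → 0≤x (<-respʳ-≈ (zeroˡ 0#) p)
    D = (s + s) + (1# + x)
    0<D : 0# < D
    0<D = 0<-+0≤ (0≤x+y 0≤s 0≤s) (0<x+y-≤ 0<1 0≤x)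
    h = inverse (0<x⇒x≉0 0<D)
    Dh≈1 = inverseʳ (0<x⇒x≉0 0<D)
    0<h = inverse-positive 0<D
    ε = (x - s * s) * h
    0<ε : 0# < ε
    0<ε = *-positive (x<y⇒0<y-x ss<x) 0<h
    r = s + ε
    s<r : s < r
    s<r = <-respˡ-≈ (+-identityʳ s) (+-monoʳ-< s 0<ε)
    -- Since x - s² = ε D, the difference x - r² is ε (1 + x - ε), and multiplying 1 + x - ε by D
    -- gives `Q`. Expanded, `Q` is 1 plus nonnegative terms.
    Q = (1# + x) * D - (x - s * s)
    0<Q : 0# < Q
    0<Q = <-respʳ-≈ (solve 2 (λ s x → con (+ 1) :+ (x :+ (x :* x :+ (s :* s :+ (s :+ s) :* (con (+ 1) :+ x))))
        := (con (+ 1) :+ x) :* ((s :+ s) :+ (con (+ 1) :+ x)) :- (x :- s :* s)) refl s x)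
      (0<x+y-≤ 0<1 (0≤x+y 0≤x (0≤x+y (0≤x² x) (0≤x+y (0≤x² s) (0≤* (0≤x+y 0≤s 0≤s) λ p → irrefl refl (<-trans p (0<x+y-≤ 0<1 0≤x)))))))
    x-rr : ε * (h * Q) ≈ x - r * r
    x-rr = trans (solve 4 (λ s x h d → (x :- s :* s) :* h :* (h :* ((con (+ 1) :+ x) :* d :- (x :- s :* s)))
          := (x :- s :* s) :* h :* ((con (+ 1) :+ x) :* (d :* h) :- (x :- s :* s) :* h)) refl s x h D)
      (trans (*-congˡ (+-congʳ (trans (*-congˡ Dh≈1) (*-identityʳ _))))
        (trans (solve 3 (λ s x e → e :* (con (+ 1) :+ x :- e) := e :* (s :+ s :+ (con (+ 1) :+ x)) :- (s :+ s) :* e :- e :* e) refl s x ε)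
          (trans (+-congʳ (+-congʳ (trans (*-assoc _ h D) (trans (*-congˡ (trans (*-comm h D) Dh≈1)) (*-identityʳ _)))))
            (solve 3 (λ s x e → x :- s :* s :- (s :+ s) :* e :- e :* e := x :- (s :+ e) :* (s :+ e)) refl s x ε))))
    r∈ : ¬ (x < r * r)
    r∈ p = irrefl refl (<-trans p (0<y-x⇒x<y (<-respʳ-≈ x-rr (*-positive 0<ε (*-positive 0<h 0<Q)))))
  -- Newton's step s - (s² - x) / (2 s) is a smaller upper bound.
  ...   | tri> _ _ x<ss = ⊥-elim (least upper′ s′<s)
    where
    0≤s : 0# ≤ s
    0≤s = upper λ p → 0≤x (<-respʳ-≈ (zeroˡ 0#) p)
    0<s : 0# < s
    0<s = 0≤-cases 0≤s (λ p → p) (λ s≈0 → ⊥-elim (0≤x (<-respʳ-≈ (trans (*-congʳ s≈0) (zeroˡ s)) x<ss)))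
    0<2s = 0<x+y 0<s 0<s
    h = inverse (0<x⇒x≉0 0<2s)
    2sh≈1 = inverseʳ (0<x⇒x≉0 0<2s)
    0<h = inverse-positive 0<2s
    δ = (s * s - x) * h
    0<δ = *-positive (x<y⇒0<y-x x<ss) 0<h
    s′ = s - δ
    s′<s : s′ < s
    s′<s = 0<y-x⇒x<y (<-respʳ-≈ (solve 2 (λ s d → d := s :- (s :- d)) refl s δ) 0<δ)
    2sδ : (s + s) * δ ≈ s * s - x
    2sδ = trans (solve 3 (λ a b h → a :* (b :* h) := b :* (a :* h)) refl (s + s) (s * s - x) h)
      (trans (*-congˡ 2sh≈1) (*-identityʳ _))
    s≈ : s ≈ (s + s) * (s * h)
    s≈ = trans (sym (*-identityʳ s)) (trans (*-congˡ (sym 2sh≈1)) (solve 3 (λ s a h → s :* (a :* h) := a :* (s :* h)) refl s (s + s) h))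
    0<s′ : 0# < s′
    0<s′ = <-respʳ-≈ (trans (solve 3 (λ s x h → (x :+ s :* s) :* h := (s :+ s) :* (s :* h) :- (s :* s :- x) :* h) refl s x h) (+-congʳ (sym s≈)))
      (*-positive (0<-+0≤ 0≤x (*-positive 0<s 0<s)) 0<h)
    -- By the choice of `δ` the linear term of the square removes exactly the excess of s² over x,
    -- and only δ² remains.
    s′s′ : s′ * s′ ≈ x + δ * δ
    s′s′ = trans (solve 2 (λ s d → (s :- d) :* (s :- d) := s :* s :- (s :+ s) :* d :+ d :* d) refl s δ)
      (trans (+-congʳ (+-congˡ (-‿cong 2sδ))) (solve 3 (λ s x e → s :- (s :- x) :+ e := x :+ e) refl (s * s) x (δ * δ)))
    upper′ : UpperBound (λ y → ¬ (x < y * y)) s′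
    upper′ {y} y∈ s′<y = y∈ (<-trans (<-respˡ-≈ (+-identityʳ x) (<-respʳ-≈ (sym s′s′) (+-monoʳ-< x (*-positive 0<δ 0<δ))))
      (square-mono 0<s′ s′<y))

-- Subfields of the complex numbers and the complexity class

module Theorem (em : ∀ {ℓ} → ExcludedMiddle ℓ) (ℝ : RealNumbers) where

  open import Algebra.Bundles using (CommutativeRing)
  import Algebra.Properties.Ring as RingProperties
  open import Data.Nat.Base using (ℕ; zero; suc)
  open import Data.Product.Base using (∃; _,_; proj₁; proj₂)
  open import Data.Sum.Base using (inj₁; inj₂)
  open import Data.Vec.Functional using (Vector; tail)
  open import Function.Base using (id; _∘_)
  open import Function.Bundles using (mk⇔; Equivalence)
  open import Relation.Binary.PropositionalEquality using (refl)
  open import Relation.Unary using (_∈_)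

  open Complex ℝ
  open StarSubfield
  open BSS
  private module R = RealNumbers ℝ
  open RingProperties R.ring using (-0#≈0#)
  open IntegerRingSolver R.commutativeRing using (solve; _:=_; _:-_; _:*_; _:+_; con)

  -- An isomorphism of K with the field 𝔽 ∩ ℝ.
  record RealPart (K : OrderedField) (𝔽 : StarSubfield) : Set where
    private module K = OrderedField K
    field
      ι         : K.Carrier → R.Carrier
      injective : ∀ {x y} → ι x R.≈ ι y → x K.≈ y
      ι-+       : ∀ x y → ι (x K.+ y) R.≈ ι x R.+ ι y
      ι-*       : ∀ x y → ι (x K.* y) R.≈ ι x R.* ι y
      ι--       : ∀ x → ι (K.- x) R.≈ R.- ι x
      ι-0       : ι K.0# R.≈ R.0#
      ι-cong    : ∀ {x y} → x K.≈ y → ι x R.≈ ι y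
      ι∈        : ∀ x → ι x ∈ 𝔽∩ℝ 𝔽
      ι-onto    : ∀ {r} → r ∈ 𝔽∩ℝ 𝔽 → ∃ λ x → ι x R.≈ r

  module _ (K : OrderedField) (𝔽 : StarSubfield) (standing : StandingAssumption 𝔽) (iso : RealPart K 𝔽) where

    open RealPart iso
    private
      module K = OrderedField K
      module F = CommutativeRing (Complex.StarSubfield.field𝔽 {ℝ} 𝔽)

      parts : ∀ {a b} → (a , b) ∈ member 𝔽 → (a ∈ 𝔽∩ℝ 𝔽) × (b ∈ 𝔽∩ℝ 𝔽)
      parts = split standing
        where
        split : StandingAssumption 𝔽 → ∀ {a b} → (a , b) ∈ member 𝔽 → (a ∈ 𝔽∩ℝ 𝔽) × (b ∈ 𝔽∩ℝ 𝔽)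
        split (inj₁ real) p = resp 𝔽 (R.refl , real p) p , resp 𝔽 (R.sym (real p) , R.refl) (0∈ 𝔽)
        split (inj₂ splits) p = Equivalence.to splits p

      re im : F.Carrier → K.Carrier
      re (_ , p) = proj₁ (ι-onto (proj₁ (parts p)))
      im (_ , p) = proj₁ (ι-onto (proj₂ (parts p)))

      ι-re : ∀ x → ι (re x) R.≈ proj₁ (proj₁ x)
      ι-re (_ , p) = proj₂ (ι-onto (proj₁ (parts p)))

      ι-im : ∀ x → ι (im x) R.≈ proj₂ (proj₁ x)
      ι-im (_ , p) = proj₂ (ι-onto (proj₂ (parts p)))


    starExtension : StarExtension (OrderedField.commutativeRing K) (Complex.StarSubfield.field𝔽 {ℝ} 𝔽) (Complex.StarSubfield.conj {ℝ} 𝔽)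
    starExtension = record
      { re = re ; im = im
      ; re-cong = λ {x} {y} (e , _) → injective (R.trans (ι-re x) (R.trans e (R.sym (ι-re y))))
      ; im-cong = λ {x} {y} (_ , e) → injective (R.trans (ι-im x) (R.trans e (R.sym (ι-im y))))
      ; injective = λ {x} {y} e e′ → R.trans (R.sym (ι-re x)) (R.trans (ι-cong e) (ι-re y)) ,
                                     R.trans (R.sym (ι-im x)) (R.trans (ι-cong e′) (ι-im y))
      ; re-0 = injective (R.trans (ι-re F.0#) (R.sym ι-0))
      ; im-0 = injective (R.trans (ι-im F.0#) (R.sym ι-0))
      ; re-+ = λ x y → injective (R.trans (ι-re (x F.+ y)) (R.sym (R.trans (ι-+ _ _) (R.+-cong (ι-re x) (ι-re y)))))
      ; im-+ = λ x y → injective (R.trans (ι-im (x F.+ y)) (R.sym (R.trans (ι-+ _ _) (R.+-cong (ι-im x) (ι-im y)))))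
      ; re-* = λ x y → injective (R.trans (ι-re (x F.* y)) (R.sym (R.trans (ι-+ _ _) (R.+-cong
          (R.trans (ι-* _ _) (R.*-cong (ι-re x) (ι-re y)))
          (R.trans (ι-- _) (R.-‿cong (R.trans (ι-* _ _) (R.*-cong (ι-im x) (ι-im y)))))))))
      ; im-* = λ x y → injective (R.trans (ι-im (x F.* y)) (R.sym (R.trans (ι-+ _ _) (R.+-cong
          (R.trans (ι-* _ _) (R.*-cong (ι-re x) (ι-im y))) (R.trans (ι-* _ _) (R.*-cong (ι-im x) (ι-re y)))))))
      ; re-conj = λ x → injective (R.trans (ι-re (conj 𝔽 x)) (R.sym (ι-re x)))
      ; im-conj = λ x → injective (R.trans (ι-im (conj 𝔽 x)) (R.sym (R.trans (ι-- _) (R.-‿cong (ι-im x)))))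
      ; kind = kinds standing
      }
      where
      kinds : StandingAssumption 𝔽 → _
      kinds (inj₁ real) = inj₁
        ( (λ x → injective (R.trans (ι-im x) (R.trans (real (proj₂ x)) (R.sym ι-0))))
        , λ k → let x = (ι k , R.0#) , ι∈ k in x , injective (ι-re x) )
      kinds (inj₂ split) = inj₂ λ k l →
        let x = (ι k , ι l) , Equivalence.from split (ι∈ k , ι∈ l)
        in x , injective (ι-re x) , injective (ι-im x)

  ReField-realPart : ∀ 𝔽 → StandingAssumption 𝔽 → RealPart (Complex.StarSubfield.ReField {ℝ} 𝔽) 𝔽
  ReField-realPart 𝔽 standing = record
    { ι = proj₁ ; injective = λ e → e ; ι-cong = λ e → e
    ; ι-+ = λ _ _ → R.refl ; ι-* = λ _ _ → R.refl ; ι-- = λ _ → R.refl ; ι-0 = R.refl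
    ; ι∈ = λ (x , y , p) → real-part standing p
    ; ι-onto = λ {r} p → (r , R.0# , p) , R.refl
    }
    where
    real-part : StandingAssumption 𝔽 → ∀ {x y} → (x , y) ∈ member 𝔽 → x ∈ 𝔽∩ℝ 𝔽
    real-part (inj₁ real)  p = resp 𝔽 (R.refl , real p) p
    real-part (inj₂ split) p = proj₁ (Equivalence.to split p)

  -- One ordered field thus represents the real part of both `𝔽` and `ReSubfield 𝔽`, so (b) follows
  -- by passing through the lattices over it.
  ReSubfield-realPart : ∀ 𝔽 → RealPart (Complex.StarSubfield.ReField {ℝ} 𝔽) (Complex.ReSubfield ℝ 𝔽)
  ReSubfield-realPart 𝔽 = record
    { ι = proj₁ ; injective = λ e → e ; ι-cong = λ e → e
    ; ι-+ = λ _ _ → R.refl ; ι-* = λ _ _ → R.refl ; ι-- = λ _ → R.refl ; ι-0 = R.refl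
    ; ι∈ = λ (x , p) → p , R.refl
    ; ι-onto = λ {r} (p , _) → (r , p) , R.refl
    }

  -- The machine is to compute over the given reals and not over their copy inside the complex
  -- numbers, hence an identification of its own.
  ℝ-realPart : RealPart (RealNumbers.orderedField ℝ) (Complex.ℝ-subfield ℝ)
  ℝ-realPart = record
    { ι = λ x → x ; injective = λ e → e ; ι-cong = λ e → e
    ; ι-+ = λ _ _ → R.refl ; ι-* = λ _ _ → R.refl ; ι-- = λ _ → R.refl ; ι-0 = R.refl
    ; ι∈ = λ _ → _ , R.refl
    ; ι-onto = λ {r} _ → r , R.refl
    }

  ℂ-realPart : RealPart (RealNumbers.orderedField ℝ) (Complex.ℂ-subfield ℝ)
  ℂ-realPart = record
    { ι = λ x → x ; injective = λ e → e ; ι-cong = λ e → e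
    ; ι-+ = λ _ _ → R.refl ; ι-* = λ _ _ → R.refl ; ι-- = λ _ → R.refl ; ι-0 = R.refl
    ; ι∈ = λ _ → _
    ; ι-onto = λ {r} _ → r , R.refl
    }

  module _ (K : OrderedField) (𝔽 : StarSubfield) (standing : StandingAssumption 𝔽) (iso : RealPart K 𝔽) where

    private
      module C = Certificates em K
      -- The names of Defs themselves are used, since type checking is slow through their copies.
      weak-record : ∀ t → Complex.WeaklySatisfiable* ℝ 𝔽 t → Weak* (Complex.StarSubfield.field𝔽 {ℝ} 𝔽) (Complex.StarSubfield.conj {ℝ} 𝔽) t
      weak-record t (d , nz , w) = weak* d nz w

      record-weak : ∀ t → Weak* (Complex.StarSubfield.field𝔽 {ℝ} 𝔽) (Complex.StarSubfield.conj {ℝ} 𝔽) t → Complex.WeaklySatisfiable* ℝ 𝔽 t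
      record-weak t (weak* d nz w) = d , nz , w

      strong-record : ∀ t → Complex.StronglySatisfiable* ℝ 𝔽 t → Strong* (Complex.StarSubfield.field𝔽 {ℝ} 𝔽) (Complex.StarSubfield.conj {ℝ} 𝔽) t
      strong-record t (d , nz , w) = strong* d nz w

      record-strong : ∀ t → Strong* (Complex.StarSubfield.field𝔽 {ℝ} 𝔽) (Complex.StarSubfield.conj {ℝ} 𝔽) t → Complex.StronglySatisfiable* ℝ 𝔽 t
      record-strong t (strong* d nz w) = d , nz , w

      E = starExtension K 𝔽 standing iso

    restrict-weak : ∀ t → Complex.WeaklySatisfiable* ℝ 𝔽 t → Weak* (OrderedField.commutativeRing K) id t
    restrict-weak t w = Extension.restrict-weak (OrderedField.commutativeRing K) (Complex.StarSubfield.field𝔽 {ℝ} 𝔽) (Complex.StarSubfield.conj {ℝ} 𝔽) E t (weak-record t w)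

    extend-weak : ∀ t → Weak* (OrderedField.commutativeRing K) id t → Complex.WeaklySatisfiable* ℝ 𝔽 t
    extend-weak t w = record-weak t (Extension.extend-weak (OrderedField.commutativeRing K) (Complex.StarSubfield.field𝔽 {ℝ} 𝔽) (Complex.StarSubfield.conj {ℝ} 𝔽) E t w)

    restrict-strong : ∀ t → Complex.StronglySatisfiable* ℝ 𝔽 t → Strong* (OrderedField.commutativeRing K) id t
    restrict-strong t w = Extension.restrict-strong (OrderedField.commutativeRing K) (Complex.StarSubfield.field𝔽 {ℝ} 𝔽) (Complex.StarSubfield.conj {ℝ} 𝔽) E t (strong-record t w)

    extend-strong : ∀ t → Strong* (OrderedField.commutativeRing K) id t → Complex.StronglySatisfiable* ℝ 𝔽 t
    extend-strong t w = record-strong t (Extension.extend-strong (OrderedField.commutativeRing K) (Complex.StarSubfield.field𝔽 {ℝ} 𝔽) (Complex.StarSubfield.conj {ℝ} 𝔽) E t w)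

    sat∈NP : LinearAlgebra.Pythagorean em K → BSS.BP K (BSS.NP K) (Complex.sat ℝ 𝔽)
    sat∈NP pythagorean =
      let (M , polynomial , accepts⇔) = Verifiers.certificate-NP K
      -- The language consists of all inputs accepted, binary or not; `BP` looks only at the binary
      -- ones.
      in Accepts K M , (M , polynomial , (λ a → a) , (λ a → a)) ,
         (λ { {w} (t , refl , ws) → Equivalence.from (accepts⇔ w) (C.satisfiable⇒certificate pythagorean t (restrict-weak t ws)) }) ,
         λ {w} acc → let (G , c) = Equivalence.to (accepts⇔ w) acc
                         (t , e , ws) = C.certificate⇒encoding w {G} c
                     in t , e , extend-weak t ws

  module _ (𝔽 : StarSubfield) (standing : StandingAssumption 𝔽) where

    private
      re = ReField-realPart 𝔽 standing
      re′ = ReSubfield-realPart 𝔽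
      standing′ : StandingAssumption (Complex.ReSubfield ℝ 𝔽)
      standing′ = inj₁ proj₂

    weak⇒Re : ∀ t → Complex.WeaklySatisfiable* ℝ 𝔽 t → Complex.WeaklySatisfiable* ℝ (Complex.ReSubfield ℝ 𝔽) t
    weak⇒Re t w = extend-weak (Complex.StarSubfield.ReField {ℝ} 𝔽) (Complex.ReSubfield ℝ 𝔽) standing′ re′ t (restrict-weak (Complex.StarSubfield.ReField {ℝ} 𝔽) 𝔽 standing re t w)

    Re⇒weak : ∀ t → Complex.WeaklySatisfiable* ℝ (Complex.ReSubfield ℝ 𝔽) t → Complex.WeaklySatisfiable* ℝ 𝔽 t
    Re⇒weak t w = extend-weak (Complex.StarSubfield.ReField {ℝ} 𝔽) 𝔽 standing re t (restrict-weak (Complex.StarSubfield.ReField {ℝ} 𝔽) (Complex.ReSubfield ℝ 𝔽) standing′ re′ t w)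

    strong⇒Re : ∀ t → Complex.StronglySatisfiable* ℝ 𝔽 t → Complex.StronglySatisfiable* ℝ (Complex.ReSubfield ℝ 𝔽) t
    strong⇒Re t w = extend-strong (Complex.StarSubfield.ReField {ℝ} 𝔽) (Complex.ReSubfield ℝ 𝔽) standing′ re′ t (restrict-strong (Complex.StarSubfield.ReField {ℝ} 𝔽) 𝔽 standing re t w)

    Re⇒strong : ∀ t → Complex.StronglySatisfiable* ℝ (Complex.ReSubfield ℝ 𝔽) t → Complex.StronglySatisfiable* ℝ 𝔽 t
    Re⇒strong t w = extend-strong (Complex.StarSubfield.ReField {ℝ} 𝔽) 𝔽 standing re t (restrict-strong (Complex.StarSubfield.ReField {ℝ} 𝔽) (Complex.ReSubfield ℝ 𝔽) standing′ re′ t w)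

    ReField-pythagorean : Pythagorean 𝔽 → LinearAlgebra.Pythagorean em (Complex.StarSubfield.ReField {ℝ} 𝔽)
    ReField-pythagorean pythagorean x =
      let (y , y∈ , e) = pythagorean _ (proj₁ ∘ x) (λ i → RealPart.ι∈ re (x i))
      in (y , R.0# , y∈) , R.trans (value x) e
      where
      value : ∀ {n} (x : Vector (OrderedField.Carrier (Complex.StarSubfield.ReField {ℝ} 𝔽)) n) →
        proj₁ (LinearAlgebra.dot em (Complex.StarSubfield.ReField {ℝ} 𝔽) x x) R.≈ OrderedFieldProperties.sum R.orderedField (λ i → proj₁ (x i) R.* proj₁ (x i))
      value {zero}  x = R.refl
      value {suc n} x = R.+-congˡ (value (tail x))

  ℝ-pythagorean : LinearAlgebra.Pythagorean em (RealNumbers.orderedField ℝ)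
  ℝ-pythagorean x = SquareRoots.sqrt ℝ _ (OrderedFieldProperties.0≤sum² R.orderedField x)

-- Complex is not opened at ℝ, which would make type checking take hours: it introduces copies of
-- the definitions, and conversion between a copy and its original unfolds whole ortholattices.
open Complex using
  (StarSubfield; ReSubfield; ℝ-subfield; ℂ-subfield; SAT; sat; WeaklySatisfiable*; StronglySatisfiable*)
open Complex.StarSubfield using (StandingAssumption; Pythagorean; ReField)
open BSS using (BP; NP)

theorem6p2 :
    (∀ {ℓ} → ExcludedMiddle ℓ) →
    (ℝ : RealNumbers) →
    let ℝ-field = RealNumbers.orderedField ℝ
    in
    ((∀ (𝔽 : StarSubfield ℝ) → StandingAssumption 𝔽 → Pythagorean 𝔽 →
        BP (ReField 𝔽) (NP (ReField 𝔽)) (sat ℝ 𝔽)) ×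
     BP ℝ-field (NP ℝ-field) (sat ℝ (ℝ-subfield ℝ)) ×
     BP ℝ-field (NP ℝ-field) (sat ℝ (ℂ-subfield ℝ))) ×
    (∀ (𝔽 : StarSubfield ℝ) → StandingAssumption 𝔽 →
      (∀ t → (WeaklySatisfiable* ℝ 𝔽 t ⇔ WeaklySatisfiable* ℝ (ReSubfield ℝ 𝔽) t) ×
             (StronglySatisfiable* ℝ 𝔽 t ⇔ StronglySatisfiable* ℝ (ReSubfield ℝ 𝔽) t)) ×
      (SAT ℝ 𝔽 ≐ SAT ℝ (ReSubfield ℝ 𝔽)) ×
      (sat ℝ 𝔽 ≐ sat ℝ (ReSubfield ℝ 𝔽)))
theorem6p2 em ℝ =
  ( (λ 𝔽 standing pythagorean →
       sat∈NP (ReField 𝔽) 𝔽 standing (ReField-realPart 𝔽 standing) (ReField-pythagorean 𝔽 standing pythagorean))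
  , sat∈NP (RealNumbers.orderedField ℝ) (ℝ-subfield ℝ) (inj₁ proj₂) ℝ-realPart ℝ-pythagorean
  , sat∈NP (RealNumbers.orderedField ℝ) (ℂ-subfield ℝ) (inj₂ (mk⇔ _ _)) ℂ-realPart ℝ-pythagorean ) ,
  λ 𝔽 standing →
    (λ t → mk⇔ (weak⇒Re 𝔽 standing t) (Re⇒weak 𝔽 standing t) , mk⇔ (strong⇒Re 𝔽 standing t) (Re⇒strong 𝔽 standing t)) ,
    ( (λ (t , e , s) → t , e , strong⇒Re 𝔽 standing t s)
    , (λ (t , e , s) → t , e , Re⇒strong 𝔽 standing t s) ) ,
    ( (λ (t , e , s) → t , e , weak⇒Re 𝔽 standing t s)
    , (λ (t , e , s) → t , e , Re⇒weak 𝔽 standing t s) )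
  where
  open import Data.Product.Base using (_,_; proj₂)
  open import Data.Sum.Base using (inj₁; inj₂)
  open import Function.Bundles using (mk⇔)
  open Theorem em ℝ
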